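{- Let $q$ be a power of a prime $p$, and let $h(x) = x^6 + a_1 x^5 + a_2 x^4 + a_3 x^3 + a_2 q x^2 + a_1 q^2 x + q^3$ with $a_1,a_2,a_3 \in \mathbb{Z}$. Then $h(x) \in W_q(3)$ if and only if all of the following hold: (a) $|a_1| \leq 6\sqrt{q}$; (b*) $4\sqrt{q}\,|a_1| - 9q \leq a_2$; (b) $a_2 \leq \frac{1}{3}a_1^2 + 3q$; (c) $-\frac{2}{27}a_1^3 + \frac{1}{3}a_1a_2 + qa_1 - \frac{2}{27}(a_1^2 - 3a_2 + 9q)^{3/2} \leq a_3 \leq -\frac{2}{27}a_1^3 + \frac{1}{3}a_1a_2 + qa_1 + \frac{2}{27}(a_1^2 - 3a_2 + 9q)^{3/2}$; (d) $-2qa_1 - 2\sqrt{q}\,a_2 - 2q\sqrt{q} \leq a_3 \leq -2qa_1 + 2\sqrt{q}\,a_2 + 2q\sqrt{q}$; where the quantity $a_1^2 - 3a_2 + 9q$ in (c) is a non-negative real number by (b). Moreover, a polynomial $h(x) \in W_q(3)$ has a real root if and only if at least one of the inequalities in (a), (b*) or (d) is an equality. Explicitly, $h(x)$ lies in $W_q(3)$ and has a real root if and only if there are non-negative integers $k,\ell$ such that exactly one of the following (mutually exclusive) cases occurs: (I) $q$ is not a square and $h(x) = (x^2-q)^2 h_0(x)$ with $h_0(x) \in W_q(1)$; (II) $q$ is a square, $k+\ell = 3$ and $h(x) = (x+\sqrt{q})^{2k}(x-\sqrt{q})^{2\ell}$; (III) $q$ is a square, $k+\ell=2$ and $h(x)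 = (x+\sqrt{q})^{2k}(x-\sqrt{q})^{2\ell}h_0(x)$ with $h_0(x) \in W_q(1)$ having no real roots; (IV) $q$ is a square, $k+\ell = 1$ and $h(x) = (x+\sqrt{q})^{2k}(x-\sqrt{q})^{2\ell}h_0(x)$ with $h_0(x) \in W_q(2)$ having no real roots.
   Context: A $q$-Weil polynomial is a monic polynomial in $\mathbb{Z}[x]$ of even positive degree $2g$ whose set of complex roots has the form $\{w_1,\bar w_1,\ldots,w_g,\bar w_g\}$ with $|w_i| = \sqrt{q}$ for every $i$. $W_q(g)$ denotes the set of $q$-Weil polynomials of degree $2g$. For a positive real $r$, $\sqrt[n]{r} = r^{1/n}$ denotes the positive real $n$-th root (so $(\cdot)^{3/2}$ of a non-negative real is non-negative real). -}

module Defs where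

open import Algebra.Bundles.Raw using (RawRing)
import Algebra.Definitions.RawSemiring as RawSemiringDefs
open import Data.Fin.Base using (Fin)
open import Data.Integer.Base as ℤ using (ℤ; +_; -[1+_]; +≤+; +<+; -≤+)
import Data.Integer.Properties as ℤP
open import Data.Integer.Solver using () renaming (module +-*-Solver to ℤSolver)
open import Data.List.Base using (List; []; _∷_; map; foldr)
open import Data.Nat.Base as ℕ using (ℕ; zero; suc)
import Data.Nat.Properties as ℕP
open import Data.Product using (∃; _×_; _,_)
open import Data.Rational.Base as ℚ using (ℚ)
import Data.Rational.Properties as ℚP
open import Data.Rational.Solver using (module +-*-Solver)
import Data.Rational.Unnormalised as ℚᵘ
import Data.Rational.Unnormalised.Properties as ℚᵘP
open import Data.Sum using (_⊎_; inj₁; inj₂)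
open import Level using (0ℓ)
open import Relation.Binary.Definitions using (tri<; tri≈; tri>)
open import Relation.Binary.PropositionalEquality
open import Relation.Nullary using (¬_; yes; no; contradiction)

module CauchySequences where

  open import Data.Rational.Base
  open ℚP using (_≤?_)

  abstract
    half : ∀ {ε} → 0ℚ < ε → 0ℚ < ½ * ε
    half {ε} p = subst (_< ½ * ε) (ℚP.*-zeroʳ ½) (ℚP.*-monoʳ-<-pos ½ p)

    half+half : ∀ ε → ½ * ε + ½ * ε ≡ ε
    half+half ε = trans (sym (ℚP.*-distribʳ-+ ε ½ ½)) (ℚP.*-identityˡ ε)

    0<1 : 0ℚ < 1ℚ
    0<1 = ℚP.positive⁻¹ 1ℚ

    /-< : ∀ a d b e → a ℕ.* suc e ℕ.< b ℕ.* suc d → + a / suc d < + b / suc e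
    /-< a d b e p = ℚP.toℚᵘ-cancel-<
      (ℚᵘP.<-respˡ-≃ (ℚᵘP.≃-sym (ℚP.toℚᵘ-fromℚᵘ (ℚᵘ.mkℚᵘ (+ a) d)))
      (ℚᵘP.<-respʳ-≃ (ℚᵘP.≃-sym (ℚP.toℚᵘ-fromℚᵘ (ℚᵘ.mkℚᵘ (+ b) e)))
        (ℚᵘ.*<* (subst₂ ℤ._<_ (ℤP.pos-* a (suc e)) (ℤP.pos-* b (suc d)) (+<+ p)))))

    /-≤ : ∀ a d b e → a ℕ.* suc e ℕ.≤ b ℕ.* suc d → + a / suc d ≤ + b / suc e
    /-≤ a d b e p = ℚP.toℚᵘ-cancel-≤
      (ℚᵘP.≤-respˡ-≃ (ℚᵘP.≃-sym (ℚP.toℚᵘ-fromℚᵘ (ℚᵘ.mkℚᵘ (+ a) d)))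
      (ℚᵘP.≤-respʳ-≃ (ℚᵘP.≃-sym (ℚP.toℚᵘ-fromℚᵘ (ℚᵘ.mkℚᵘ (+ b) e)))
        (ℚᵘ.*≤* (subst₂ ℤ._≤_ (ℤP.pos-* a (suc e)) (ℤP.pos-* b (suc d)) (+≤+ p)))))

    0≤/ : ∀ a d → 0ℚ ≤ + a / suc d
    0≤/ a d = /-≤ 0 0 a d ℕ.z≤n

    suc/ : ∀ a d → + suc a / suc d ≡ + a / suc d + + 1 / suc d
    suc/ a d = ℚP.toℚᵘ-injective (begin
      toℚᵘ (+ suc a / suc d)        ≈⟨ ℚP.toℚᵘ-fromℚᵘ (ℚᵘ.mkℚᵘ (+ suc a) d) ⟩
      ℚᵘ.mkℚᵘ (+ suc a) d           ≈⟨ ℚᵘ.*≡* (lem (+ a) (+ suc d)) ⟩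
      ℚᵘ.mkℚᵘ (+ a) d ℚᵘ.+ ℚᵘ.mkℚᵘ (+ 1) d
        ≈⟨ ℚᵘP.+-cong (ℚP.toℚᵘ-fromℚᵘ (ℚᵘ.mkℚᵘ (+ a) d)) (ℚP.toℚᵘ-fromℚᵘ (ℚᵘ.mkℚᵘ (+ 1) d)) ⟨
      toℚᵘ (+ a / suc d) ℚᵘ.+ toℚᵘ (+ 1 / suc d) ≈⟨ ℚP.toℚᵘ-homo-+ (+ a / suc d) (+ 1 / suc d) ⟨
      toℚᵘ (+ a / suc d + + 1 / suc d) ∎)
      where
      open ℚᵘP.≃-Reasoning
      open ℤSolver
      lem : ∀ a d → (+ 1 ℤ.+ a) ℤ.* (d ℤ.* d) ≡ (a ℤ.* d ℤ.+ + 1 ℤ.* d) ℤ.* d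
      lem = solve 2 (λ a d → (con (+ 1) :+ a) :* (d :* d) := (a :* d :+ con (+ 1) :* d) :* d) refl

    archimedean : ∀ ε → 0ℚ < ε → ∃ λ N → ∀ n → N ℕ.≤ n → + 1 / suc n < ε
    archimedean (mkℚ (+ suc a) d c) p = suc d , λ n d≤n →
      subst (+ 1 / suc n <_) (ℚP.↥p/↧p≡p (mkℚ (+ suc a) d c))
        (/-< 1 n (suc a) d (subst (ℕ._< suc n ℕ.+ a ℕ.* suc n) (sym (ℕP.*-identityˡ (suc d))) (ℕP.m≤n⇒m≤n+o _ (ℕ.s≤s d≤n))))
    archimedean (mkℚ (+ zero) d c) (*<* (+<+ p)) = contradiction p (λ ())
    archimedean (mkℚ -[1+ a ] d c) (*<* ())

    sq-cancel-< : ∀ a b → 0ℚ ≤ b → a * a < b * b → a < b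
    sq-cancel-< a b 0≤b p with ℚP.<-cmp a b
    ... | tri< q _ _ = q
    ... | tri≈ _ refl _ = contradiction p (ℚP.<-irrefl refl)
    ... | tri> _ _ b<a = contradiction p (λ p → ℚP.<-irrefl refl (ℚP.<-≤-trans p
        (ℚP.≤-trans (ℚP.*-monoˡ-≤-nonNeg b {{nonNegative 0≤b}} (ℚP.<⇒≤ b<a))
                    (ℚP.*-monoʳ-≤-nonNeg a {{nonNegative (ℚP.≤-trans 0≤b (ℚP.<⇒≤ b<a))}} (ℚP.<⇒≤ b<a)))))

    ∣∣<-intro : ∀ {a b ε} → a < b + ε → b < a + ε → ∣ a - b ∣ < ε
    ∣∣<-intro {a} {b} {ε} p q with ℚP.∣p∣≡p∨∣p∣≡-p (a - b)
    ... | inj₁ e = subst₂ _<_ (sym e) (solve 2 (λ b ε → (b :+ ε) :- b := ε) refl b ε)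
                     (ℚP.+-monoˡ-< (- b) p)
      where open +-*-Solver
    ... | inj₂ e = subst₂ _<_ (trans (solve 2 (λ a b → b :- a := :- (a :- b)) refl a b) (sym e))
                     (solve 2 (λ a ε → (a :+ ε) :- a := ε) refl a ε)
                     (ℚP.+-monoˡ-< (- a) q)
      where open +-*-Solver

    ∣∣<-elim : ∀ {a b ε} → ∣ a - b ∣ < ε → a < b + ε
    ∣∣<-elim {a} {b} {ε} p = subst₂ _<_ (solve 2 (λ a b → b :+ (a :- b) := a) refl a b) refl
      (ℚP.+-monoʳ-< b (ℚP.≤-<-trans (p≤∣p∣ (a - b)) p))
      where
      open +-*-Solver
      p≤∣p∣ : ∀ p → p ≤ ∣ p ∣
      p≤∣p∣ (mkℚ (+ n) d c) = ℚP.≤-refl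
      p≤∣p∣ (mkℚ -[1+ n ] d c) = *≤* -≤+

  Cauchy : (ℕ → ℚ) → Set
  Cauchy x = ∀ ε → 0ℚ < ε → ∃ λ N → ∀ m n → N ℕ.≤ m → N ℕ.≤ n → ∣ x m - x n ∣ < ε

  abstract
    const-cauchy : ∀ r → Cauchy (λ _ → r)
    const-cauchy r ε 0<ε = 0 , λ _ _ _ _ → subst (λ t → ∣ t ∣ < ε) (sym (ℚP.+-inverseʳ r)) 0<ε

    +-cauchy : ∀ {x y} → Cauchy x → Cauchy y → Cauchy (λ n → x n + y n)
    +-cauchy {x} {y} cx cy ε 0<ε
      with cx (½ * ε) (half 0<ε) | cy (½ * ε) (half 0<ε)
    ... | M , p | N , q = M ℕ.⊔ N , λ m n m≥ n≥ → begin-strict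
        ∣ (x m + y m) - (x n + y n) ∣  ≡⟨ cong ∣_∣ (rearrange (x m) (y m) (x n) (y n)) ⟩
        ∣ (x m - x n) + (y m - y n) ∣  ≤⟨ ℚP.∣p+q∣≤∣p∣+∣q∣ (x m - x n) (y m - y n) ⟩
        ∣ x m - x n ∣ + ∣ y m - y n ∣
          <⟨ ℚP.+-mono-< (p m n (ℕP.m⊔n≤o⇒m≤o M N m≥) (ℕP.m⊔n≤o⇒m≤o M N n≥))
                         (q m n (ℕP.m⊔n≤o⇒n≤o M N m≥) (ℕP.m⊔n≤o⇒n≤o M N n≥)) ⟩
        ½ * ε + ½ * ε                  ≡⟨ half+half ε ⟩
        ε                              ∎
      where
      open ℚP.≤-Reasoning
      open +-*-Solver
      rearrange : ∀ a b c d → (a + b) - (c + d) ≡ (a - c) + (b - d)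
      rearrange = solve 4 (λ a b c d → (a :+ b) :- (c :+ d) := (a :- c) :+ (b :- d)) refl

    neg-cauchy : ∀ {x} → Cauchy x → Cauchy (λ n → - x n)
    neg-cauchy {x} cx ε 0<ε with cx ε 0<ε
    ... | N , p = N , λ m n m≥ n≥ → subst (_< ε)
        (trans (sym (ℚP.∣-p∣≡∣p∣ (x m - x n))) (cong ∣_∣ (ℚP.neg-distrib-+ (x m) (- x n)))) (p m n m≥ n≥)

    cauchy-bound : ∀ {x} → Cauchy x → ∃ λ B → ∃ λ N → 0ℚ < B × (∀ n → N ℕ.≤ n → ∣ x n ∣ < B)
    cauchy-bound {x} cx with cx 1ℚ 0<1
    ... | N , p = ∣ x N ∣ + 1ℚ , N , ℚP.+-mono-≤-< (ℚP.0≤∣p∣ (x N)) 0<1 , λ n n≥ → begin-strict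
        ∣ x n ∣                  ≡⟨ cong ∣_∣ (split (x n) (x N)) ⟩
        ∣ x N + (x n - x N) ∣    ≤⟨ ℚP.∣p+q∣≤∣p∣+∣q∣ (x N) (x n - x N) ⟩
        ∣ x N ∣ + ∣ x n - x N ∣  <⟨ ℚP.+-monoʳ-< ∣ x N ∣ (p n N n≥ ℕP.≤-refl) ⟩
        ∣ x N ∣ + 1ℚ             ∎
      where
      open ℚP.≤-Reasoning
      open +-*-Solver
      split : ∀ a b → a ≡ b + (a - b)
      split = solve 2 (λ a b → a := b :+ (a :- b)) refl

    divide : ∀ C {ε} → 0ℚ < C → 0ℚ < ε → ∃ λ δ → 0ℚ < δ × C * δ ≡ ε
    divide C {ε} 0<C 0<ε = 1/ C * ε
      , subst (_< 1/ C * ε) (ℚP.*-zeroʳ (1/ C)) (ℚP.*-monoʳ-<-pos (1/ C) {{ℚP.1/pos⇒pos C}} 0<ε)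
      , trans (sym (ℚP.*-assoc C (1/ C) ε)) (trans (cong (_* ε) (ℚP.*-inverseʳ C)) (ℚP.*-identityˡ ε))
      where
      instance
        posC : Positive C
        posC = positive 0<C
        nzC : NonZero C
        nzC = ℚP.pos⇒nonZero C

    *-estimate : ∀ a b c d {A B δ} → ∣ a ∣ < A → ∣ d ∣ < B → 0ℚ < A → 0ℚ < B →
      ∣ b - d ∣ < δ → ∣ a - c ∣ < δ → ∣ a * b - c * d ∣ < (A + B) * δ
    *-estimate a b c d {A} {B} {δ} a<A d<B 0<A 0<B b-d<δ a-c<δ =
      subst (λ t → ∣ t ∣ < (A + B) * δ) (sym (rearrange a b c d))
      (subst (λ t → ∣ a * (b - d) + d * (a - c) ∣ < t) (sym (ℚP.*-distribʳ-+ δ A B))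
      (ℚP.≤-<-trans (ℚP.∣p+q∣≤∣p∣+∣q∣ (a * (b - d)) (d * (a - c)))
      (ℚP.+-mono-< (mul a A (b - d) δ 0<A a<A b-d<δ) (mul d B (a - c) δ 0<B d<B a-c<δ))))
      where
      open +-*-Solver
      rearrange : ∀ a b c d → a * b - c * d ≡ a * (b - d) + d * (a - c)
      rearrange = solve 4 (λ a b c d → a :* b :- c :* d := a :* (b :- d) :+ d :* (a :- c)) refl
      mul : ∀ a b c d → 0ℚ < b → ∣ a ∣ < b → ∣ c ∣ < d → ∣ a * c ∣ < b * d
      mul a b c d 0<b a<b c<d = subst (_< b * d) (sym (ℚP.∣p*q∣≡∣p∣*∣q∣ a c)) (ℚP.≤-<-trans
        (ℚP.*-monoʳ-≤-nonNeg ∣ c ∣ {{ℚP.∣-∣-nonNeg c}} (ℚP.<⇒≤ a<b))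
        (ℚP.*-monoʳ-<-pos b {{positive 0<b}} c<d))

    *-cauchy : ∀ {x y} → Cauchy x → Cauchy y → Cauchy (λ n → x n * y n)
    *-cauchy {x} {y} cx cy ε 0<ε =
      let A , K , 0<A , x<A = cauchy-bound cx
          B , L , 0<B , y<B = cauchy-bound cy
          δ , 0<δ , Cδ≡ε = divide (A + B) (ℚP.+-mono-< 0<A 0<B) 0<ε
          M , p = cx δ 0<δ
          N , q = cy δ 0<δ
      in (K ℕ.⊔ L) ℕ.⊔ (M ℕ.⊔ N) , λ m n m≥ n≥ →
        let k≤m = ℕP.m⊔n≤o⇒m≤o K L (ℕP.m⊔n≤o⇒m≤o (K ℕ.⊔ L) (M ℕ.⊔ N) m≥)
            l≤n = ℕP.m⊔n≤o⇒n≤o K L (ℕP.m⊔n≤o⇒m≤o (K ℕ.⊔ L) (M ℕ.⊔ N) n≥)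
            mn≤m = ℕP.m⊔n≤o⇒n≤o (K ℕ.⊔ L) (M ℕ.⊔ N) m≥
            mn≤n = ℕP.m⊔n≤o⇒n≤o (K ℕ.⊔ L) (M ℕ.⊔ N) n≥
        in subst (∣ x m * y m - x n * y n ∣ <_) Cδ≡ε
          (*-estimate (x m) (y m) (x n) (y n) {A} {B} {δ} (x<A m k≤m) (y<B n l≤n) 0<A 0<B
            (q m n (ℕP.m⊔n≤o⇒n≤o M N mn≤m) (ℕP.m⊔n≤o⇒n≤o M N mn≤n))
            (p m n (ℕP.m⊔n≤o⇒m≤o M N mn≤m) (ℕP.m⊔n≤o⇒m≤o M N mn≤n)))

  -- The largest k ≤ K with f k ≤ r, or 0 if there is none.
  largest : (ℕ → ℚ) → ℚ → ℕ → ℕ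
  largest f r zero = 0
  largest f r (suc K) with f (suc K) ≤? r
  ... | yes _ = suc K
  ... | no _ = largest f r K

  infix 8 _²
  _² : ℚ → ℚ
  x ² = x * x

  abstract
    largest-lower : ∀ (f : ℕ → ℚ) r K → f 0 ≤ r → f (largest f r K) ≤ r
    largest-lower f r zero p = p
    largest-lower f r (suc K) p with f (suc K) ≤? r
    ... | yes q = q
    ... | no _ = largest-lower f r K p

    largest-upper : ∀ (f : ℕ → ℚ) r K → r < f (suc K) → r < f (suc (largest f r K))
    largest-upper f r zero p = p
    largest-upper f r (suc K) p with f (suc K) ≤? r
    ... | yes _ = p
    ... | no r< = largest-upper f r K (ℚP.≰⇒> r<)

    p≤∣↥p∣ : ∀ p → p ≤ + ℤ.∣ ↥ p ∣ / 1
    p≤∣↥p∣ p@(mkℚ (+ a) d _) = subst (_≤ + a / 1) (ℚP.↥p/↧p≡p p)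
      (/-≤ a d a 0 (subst (ℕ._≤ a ℕ.* suc d) (sym (ℕP.*-identityʳ a)) (ℕP.m≤m*n a (suc d))))
    p≤∣↥p∣ p@(mkℚ -[1+ a ] d _) = ℚP.≤-trans (ℚP.<⇒≤ (ℚP.negative⁻¹ p)) (0≤/ (suc a) 0)

    1≤x≤y⇒x≤y² : ∀ {x y} → 1ℚ ≤ x → x ≤ y → x ≤ y ²
    1≤x≤y⇒x≤y² {x} {y} 1≤x x≤y = ℚP.≤-trans x≤y (subst (_≤ y ²) (ℚP.*-identityʳ y)
      (ℚP.*-monoˡ-≤-nonNeg y {{nonNegative (ℚP.≤-trans (ℚP.<⇒≤ 0<1) 1≤y)}} 1≤y))
      where
      1≤y : 1ℚ ≤ y
      1≤y = ℚP.≤-trans 1≤x x≤y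

    grid-bound : ∀ c n → + c / 1 < (+ suc (suc n ℕ.* suc c) / suc n) ²
    grid-bound c n = ℚP.<-≤-trans
      (/-< c 0 (suc c) 0 (ℕ.s≤s (ℕP.≤-trans (ℕP.≤-reflexive (ℕP.*-identityʳ c)) (ℕP.≤-reflexive (sym (ℕP.*-identityʳ c))))))
      (1≤x≤y⇒x≤y² (/-≤ 1 0 (suc c) 0 (ℕ.s≤s ℕ.z≤n))
        (/-≤ (suc c) 0 (suc (suc n ℕ.* suc c)) n
          (subst₂ ℕ._≤_ (ℕP.*-comm (suc n) (suc c)) (sym (ℕP.*-identityʳ (suc (suc n ℕ.* suc c))))
            (ℕP.n≤1+n (suc n ℕ.* suc c)))))

  opaque
    -- The bound on k is large enough not to matter: r ≤ ∣ numerator of r ∣.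
    sqrtNumerator : ℚ → ℕ → ℕ
    sqrtNumerator r n = largest (λ (k : ℕ) → (+ k / suc n) ²) r (suc n ℕ.* suc ℤ.∣ ↥ r ∣)

    sqrtNumerator-lower : ∀ r n → 0ℚ ≤ r → (+ sqrtNumerator r n / suc n) ² ≤ r
    sqrtNumerator-lower r n 0≤r = largest-lower (λ (k : ℕ) → (+ k / suc n) ²) r (suc n ℕ.* suc ℤ.∣ ↥ r ∣)
      (subst (_≤ r) (sym (trans (cong _² (ℚP.0/n≡0 (suc n))) (ℚP.*-zeroˡ 0ℚ))) 0≤r)

    sqrtNumerator-upper : ∀ r n → r < (+ sqrtNumerator r n / suc n + + 1 / suc n) ²
    sqrtNumerator-upper r n = subst (λ t → r < t ²) (suc/ (sqrtNumerator r n) n)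
      (largest-upper (λ (k : ℕ) → (+ k / suc n) ²) r (suc n ℕ.* suc ℤ.∣ ↥ r ∣)
        (ℚP.≤-<-trans (p≤∣↥p∣ r) (grid-bound ℤ.∣ ↥ r ∣ n)))

  opaque
    -- The largest multiple of 1 / (n + 1) whose square is at most max(r, 0).
    sqrt≈ : ℚ → ℕ → ℚ
    sqrt≈ r n = + sqrtNumerator (r ⊔ 0ℚ) n / suc n

    sqrt≈-nonNeg : ∀ r n → 0ℚ ≤ sqrt≈ r n
    sqrt≈-nonNeg r n = 0≤/ (sqrtNumerator (r ⊔ 0ℚ) n) n

    sqrt≈-lower : ∀ r n → sqrt≈ r n ² ≤ r ⊔ 0ℚ
    sqrt≈-lower r n = sqrtNumerator-lower (r ⊔ 0ℚ) n (ℚP.p≤q⊔p r 0ℚ)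

    sqrt≈-upper : ∀ r n → r ⊔ 0ℚ < (sqrt≈ r n + + 1 / suc n) ²
    sqrt≈-upper r n = sqrtNumerator-upper (r ⊔ 0ℚ) n

  abstract
    sqrt-close : ∀ a m b n {η ε} → 0ℚ ≤ η → a < b + η ² → + 1 / suc n < η → η + η ≡ ε →
      sqrt≈ a m < sqrt≈ b n + ε
    sqrt-close a m b n {η} {ε} 0≤η a<b+η² 1/n<η η+η≡ε = begin-strict
        sqrt≈ a m              <⟨ sq-cancel-< (sqrt≈ a m) (t + η) (ℚP.+-mono-≤ 0≤t 0≤η) squares ⟩
        t + η                  <⟨ ℚP.+-monoˡ-< η (ℚP.+-monoʳ-< (sqrt≈ b n) 1/n<η) ⟩
        sqrt≈ b n + η + η      ≡⟨ ℚP.+-assoc (sqrt≈ b n) η η ⟩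
        sqrt≈ b n + (η + η)    ≡⟨ cong (λ z → sqrt≈ b n + z) η+η≡ε ⟩
        sqrt≈ b n + ε          ∎
      where
      open ℚP.≤-Reasoning
      open +-*-Solver
      t : ℚ
      t = sqrt≈ b n + + 1 / suc n
      0≤t : 0ℚ ≤ t
      0≤t = ℚP.+-mono-≤ (sqrt≈-nonNeg b n) (0≤/ 1 n)
      0≤* : ∀ {x y} → 0ℚ ≤ x → 0ℚ ≤ y → 0ℚ ≤ x * y
      0≤* {x} {y} 0≤x 0≤y = ℚP.nonNegative⁻¹ (x * y)
        {{ℚP.nonNeg*nonNeg⇒nonNeg x {{nonNegative 0≤x}} y {{nonNegative 0≤y}}}}
      expand : ∀ x y → x * x + y * y + (x * y + x * y) ≡ (x + y) * (x + y)
      expand = solve 2 (λ x y → x :* x :+ y :* y :+ (x :* y :+ x :* y) := (x :+ y) :* (x :+ y)) refl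
      a⊔0≤ : a ⊔ 0ℚ ≤ (b ⊔ 0ℚ) + η ²
      a⊔0≤ = ℚP.⊔-lub
        (ℚP.≤-trans (ℚP.<⇒≤ a<b+η²) (ℚP.+-monoˡ-≤ (η ²) (ℚP.p≤p⊔q b 0ℚ)))
        (ℚP.+-mono-≤ (ℚP.p≤q⊔p b 0ℚ) (0≤* 0≤η 0≤η))
      squares : sqrt≈ a m ² < (t + η) ²
      squares = begin-strict
        sqrt≈ a m ²                  ≤⟨ sqrt≈-lower a m ⟩
        a ⊔ 0ℚ                       ≤⟨ a⊔0≤ ⟩
        (b ⊔ 0ℚ) + η ²               <⟨ ℚP.+-monoˡ-< (η ²) (sqrt≈-upper b n) ⟩
        t ² + η ²                    ≡⟨ ℚP.+-identityʳ (t ² + η ²) ⟨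
        t ² + η ² + 0ℚ               ≤⟨ ℚP.+-monoʳ-≤ (t ² + η ²) (ℚP.+-mono-≤ (0≤* 0≤t 0≤η) (0≤* 0≤t 0≤η)) ⟩
        t ² + η ² + (t * η + t * η)  ≡⟨ expand t η ⟩
        (t + η) ²                    ∎

    sqrt-cauchy : ∀ {x} → Cauchy x → Cauchy (λ n → sqrt≈ (x n) n)
    sqrt-cauchy {x} cx ε 0<ε =
      let 0<η = half 0<ε
          M , p = cx ((½ * ε) ²) (0<² 0<η)
          N , q = archimedean (½ * ε) 0<η
      in M ℕ.⊔ N , λ m n m≥ n≥ →
        let M≤m = ℕP.m⊔n≤o⇒m≤o M N m≥
            M≤n = ℕP.m⊔n≤o⇒m≤o M N n≥
            N≤m = ℕP.m⊔n≤o⇒n≤o M N m≥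
            N≤n = ℕP.m⊔n≤o⇒n≤o M N n≥
        in ∣∣<-intro
          (sqrt-close (x m) m (x n) n (ℚP.<⇒≤ 0<η) (∣∣<-elim (p m n M≤m M≤n)) (q n N≤n) (half+half ε))
          (sqrt-close (x n) n (x m) m (ℚP.<⇒≤ 0<η) (∣∣<-elim (p n m M≤n M≤m)) (q m N≤m) (half+half ε))
      where
      0<² : ∀ {a} → 0ℚ < a → 0ℚ < a ²
      0<² {a} 0<a = subst (_< a ²) (ℚP.*-zeroʳ a) (ℚP.*-monoʳ-<-pos a {{positive 0<a}} 0<a)

-- Polynomials are lists of coefficients, constant term first. Trailing zeros
-- are allowed: equality compares all coefficients.
module Polynomial (R : RawRing 0ℓ 0ℓ) where

  open RawRing R renaming
    (_≈_ to _≈ᴿ_; _+_ to _+ᴿ_; _*_ to _*ᴿ_; -_ to -ᴿ_; 0# to 0ᴿ; 1# to 1ᴿ)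

  Poly : Set
  Poly = List Carrier

  coeff : Poly → ℕ → Carrier
  coeff [] i = 0ᴿ
  coeff (a ∷ p) zero = a
  coeff (a ∷ p) (suc i) = coeff p i

  infix 4 _≈_
  record _≈_ (p q : Poly) : Set where
    constructor mk≈
    field
      coeff-≈ : ∀ i → coeff p i ≈ᴿ coeff q i

  infixl 6 _+_
  _+_ : Poly → Poly → Poly
  [] + q = q
  (a ∷ p) + [] = a ∷ p
  (a ∷ p) + (b ∷ q) = (a +ᴿ b) ∷ (p + q)

  infixl 7 _*_
  _*_ : Poly → Poly → Poly
  [] * q = []
  (a ∷ p) * q = map (a *ᴿ_) q + (0ᴿ ∷ (p * q))

  rawRing : RawRing 0ℓ 0ℓ
  rawRing = record
    { Carrier = Poly ; _≈_ = _≈_ ; _+_ = _+_ ; _*_ = _*_ ; -_ = map -ᴿ_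
    ; 0# = [] ; 1# = 1ᴿ ∷ [] }

  open RawSemiringDefs (RawRing.rawSemiring rawRing) public using (_^_; product)

  C : Carrier → Poly
  C a = a ∷ []

  X : Poly
  X = 0ᴿ ∷ 1ᴿ ∷ []

  eval : Poly → Carrier → Carrier
  eval p x = foldr (λ a v → a +ᴿ x *ᴿ v) 0ᴿ p

-- Real numbers are represented by Cauchy sequences, not by classes of them;
-- Real._≈_ is equality of reals.
record ℝ : Set where
  constructor mkℝ
  field
    seq : ℕ → ℚ
    cauchy : CauchySequences.Cauchy seq

module Real where

  open CauchySequences
  open ℝ

  infix 8 -_ _^3/2
  infixl 7 _*_
  infixl 6 _+_ _-_
  infix 4 _≈_ _≤_

  -- Records rather than functions, so that x and y can be inferred from x ≈ y.
  record _≈_ (x y : ℝ) : Set where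
    constructor mk≈
    field
      close : ∀ ε → ℚ.0ℚ ℚ.< ε → ∃ λ N → ∀ n → N ℕ.≤ n → ℚ.∣ seq x n ℚ.- seq y n ∣ ℚ.< ε

  record _≤_ (x y : ℝ) : Set where
    constructor mk≤
    field
      below : ∀ ε → ℚ.0ℚ ℚ.< ε → ∃ λ N → ∀ n → N ℕ.≤ n → seq x n ℚ.< seq y n ℚ.+ ε

  fromℚ : ℚ → ℝ
  fromℚ r = mkℝ (λ _ → r) (const-cauchy r)

  fromℤ : ℤ → ℝ
  fromℤ a = fromℚ (a ℚ./ 1)

  fromℕ : ℕ → ℝ
  fromℕ n = fromℤ (+ n)

  _+_ : ℝ → ℝ → ℝ
  x + y = mkℝ (λ n → seq x n ℚ.+ seq y n) (+-cauchy {seq x} {seq y} (cauchy x) (cauchy y))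

  -_ : ℝ → ℝ
  - x = mkℝ (λ n → ℚ.- seq x n) (neg-cauchy {seq x} (cauchy x))

  _-_ : ℝ → ℝ → ℝ
  x - y = x + - y

  _*_ : ℝ → ℝ → ℝ
  x * y = mkℝ (λ n → seq x n ℚ.* seq y n) (*-cauchy {seq x} {seq y} (cauchy x) (cauchy y))

  rawRing : RawRing 0ℓ 0ℓ
  rawRing = record
    { Carrier = ℝ ; _≈_ = _≈_ ; _+_ = _+_ ; _*_ = _*_ ; -_ = -_
    ; 0# = fromℕ 0 ; 1# = fromℕ 1 }

  open RawSemiringDefs (RawRing.rawSemiring rawRing) public using (_^_)

  -- The non-negative square root for x ≥ 0; by convention √ x = 0 for x ≤ 0.
  √ : ℝ → ℝ
  √ x = mkℝ (λ n → sqrt≈ (seq x n) n) (sqrt-cauchy {seq x} (cauchy x))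

  _^3/2 : ℝ → ℝ
  x ^3/2 = √ x ^ 3

record ℂ : Set where
  constructor _+i_
  field
    re im : ℝ

module Complex where

  open ℂ
  open Real using () renaming (_+_ to _+ᴿ_; _*_ to _*ᴿ_; _-_ to _-ᴿ_; -_ to -ᴿ_)

  fromℝ : ℝ → ℂ
  fromℝ x = x +i Real.fromℕ 0

  conj : ℂ → ℂ
  conj z = re z +i (-ᴿ im z)

  ∣_∣ : ℂ → ℝ
  ∣ z ∣ = Real.√ (re z *ᴿ re z +ᴿ im z *ᴿ im z)

  rawRing : RawRing 0ℓ 0ℓ
  rawRing = record
    { Carrier = ℂ
    ; _≈_ = λ z w → re z Real.≈ re w × im z Real.≈ im w
    ; _+_ = λ z w → (re z +ᴿ re w) +i (im z +ᴿ im w)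
    ; _*_ = λ z w → (re z *ᴿ re w -ᴿ im z *ᴿ im w) +i (re z *ᴿ im w +ᴿ im z *ᴿ re w)
    ; -_ = λ z → (-ᴿ re z) +i (-ᴿ im z)
    ; 0# = fromℝ (Real.fromℕ 0)
    ; 1# = fromℝ (Real.fromℕ 1)
    }

module ℤ[X] = Polynomial ℤ.+-*-rawRing
module ℝ[X] = Polynomial Real.rawRing
module ℂ[X] = Polynomial Complex.rawRing

toℝ[X] : ℤ[X].Poly → ℝ[X].Poly
toℝ[X] = map Real.fromℤ

toℂ[X] : ℤ[X].Poly → ℂ[X].Poly
toℂ[X] = map (λ a → Complex.fromℝ (Real.fromℤ a))

linear : ℂ → ℂ[X].Poly
linear z = ℂ[X].X ℂ[X].+ ℂ[X].C (RawRing.-_ Complex.rawRing z)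

-- The roots of a q-Weil polynomial are listed with multiplicity, so that
-- h = ∏ᵢ (X - wᵢ)(X - w̄ᵢ) over ℂ.
record W (q g : ℕ) (h : ℤ[X].Poly) : Set where
  field
    positive-degree : 1 ℕ.≤ g
    monic : ℤ[X].coeff h (2 ℕ.* g) ≡ + 1
    degree : ∀ i → 2 ℕ.* g ℕ.< i → ℤ[X].coeff h i ≡ + 0
    w : Fin g → ℂ
    modulus : ∀ i → Complex.∣ w i ∣ Real.≈ Real.√ (Real.fromℕ q)
    factorization : toℂ[X] h ℂ[X].≈
      ℂ[X].product (λ i → linear (w i) ℂ[X].* linear (Complex.conj (w i)))

HasRealRoot : ℤ[X].Poly → Set
HasRealRoot h = ∃ λ (r : ℝ) → ℝ[X].eval (toℝ[X] h) r Real.≈ Real.fromℕ 0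

IsSquare : ℕ → Set
IsSquare q = ∃ λ m → q ≡ m ℕ.* m

data Case : Set where
  I II III IV : Case

module _ (q : ℕ) (a₁ a₂ a₃ : ℤ) where

  -- x⁶ + a₁x⁵ + a₂x⁴ + a₃x³ + a₂qx² + a₁q²x + q³
  sextic : ℤ[X].Poly
  sextic = ((+ q) ℤ.^ 3) ∷ (a₁ ℤ.* (+ q) ℤ.^ 2) ∷ (a₂ ℤ.* + q) ∷ a₃ ∷ a₂ ∷ a₁ ∷ + 1 ∷ []

  module Conditions where

    open Real

    s Q α₁ α₂ α₃ ∣α₁∣ : ℝ
    s = √ (fromℕ q)
    Q = fromℕ q
    α₁ = fromℤ a₁
    α₂ = fromℤ a₂
    α₃ = fromℤ a₃
    ∣α₁∣ = fromℕ ℤ.∣ a₁ ∣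

    c-centre d-lower d-upper b*-lower : ℝ
    c-centre = - fromℚ (+ 2 ℚ./ 27) * α₁ ^ 3 + fromℚ (+ 1 ℚ./ 3) * α₁ * α₂ + Q * α₁
    d-lower = - fromℕ 2 * Q * α₁ - fromℕ 2 * s * α₂ - fromℕ 2 * Q * s
    d-upper = - fromℕ 2 * Q * α₁ + fromℕ 2 * s * α₂ + fromℕ 2 * Q * s
    b*-lower = fromℕ 4 * s * ∣α₁∣ - fromℕ 9 * Q

    radicand : ℝ
    radicand = α₁ ^ 2 - fromℕ 3 * α₂ + fromℕ 9 * Q

    a b* b c d : Set
    a = ∣α₁∣ ≤ fromℕ 6 * s
    b* = b*-lower ≤ α₂
    b = α₂ ≤ fromℚ (+ 1 ℚ./ 3) * α₁ ^ 2 + fromℕ 3 * Q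
    c = c-centre - fromℚ (+ 2 ℚ./ 27) * radicand ^3/2 ≤ α₃
      × α₃ ≤ c-centre + fromℚ (+ 2 ℚ./ 27) * radicand ^3/2
    d = d-lower ≤ α₃ × α₃ ≤ d-upper

    a-equality b*-equality d-equality : Set
    a-equality = ∣α₁∣ ≈ fromℕ 6 * s
    b*-equality = b*-lower ≈ α₂
    d-equality = d-lower ≈ α₃ ⊎ α₃ ≈ d-upper

  -- (x + √q)²ᵏ (x - √q)²ˡ h₀
  realFactors : ℕ → ℕ → ℝ[X].Poly → ℝ[X].Poly
  realFactors k ℓ h₀ = (X + C s) ^ (2 ℕ.* k) * (X + C (Real.- s)) ^ (2 ℕ.* ℓ) * h₀
    where
    open ℝ[X]
    s = Real.√ (Real.fromℕ q)

  x²-q : ℤ[X].Poly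
  x²-q = ℤ[X].X ℤ[X].^ 2 ℤ[X].+ ℤ[X].C (ℤ.- (+ q))

  Occurs : ℕ → ℕ → Case → Set
  Occurs k ℓ I = ¬ IsSquare q × ∃ λ h₀ → W q 1 h₀
    × sextic ℤ[X].≈ x²-q ℤ[X].^ 2 ℤ[X].* h₀
  Occurs k ℓ II = IsSquare q × k ℕ.+ ℓ ≡ 3
    × toℝ[X] sextic ℝ[X].≈ realFactors k ℓ (ℝ[X].C (Real.fromℕ 1))
  Occurs k ℓ III = IsSquare q × k ℕ.+ ℓ ≡ 2 × ∃ λ h₀ → W q 1 h₀ × ¬ HasRealRoot h₀
    × toℝ[X] sextic ℝ[X].≈ realFactors k ℓ (toℝ[X] h₀)
  Occurs k ℓ IV = IsSquare q × k ℕ.+ ℓ ≡ 1 × ∃ λ h₀ → W q 2 h₀ × ¬ HasRealRoot h₀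
    × toℝ[X] sextic ℝ[X].≈ realFactors k ℓ (toℝ[X] h₀)

{-# OPTIONS --safe #-}
-- Since h(x) = x³ f(x + q/x) for a monic integral cubic f, h is a q-Weil polynomial iff f has three real
-- roots y₁, y₂, y₃ in [-2√q, 2√q]: then h = ∏ (x² - yᵢx + q). For t = 3y + a₁ the equation f(y) = 0 becomes
-- t³ - 3At + B = 0 with A = a₁² - 3a₂ + 9q, and (c) says |B| ≤ 2A^{3/2}. Any real root then satisfies t² ≤ 4A,
-- which makes the discriminant of the quadratic cofactor of f non-negative, so that one root found by bisection
-- yields all three. The bounds yᵢ ≤ 2√q are equivalent to the non-negativity of the elementary symmetric
-- functions of the 2√q - yᵢ, and together with yᵢ ≥ -2√q this is (a), (b*) and (d).
-- A real root of h is ±√q and belongs to some yᵢ = ±2√q, that is, f(±2√q) = 0. As f(±2√q) = P ± R√q with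
-- integers P, R, this is decidable; it forces P = R = 0 if q is not a square, and otherwise the integral
-- roots ±2√q can be split off from f one by one.
module Submission where

open import Algebra.Bundles using (CommutativeMonoid; CommutativeRing)
open import Algebra.Bundles.Raw using (RawRing)
import Algebra.Properties.CommutativeSemigroup
import Algebra.Properties.Ring
import Algebra.Properties.Semiring.Exp
import Algebra.Solver.Ring
open import Algebra.Solver.Ring.AlmostCommutativeRing using (fromCommutativeRing; _-Raw-AlmostCommutative⟶_)
open import Algebra.Structures using (IsCommutativeRing)
open import Data.Bool.Base using (T)
open import Data.Empty using (⊥)
open import Data.Fin.Base as Fin using (Fin; zero; suc)
open import Data.Integer.Base as ℤ using (ℤ; +_; -[1+_])
import Data.Integer.Properties as ℤP
open import Data.Integer.Solver using () renaming (module +-*-Solver to ℤSolver)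
open import Data.List.Base as List using (List; []; _∷_; _++_; replicate)
open import Data.List.Membership.Propositional.Properties using (∈-lookup)
import Data.List.Properties as ListP
open import Data.List.Relation.Unary.All as All using (All; []; _∷_)
import Data.List.Relation.Unary.All.Properties as AllP
open import Data.List.Relation.Unary.Any using (Any; here; there)
import Data.Maybe as Maybe
open import Data.Nat.Base as ℕ using (ℕ; zero; suc)
import Data.Nat.Coprimality as Coprimality
import Data.Nat.DivMod as DivMod
import Data.Nat.Divisibility as Divisibility
open import Data.Nat.GCD using (gcd; gcd[m,n]∣m; gcd[m,n]∣n; gcd[m,n]≢0)
open import Data.Nat.Primality using (Prime)
import Data.Nat.Properties as ℕP
import Data.Nat.Solver
open import Data.Product using (∃; ∃₂; ∃!; _×_; _,_; proj₁; proj₂)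
open import Data.Rational.Base as ℚ using (ℚ)
import Data.Rational.Properties as ℚP
open import Data.Rational.Solver using () renaming (module +-*-Solver to ℚSolver)
import Data.Rational.Unnormalised as ℚᵘ
import Data.Rational.Unnormalised.Properties as ℚᵘP
open import Data.Sum as Sum using (_⊎_; inj₁; inj₂)
import Data.Vec.Base as Vec
open import Data.Vec.N-ary using (N-ary; Eq; _$ⁿ_; curryⁿ; curryⁿ-cong)
open import Function.Bundles using (_⇔_; mk⇔)
open import Level using (0ℓ)
import Relation.Binary.Reasoning.Setoid
open import Relation.Binary.PropositionalEquality as ≡ using (_≡_)
open import Relation.Nullary using (¬_; Dec; yes; no; contradiction)
open import Relation.Nullary.Decidable using (dec⇒maybe; map′)
open import Defs

-- Reals are Cauchy sequences of rationals, so neither order nor equality is decidable. Inequalities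
-- and equations are stable under double negation, but roots, factors and disjunctions must be
-- produced as data, and this shapes every existence step. Bisection runs on a cubic with integral
-- coefficients, whose signs at rational points are decidable; the other two roots come from the
-- quadratic formula. That some `yᵢ` is `±2√q` is at first known only up to double negation.
-- However, `-f(2√q) f(-2√q) = q R² - P²` is an integer, so its vanishing is decidable, and the
-- signs of `P` and `R` then tell which end is a root. If `√q` is an integer, so are the values of
-- `f` and of its cofactors at `±2√q`, and every equality tested while splitting is decidable. The
-- cases are told apart by symmetric functions of the `4q - yᵢ²`, which avoids matching two triples
-- of roots with each other. The algebra is carried out over an abstract `RealStructure`, so that no
-- sequence is unfolded by the ring solver.

module RealProperties where

  open CauchySequences
  open ℝ
  open Real
  open _≈_
  open _≤_

  -- The ordered ring of Cauchy reals and its square roots.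

  Eventually : (ℕ → Set) → Set
  Eventually P = ∃ λ N → ∀ n → N ℕ.≤ n → P n

  always : ∀ {P : ℕ → Set} → (∀ n → P n) → Eventually P
  always p = 0 , λ n _ → p n

  infixl 5 _⟨$⟩_ _⟨*⟩_

  _⟨$⟩_ : ∀ {P Q : ℕ → Set} → (∀ {n} → P n → Q n) → Eventually P → Eventually Q
  f ⟨$⟩ (N , p) = N , λ n N≤n → f (p n N≤n)

  _⟨*⟩_ : ∀ {P Q : ℕ → Set} → Eventually (λ n → P n → Q n) → Eventually P → Eventually Q
  (M , f) ⟨*⟩ (N , p) = M ℕ.⊔ N , λ n n≥ → f n (ℕP.m⊔n≤o⇒m≤o M N n≥) (p n (ℕP.m⊔n≤o⇒n≤o M N n≥))

  eventually-const : ∀ {A : Set} → Eventually (λ _ → A) → A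
  eventually-const (N , p) = p N ℕP.≤-refl

  -- The equation says `b - a = q - p`. Stated without subtraction, it is a ring identity for the
  -- solver in each application.
  shift-≤ : ∀ {a b p q} → p ℚ.≤ q → a ℚ.+ q ≡ b ℚ.+ p → a ℚ.≤ b
  shift-≤ {a} {b} {p} {q} p≤q e = ≡.subst₂ ℚ._≤_ (cancel a p) (cancel b p)
    (ℚP.+-monoˡ-≤ (ℚ.- p) (ℚP.≤-trans (ℚP.+-monoʳ-≤ a p≤q) (ℚP.≤-reflexive e)))
    where
    open ℚSolver
    cancel : ∀ a p → (a ℚ.+ p) ℚ.+ ℚ.- p ≡ a
    cancel = solve 2 (λ a p → (a :+ p) :- p := a) ≡.refl

  shift-< : ∀ {a b p q} → p ℚ.< q → a ℚ.+ q ≡ b ℚ.+ p → a ℚ.< b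
  shift-< {a} {b} {p} {q} p<q e = ≡.subst₂ ℚ._<_ (cancel a p) (cancel b p)
    (ℚP.+-monoˡ-< (ℚ.- p) (ℚP.<-≤-trans (ℚP.+-monoʳ-< a p<q) (ℚP.≤-reflexive e)))
    where
    open ℚSolver
    cancel : ∀ a p → (a ℚ.+ p) ℚ.+ ℚ.- p ≡ a
    cancel = solve 2 (λ a p → (a :+ p) :- p := a) ≡.refl

  p<p+ε : ∀ p {ε} → ℚ.0ℚ ℚ.< ε → p ℚ.< p ℚ.+ ε
  p<p+ε p {ε} 0<ε = shift-< 0<ε (≡.sym (ℚP.+-identityʳ (p ℚ.+ ε)))

  p≤∣p∣ : ∀ p → p ℚ.≤ ℚ.∣ p ∣
  p≤∣p∣ p with ℚP.≤-total ℚ.0ℚ p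
  ... | inj₁ 0≤p = ℚP.≤-reflexive (≡.sym (ℚP.0≤p⇒∣p∣≡p 0≤p))
  ... | inj₂ p≤0 = ℚP.≤-trans p≤0 (ℚP.0≤∣p∣ p)

  ∣∣-comm : ∀ a b → ℚ.∣ a ℚ.- b ∣ ≡ ℚ.∣ b ℚ.- a ∣
  ∣∣-comm a b = ≡.trans (≡.sym (ℚP.∣-p∣≡∣p∣ (a ℚ.- b))) (≡.cong ℚ.∣_∣ (swap a b))
    where
    open ℚSolver
    swap : ∀ a b → ℚ.- (a ℚ.- b) ≡ b ℚ.- a
    swap = solve 2 (λ a b → :- (a :- b) := b :- a) ≡.refl

  ≈⇒≤ : ∀ {x y} → x ≈ y → x ≤ y
  ≈⇒≤ x≈y .below ε 0<ε = ∣∣<-elim ⟨$⟩ close x≈y ε 0<ε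

  ≈⇒≥ : ∀ {x y} → x ≈ y → y ≤ x
  ≈⇒≥ {x} {y} x≈y .below ε 0<ε =
    (λ {n} p → ∣∣<-elim (≡.subst (ℚ._< ε) (∣∣-comm (seq x n) (seq y n)) p)) ⟨$⟩ close x≈y ε 0<ε

  ≤-antisym : ∀ {x y} → x ≤ y → y ≤ x → x ≈ y
  ≤-antisym x≤y y≤x .close ε 0<ε = ∣∣<-intro ⟨$⟩ below x≤y ε 0<ε ⟨*⟩ below y≤x ε 0<ε

  pointwise-≤ : ∀ {x y} → (∀ n → seq x n ℚ.≤ seq y n) → x ≤ y
  pointwise-≤ {x} {y} p .below ε 0<ε = always λ n → ℚP.≤-<-trans (p n) (p<p+ε (seq y n) 0<ε)

  pointwise-≈ : ∀ {x y} → (∀ n → seq x n ≡ seq y n) → x ≈ y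
  pointwise-≈ p = ≤-antisym (pointwise-≤ λ n → ℚP.≤-reflexive (p n))
    (pointwise-≤ λ n → ℚP.≤-reflexive (≡.sym (p n)))

  ≤-trans : ∀ {x y z} → x ≤ y → y ≤ z → x ≤ z
  ≤-trans {x} {y} {z} x≤y y≤z .below ε 0<ε =
    (λ {n} p q → ≡.subst (seq x n ℚ.<_) (≡.trans (ℚP.+-assoc (seq z n) _ _) (≡.cong (seq z n ℚ.+_) (half+half ε)))
      (ℚP.<-trans p (ℚP.+-monoˡ-< (ℚ.½ ℚ.* ε) q)))
    ⟨$⟩ below x≤y _ (half 0<ε) ⟨*⟩ below y≤z _ (half 0<ε)

  +-mono-≤ : ∀ {x y u v} → x ≤ y → u ≤ v → x + u ≤ y + v
  +-mono-≤ {x} {y} {u} {v} x≤y u≤v .below ε 0<ε =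
    (λ {n} p q → ≡.subst (seq x n ℚ.+ seq u n ℚ.<_)
      (≡.trans (rearrange (seq y n) (seq v n) (ℚ.½ ℚ.* ε)) (≡.cong (seq y n ℚ.+ seq v n ℚ.+_) (half+half ε)))
      (ℚP.+-mono-< p q))
    ⟨$⟩ below x≤y _ (half 0<ε) ⟨*⟩ below u≤v _ (half 0<ε)
    where
    open ℚSolver
    rearrange : ∀ y v e → (y ℚ.+ e) ℚ.+ (v ℚ.+ e) ≡ y ℚ.+ v ℚ.+ (e ℚ.+ e)
    rearrange = solve 3 (λ y v e → (y :+ e) :+ (v :+ e) := y :+ v :+ (e :+ e)) ≡.refl

  neg-antimono-≤ : ∀ {x y} → x ≤ y → - y ≤ - x
  neg-antimono-≤ {x} {y} x≤y .below ε 0<ε =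
    (λ {n} p → shift-< p (rearrange (seq x n) (seq y n) ε)) ⟨$⟩ below x≤y ε 0<ε
    where
    open ℚSolver
    rearrange : ∀ x y e → ℚ.- y ℚ.+ (y ℚ.+ e) ≡ (ℚ.- x ℚ.+ e) ℚ.+ x
    rearrange = solve 3 (λ x y e → :- y :+ (y :+ e) := (:- x :+ e) :+ x) ≡.refl

  ≈-refl : ∀ {x} → x ≈ x
  ≈-refl = pointwise-≈ λ _ → ≡.refl

  ≈-sym : ∀ {x y} → x ≈ y → y ≈ x
  ≈-sym x≈y = ≤-antisym (≈⇒≥ x≈y) (≈⇒≤ x≈y)

  ≈-trans : ∀ {x y z} → x ≈ y → y ≈ z → x ≈ z
  ≈-trans x≈y y≈z = ≤-antisym (≤-trans (≈⇒≤ x≈y) (≈⇒≤ y≈z)) (≤-trans (≈⇒≥ y≈z) (≈⇒≥ x≈y))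

  +-cong : ∀ {x y u v} → x ≈ y → u ≈ v → x + u ≈ y + v
  +-cong x≈y u≈v = ≤-antisym (+-mono-≤ (≈⇒≤ x≈y) (≈⇒≤ u≈v)) (+-mono-≤ (≈⇒≥ x≈y) (≈⇒≥ u≈v))

  -‿cong : ∀ {x y} → x ≈ y → - x ≈ - y
  -‿cong x≈y = ≤-antisym (neg-antimono-≤ (≈⇒≥ x≈y)) (neg-antimono-≤ (≈⇒≤ x≈y))

  *-cong : ∀ {x y u v} → x ≈ y → u ≈ v → x * u ≈ y * v
  *-cong {x} {y} {u} {v} x≈y u≈v .close ε 0<ε =
    let A , K , 0<A , x<A = cauchy-bound (cauchy x)
        B , L , 0<B , v<B = cauchy-bound (cauchy v)
        δ , 0<δ , Cδ≡ε = divide (A ℚ.+ B) (ℚP.+-mono-< 0<A 0<B) 0<ε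
    in (λ {n} a b c d → ≡.subst (ℚ.∣ seq x n ℚ.* seq u n ℚ.- seq y n ℚ.* seq v n ∣ ℚ.<_) Cδ≡ε
          (*-estimate (seq x n) (seq u n) (seq y n) (seq v n) a b 0<A 0<B c d))
       ⟨$⟩ (K , x<A) ⟨*⟩ (L , v<B) ⟨*⟩ close u≈v δ 0<δ ⟨*⟩ close x≈y δ 0<δ

  isCommutativeRing : IsCommutativeRing _≈_ _+_ _*_ -_ (fromℕ 0) (fromℕ 1)
  isCommutativeRing = record
    { isRing = record
      { +-isAbelianGroup = record
        { isGroup = record
          { isMonoid = record
            { isSemigroup = record
              { isMagma = record
                { isEquivalence = record { refl = ≈-refl ; sym = ≈-sym ; trans = ≈-trans }
                ; ∙-cong = +-cong }
              ; assoc = λ x y z → pointwise-≈ λ n → ℚP.+-assoc (seq x n) (seq y n) (seq z n) }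
            ; identity = (λ x → pointwise-≈ λ n → ℚP.+-identityˡ (seq x n))
                       , (λ x → pointwise-≈ λ n → ℚP.+-identityʳ (seq x n)) }
          ; inverse = (λ x → pointwise-≈ λ n → ℚP.+-inverseˡ (seq x n))
                    , (λ x → pointwise-≈ λ n → ℚP.+-inverseʳ (seq x n))
          ; ⁻¹-cong = -‿cong }
        ; comm = λ x y → pointwise-≈ λ n → ℚP.+-comm (seq x n) (seq y n) }
      ; *-cong = *-cong
      ; *-assoc = λ x y z → pointwise-≈ λ n → ℚP.*-assoc (seq x n) (seq y n) (seq z n)
      ; *-identity = (λ x → pointwise-≈ λ n → ℚP.*-identityˡ (seq x n))
                   , (λ x → pointwise-≈ λ n → ℚP.*-identityʳ (seq x n))
      ; distrib = (λ x y z → pointwise-≈ λ n → ℚP.*-distribˡ-+ (seq x n) (seq y n) (seq z n))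
                , (λ x y z → pointwise-≈ λ n → ℚP.*-distribʳ-+ (seq x n) (seq y n) (seq z n)) }
    ; *-comm = λ x y → pointwise-≈ λ n → ℚP.*-comm (seq x n) (seq y n) }

  infix 4 _⋖_
  -- Strict inequality as data: a positive rational that eventually separates the terms.
  _⋖_ : ℝ → ℝ → Set
  x ⋖ y = ∃ λ δ → ℚ.0ℚ ℚ.< δ × Eventually (λ n → δ ℚ.< seq y n ℚ.- seq x n)

  -- The constructive substitute for comparing `z` with 0. A single term `z_N` is compared with
  -- `ε/2`; from `N` on all terms stay within `ε/4` of it, so either answer persists, with `δ = ε/4`
  -- in the second case.
  located : ∀ z ε → ℚ.0ℚ ℚ.< ε →
    Eventually (λ n → seq z n ℚ.< ε) ⊎ (∃ λ δ → ℚ.0ℚ ℚ.< δ × Eventually (λ n → δ ℚ.< seq z n))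
  located z ε 0<ε with cauchy z (ℚ.½ ℚ.* (ℚ.½ ℚ.* ε)) (half (half 0<ε))
  ... | N , p with ℚ.½ ℚ.* ε ℚP.≤? seq z N
  ... | yes η≤z = inj₂ (ℚ.½ ℚ.* (ℚ.½ ℚ.* ε) , half (half 0<ε) , N , λ n N≤n →
    shift-< (ℚP.≤-<-trans η≤z (∣∣<-elim (p N n ℕP.≤-refl N≤n)))
      (≡.trans (rearrange (ℚ.½ ℚ.* (ℚ.½ ℚ.* ε)) (seq z n)) (≡.cong (seq z n ℚ.+_) (half+half (ℚ.½ ℚ.* ε)))))
    where
    open ℚSolver
    rearrange : ∀ d z → d ℚ.+ (z ℚ.+ d) ≡ z ℚ.+ (d ℚ.+ d)
    rearrange = solve 2 (λ d z → d :+ (z :+ d) := z :+ (d :+ d)) ≡.refl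
  ... | no η≰z = inj₁ (N , λ n N≤n → ≡.subst (seq z n ℚ.<_) (half+half ε)
    (ℚP.<-trans (∣∣<-elim (p n N N≤n ℕP.≤-refl)) (ℚP.+-mono-< (ℚP.≰⇒> η≰z) ½η<η)))
    where
    ½η<η : ℚ.½ ℚ.* (ℚ.½ ℚ.* ε) ℚ.< ℚ.½ ℚ.* ε
    ½η<η = ≡.subst (ℚ.½ ℚ.* (ℚ.½ ℚ.* ε) ℚ.<_) (half+half (ℚ.½ ℚ.* ε)) (p<p+ε _ (half (half 0<ε)))

  -- `_≤_` asks for one ε at a time, and `located` at that ε suffices. Together with `⋖⇒¬≤` this
  -- presents `_≤_` as a negation, which is the source of its stability.
  ¬⋖⇒≤ : ∀ {x y} → ¬ (y ⋖ x) → x ≤ y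
  ¬⋖⇒≤ {x} {y} ¬y⋖x .below ε 0<ε with located (x - y) ε 0<ε
  ... | inj₁ p = (λ {n} q → shift-< q (rearrange (seq x n) (seq y n) ε)) ⟨$⟩ p
    where
    open ℚSolver
    rearrange : ∀ x y e → x ℚ.+ e ≡ (y ℚ.+ e) ℚ.+ (x ℚ.- y)
    rearrange = solve 3 (λ x y e → x :+ e := (y :+ e) :+ (x :- y)) ≡.refl
  ... | inj₂ y⋖x = contradiction y⋖x ¬y⋖x

  ⋖⇒¬≤ : ∀ {x y} → y ⋖ x → ¬ (x ≤ y)
  ⋖⇒¬≤ {x} {y} (δ , 0<δ , p) x≤y = eventually-const
    ((λ {n} q r → ℚP.<-asym q (shift-< r (rearrange (seq x n) (seq y n) δ))) ⟨$⟩ p ⟨*⟩ below x≤y δ 0<δ)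
    where
    open ℚSolver
    rearrange : ∀ x y d → (x ℚ.- y) ℚ.+ (y ℚ.+ d) ≡ d ℚ.+ x
    rearrange = solve 3 (λ x y d → (x :- y) :+ (y :+ d) := d :+ x) ≡.refl

  ≤-stable : ∀ {x y} → ¬ ¬ (x ≤ y) → x ≤ y
  ≤-stable ¬¬x≤y = ¬⋖⇒≤ λ y⋖x → ¬¬x≤y (⋖⇒¬≤ y⋖x)

  -- The disjunction of `x ≤ y` and `y ≤ x` cannot be decided; what remains of totality is that both
  -- cannot fail, because `_⋖_` is asymmetric.
  ≤-total : ∀ {x y} → ¬ (x ≤ y) → ¬ (y ≤ x) → ∀ {A : Set} → A
  ≤-total {x} {y} ¬x≤y ¬y≤x = contradiction (¬⋖⇒≤ λ y⋖x → ¬y≤x (¬⋖⇒≤ λ x⋖y → ⋖-asym {x} {y} x⋖y y⋖x)) ¬x≤y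
    where
    ⋖-asym : ∀ {x y} → x ⋖ y → ¬ (y ⋖ x)
    ⋖-asym {x} {y} (δ , 0<δ , p) (η , 0<η , q) = eventually-const
      ((λ {n} a b → ℚP.<-asym {ℚ.0ℚ} {seq y n ℚ.- seq x n} (ℚP.<-trans 0<δ a)
        (shift-< (ℚP.<-trans 0<η b) (rearrange (seq x n) (seq y n)))) ⟨$⟩ p ⟨*⟩ q)
      where
      open ℚSolver
      rearrange : ∀ x y → (y ℚ.- x) ℚ.+ (x ℚ.- y) ≡ ℚ.0ℚ ℚ.+ ℚ.0ℚ
      rearrange = solve 2 (λ x y → (y :- x) :+ (x :- y) := con ℚ.0ℚ :+ con ℚ.0ℚ) ≡.refl

  ¬1≤0 : ¬ (fromℕ 1 ≤ fromℕ 0)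
  ¬1≤0 1≤0 = ℚP.<-irrefl ≡.refl (eventually-const (below 1≤0 ℚ.1ℚ 0<1))

  ⊔0-close : ∀ {a ε} → ℚ.0ℚ ℚ.< ε → ℚ.0ℚ ℚ.< a ℚ.+ ε → ℚ.∣ a ℚ.- (a ℚ.⊔ ℚ.0ℚ) ∣ ℚ.< ε
  ⊔0-close {a} {ε} 0<ε p = ∣∣<-intro (ℚP.≤-<-trans (ℚP.p≤p⊔q a ℚ.0ℚ) (p<p+ε _ 0<ε)) ⊔<
    where
    ⊔< : a ℚ.⊔ ℚ.0ℚ ℚ.< a ℚ.+ ε
    ⊔< with ℚP.≤-total a ℚ.0ℚ
    ... | inj₁ a≤0 = ≡.subst (ℚ._< a ℚ.+ ε) (≡.sym (ℚP.p≤q⇒p⊔q≡q a≤0)) p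
    ... | inj₂ 0≤a = ≡.subst (ℚ._< a ℚ.+ ε) (≡.sym (ℚP.p≥q⇒p⊔q≡p 0≤a)) (p<p+ε a 0<ε)

  0≤⊔0*⊔0 : ∀ a b → ℚ.0ℚ ℚ.≤ (a ℚ.⊔ ℚ.0ℚ) ℚ.* (b ℚ.⊔ ℚ.0ℚ)
  0≤⊔0*⊔0 a b = ℚP.nonNegative⁻¹ _ {{ℚP.nonNeg*nonNeg⇒nonNeg (a ℚ.⊔ ℚ.0ℚ) {{ℚ.nonNegative (ℚP.p≤q⊔p a ℚ.0ℚ)}}
    (b ℚ.⊔ ℚ.0ℚ) {{ℚ.nonNegative (ℚP.p≤q⊔p b ℚ.0ℚ)}}}}

  ∣⊔0∣≤∣∣ : ∀ a → ℚ.∣ a ℚ.⊔ ℚ.0ℚ ∣ ℚ.≤ ℚ.∣ a ∣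
  ∣⊔0∣≤∣∣ a with ℚP.≤-total a ℚ.0ℚ
  ... | inj₁ a≤0 = ≡.subst (λ t → ℚ.∣ t ∣ ℚ.≤ ℚ.∣ a ∣) (≡.sym (ℚP.p≤q⇒p⊔q≡q a≤0)) (ℚP.0≤∣p∣ a)
  ... | inj₂ 0≤a = ℚP.≤-reflexive (≡.cong ℚ.∣_∣ (ℚP.p≥q⇒p⊔q≡p 0≤a))

  -- The terms of a non-negative real may be slightly negative. Truncated at 0 they have a
  -- non-negative product, and as the sequences are bounded, truncation eventually changes the
  -- product by less than ε.
  0≤-* : ∀ {x y} → fromℕ 0 ≤ x → fromℕ 0 ≤ y → fromℕ 0 ≤ x * y
  0≤-* {x} {y} 0≤x 0≤y .below ε 0<ε =
    let A , K , 0<A , x<A = cauchy-bound {seq x} (cauchy x)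
        B , L , 0<B , y<B = cauchy-bound {seq y} (cauchy y)
        δ , 0<δ , Cδ≡ε = divide (A ℚ.+ B) (ℚP.+-mono-< 0<A 0<B) 0<ε
    in (λ {n} a b c d → let u = seq x n ; v = seq y n in
         ℚP.≤-<-trans (0≤⊔0*⊔0 u v) (≡.subst (λ t → (u ℚ.⊔ ℚ.0ℚ) ℚ.* (v ℚ.⊔ ℚ.0ℚ) ℚ.< u ℚ.* v ℚ.+ t) Cδ≡ε
           (∣∣<-elim (≡.subst (ℚ._< (A ℚ.+ B) ℚ.* δ) (∣∣-comm (u ℚ.* v) ((u ℚ.⊔ ℚ.0ℚ) ℚ.* (v ℚ.⊔ ℚ.0ℚ)))
             (*-estimate u v (u ℚ.⊔ ℚ.0ℚ) (v ℚ.⊔ ℚ.0ℚ) a (ℚP.≤-<-trans (∣⊔0∣≤∣∣ v) b) 0<A 0<B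
               (⊔0-close {v} 0<δ d) (⊔0-close {u} 0<δ c))))))
       ⟨$⟩ (K , x<A) ⟨*⟩ (L , y<B) ⟨*⟩ below 0≤x δ 0<δ ⟨*⟩ below 0≤y δ 0<δ

  -- Apartness gives `δ < ∣xₙ∣` eventually, so `∣xₙ yₙ∣ < δ ε` can be divided by `δ`.
  ⋖0⊎0⋖⇒*-cancel : ∀ {x y} → (x ⋖ fromℕ 0) ⊎ (fromℕ 0 ⋖ x) → x * y ≈ fromℕ 0 → y ≈ fromℕ 0
  ⋖0⊎0⋖⇒*-cancel {x} {y} x≉0 xy≈0 .close ε 0<ε =
    let δ , 0<δ , p = apart x≉0
        0<δε = ≡.subst (ℚ._< δ ℚ.* ε) (ℚP.*-zeroʳ δ) (ℚP.*-monoʳ-<-pos δ {{ℚ.positive 0<δ}} 0<ε)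
    in (λ {n} a b → ≡.subst (ℚ._< ε) (≡.cong ℚ.∣_∣ (≡.sym (minus-zero (seq y n))))
         (ℚP.*-cancelˡ-<-nonNeg δ {{ℚ.nonNegative (ℚP.<⇒≤ 0<δ)}}
           (ℚP.≤-<-trans (ℚP.*-monoʳ-≤-nonNeg ℚ.∣ seq y n ∣ {{ℚP.∣-∣-nonNeg (seq y n)}} (ℚP.<⇒≤ a))
             (≡.subst (ℚ._< δ ℚ.* ε) (≡.trans (≡.cong ℚ.∣_∣ (minus-zero (seq x n ℚ.* seq y n))) (ℚP.∣p*q∣≡∣p∣*∣q∣ (seq x n) (seq y n))) b))))
       ⟨$⟩ p ⟨*⟩ close xy≈0 (δ ℚ.* ε) 0<δε
    where
    minus-zero : ∀ a → a ℚ.- ℚ.0ℚ ≡ a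
    minus-zero = ℚP.+-identityʳ
    apart : (x ⋖ fromℕ 0) ⊎ (fromℕ 0 ⋖ x) → ∃ λ δ → ℚ.0ℚ ℚ.< δ × Eventually (λ n → δ ℚ.< ℚ.∣ seq x n ∣)
    apart (inj₁ (δ , 0<δ , p)) = δ , 0<δ , (λ {n} a → ℚP.<-≤-trans a
      (≡.subst₂ ℚ._≤_ (≡.sym (ℚP.+-identityˡ (ℚ.- seq x n))) (ℚP.∣-p∣≡∣p∣ (seq x n)) (p≤∣p∣ (ℚ.- seq x n)))) ⟨$⟩ p
    apart (inj₂ (δ , 0<δ , p)) = δ , 0<δ , (λ {n} a → ℚP.<-≤-trans a
      (≡.subst (ℚ._≤ ℚ.∣ seq x n ∣) (≡.sym (minus-zero (seq x n))) (p≤∣p∣ (seq x n)))) ⟨$⟩ p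

  -- The goal consists of two stable inequalities, so `y ≉ 0` may be assumed. Then `x` is apart from
  -- 0 on neither side, that is, `x ≈ 0`.
  *≈0⇒≈0 : ∀ {x y} → x * y ≈ fromℕ 0 → ¬ (x ≈ fromℕ 0) → y ≈ fromℕ 0
  *≈0⇒≈0 {x} {y} xy≈0 x≉0 = ≤-antisym (≤-stable λ ¬p → x≉0 (x≈0 λ y≈0 → ¬p (≈⇒≤ y≈0)))
    (≤-stable λ ¬p → x≉0 (x≈0 λ y≈0 → ¬p (≈⇒≥ y≈0)))
    where
    x≈0 : ¬ (y ≈ fromℕ 0) → x ≈ fromℕ 0
    x≈0 y≉0 = ≤-antisym (¬⋖⇒≤ λ p → y≉0 (⋖0⊎0⋖⇒*-cancel (inj₂ p) xy≈0))
      (¬⋖⇒≤ λ p → y≉0 (⋖0⊎0⋖⇒*-cancel (inj₁ p) xy≈0))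

  0≤√ : ∀ x → fromℕ 0 ≤ √ x
  0≤√ x = pointwise-≤ λ n → sqrt≈-nonNeg (seq x n) n

  -- The approximations `r` satisfy `r² ≤ xₙ ⊔ 0 < (r + 1/(n+1))²`. The left part gives `upper`, as
  -- `0 ≤ x` makes the truncation negligible; the right part gives `lower`, as `r` stays bounded.
  √*√≈ : ∀ {x} → fromℕ 0 ≤ x → √ x * √ x ≈ x
  √*√≈ {x} 0≤x = ≤-antisym upper lower
    where
    upper : √ x * √ x ≤ x
    upper .below ε 0<ε = (λ {n} 0<x+ε → ℚP.≤-<-trans (sqrt≈-lower (seq x n) n)
        (∣∣<-elim (≡.subst (ℚ._< ε) (∣∣-comm (seq x n) (seq x n ℚ.⊔ ℚ.0ℚ)) (⊔0-close {seq x n} 0<ε 0<x+ε))))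
      ⟨$⟩ below 0≤x ε 0<ε
    -- Here `(r + t)² - r² = (2r + t) t` with `t = 1/(n+1) ≤ 1` and `r < B`, whence the constant
    -- `2B + 1`.
    square : ∀ {r t B δ ε} → ℚ.0ℚ ℚ.≤ r → ℚ.0ℚ ℚ.≤ t → r ℚ.< B → t ℚ.< δ → t ℚ.≤ ℚ.1ℚ →
      ((B ℚ.+ B) ℚ.+ ℚ.1ℚ) ℚ.* δ ≡ ε → (r ℚ.+ t) ℚ.* (r ℚ.+ t) ℚ.≤ r ℚ.* r ℚ.+ ε
    square {r} {t} {B} {δ} {ε} 0≤r 0≤t r<B t<δ t≤1 e = begin
      (r ℚ.+ t) ℚ.* (r ℚ.+ t)                    ≡⟨ expand r t ⟩
      r ℚ.* r ℚ.+ ((r ℚ.+ r) ℚ.+ t) ℚ.* t         ≤⟨ ℚP.+-monoʳ-≤ (r ℚ.* r) (ℚP.≤-trans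
        (ℚP.*-monoˡ-≤-nonNeg ((r ℚ.+ r) ℚ.+ t) {{ℚ.nonNegative 0≤2r+t}} (ℚP.<⇒≤ t<δ))
        (ℚP.*-monoʳ-≤-nonNeg δ {{ℚ.nonNegative (ℚP.≤-trans 0≤t (ℚP.<⇒≤ t<δ))}}
          (ℚP.+-mono-≤ (ℚP.+-mono-≤ (ℚP.<⇒≤ r<B) (ℚP.<⇒≤ r<B)) t≤1))) ⟩
      r ℚ.* r ℚ.+ ((B ℚ.+ B) ℚ.+ ℚ.1ℚ) ℚ.* δ     ≡⟨ ≡.cong (r ℚ.* r ℚ.+_) e ⟩
      r ℚ.* r ℚ.+ ε                              ∎
      where
      open ℚP.≤-Reasoning
      open ℚSolver
      expand : ∀ r t → (r ℚ.+ t) ℚ.* (r ℚ.+ t) ≡ r ℚ.* r ℚ.+ ((r ℚ.+ r) ℚ.+ t) ℚ.* t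
      expand = solve 2 (λ r t → (r :+ t) :* (r :+ t) := r :* r :+ ((r :+ r) :+ t) :* t) ≡.refl
      0≤2r+t : ℚ.0ℚ ℚ.≤ (r ℚ.+ r) ℚ.+ t
      0≤2r+t = ℚP.+-mono-≤ (ℚP.+-mono-≤ 0≤r 0≤r) 0≤t
    lower : x ≤ √ x * √ x
    lower .below ε 0<ε =
      let B , K , 0<B , r<B = cauchy-bound {seq (√ x)} (cauchy (√ x))
          0<C = ℚP.+-mono-< (ℚP.+-mono-< 0<B 0<B) 0<1
          δ , 0<δ , Cδ≡ε = divide ((B ℚ.+ B) ℚ.+ ℚ.1ℚ) 0<C 0<ε
      in (λ {n} a b → ℚP.≤-<-trans (ℚP.p≤p⊔q (seq x n) ℚ.0ℚ) (ℚP.<-≤-trans (sqrt≈-upper (seq x n) n)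
           (square (sqrt≈-nonNeg (seq x n) n) (0≤/ 1 n) (ℚP.≤-<-trans (p≤∣p∣ (sqrt≈ (seq x n) n)) a) b
             (/-≤ 1 n 1 0 (ℕ.s≤s ℕ.z≤n)) Cδ≡ε)))
         ⟨$⟩ (K , r<B) ⟨*⟩ archimedean δ 0<δ

-- The embedding of the integers into the rationals.

module IntegerEmbedding where

  abstract
    toℚᵘ-/1 : ∀ a → ℚ.toℚᵘ (a ℚ./ 1) ℚᵘ.≃ ℚᵘ.mkℚᵘ a 0
    toℚᵘ-/1 a = ℚP.toℚᵘ-fromℚᵘ (ℚᵘ.mkℚᵘ a 0)

    /1-homo-+ : ∀ a b → (a ℤ.+ b) ℚ./ 1 ≡ a ℚ./ 1 ℚ.+ b ℚ./ 1
    /1-homo-+ a b = ℚP.toℚᵘ-injective (begin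
      ℚ.toℚᵘ ((a ℤ.+ b) ℚ./ 1)                   ≈⟨ toℚᵘ-/1 (a ℤ.+ b) ⟩
      ℚᵘ.mkℚᵘ (a ℤ.+ b) 0                        ≈⟨ ℚᵘ.*≡* (over-1 a b) ⟩
      ℚᵘ.mkℚᵘ a 0 ℚᵘ.+ ℚᵘ.mkℚᵘ b 0               ≈⟨ ℚᵘP.+-cong (toℚᵘ-/1 a) (toℚᵘ-/1 b) ⟨
      ℚ.toℚᵘ (a ℚ./ 1) ℚᵘ.+ ℚ.toℚᵘ (b ℚ./ 1)     ≈⟨ ℚP.toℚᵘ-homo-+ (a ℚ./ 1) (b ℚ./ 1) ⟨
      ℚ.toℚᵘ (a ℚ./ 1 ℚ.+ b ℚ./ 1)               ∎)
      where
      open ℚᵘP.≃-Reasoning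
      open ℤSolver
      over-1 : ∀ a b → (a ℤ.+ b) ℤ.* + 1 ≡ (a ℤ.* + 1 ℤ.+ b ℤ.* + 1) ℤ.* + 1
      over-1 = solve 2 (λ a b → (a :+ b) :* con (+ 1) := (a :* con (+ 1) :+ b :* con (+ 1)) :* con (+ 1)) ≡.refl

    /1-homo-* : ∀ a b → (a ℤ.* b) ℚ./ 1 ≡ (a ℚ./ 1) ℚ.* (b ℚ./ 1)
    /1-homo-* a b = ℚP.toℚᵘ-injective (begin
      ℚ.toℚᵘ ((a ℤ.* b) ℚ./ 1)                   ≈⟨ toℚᵘ-/1 (a ℤ.* b) ⟩
      ℚᵘ.mkℚᵘ a 0 ℚᵘ.* ℚᵘ.mkℚᵘ b 0               ≈⟨ ℚᵘP.*-cong (toℚᵘ-/1 a) (toℚᵘ-/1 b) ⟨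
      ℚ.toℚᵘ (a ℚ./ 1) ℚᵘ.* ℚ.toℚᵘ (b ℚ./ 1)     ≈⟨ ℚP.toℚᵘ-homo-* (a ℚ./ 1) (b ℚ./ 1) ⟨
      ℚ.toℚᵘ ((a ℚ./ 1) ℚ.* (b ℚ./ 1))           ∎)
      where
      open ℚᵘP.≃-Reasoning

    /1-homo-neg : ∀ a → (ℤ.- a) ℚ./ 1 ≡ ℚ.- (a ℚ./ 1)
    /1-homo-neg a = ℚP.toℚᵘ-injective (begin
      ℚ.toℚᵘ ((ℤ.- a) ℚ./ 1)     ≈⟨ toℚᵘ-/1 (ℤ.- a) ⟩
      ℚᵘ.- ℚᵘ.mkℚᵘ a 0           ≈⟨ ℚᵘP.-‿cong (toℚᵘ-/1 a) ⟨
      ℚᵘ.- ℚ.toℚᵘ (a ℚ./ 1)      ≈⟨ ℚP.toℚᵘ-homo‿- (a ℚ./ 1) ⟨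
      ℚ.toℚᵘ (ℚ.- (a ℚ./ 1))     ∎)
      where
      open ℚᵘP.≃-Reasoning

    /1-mono-≤ : ∀ {a b} → a ℤ.≤ b → a ℚ./ 1 ℚ.≤ b ℚ./ 1
    /1-mono-≤ {a} {b} a≤b = ℚP.toℚᵘ-cancel-≤
      (ℚᵘP.≤-respˡ-≃ (ℚᵘP.≃-sym (toℚᵘ-/1 a)) (ℚᵘP.≤-respʳ-≃ (ℚᵘP.≃-sym (toℚᵘ-/1 b))
        (ℚᵘ.*≤* (ℤP.*-monoʳ-≤-nonNeg (+ 1) a≤b))))

-- Real roots of integral cubics by bisection.

module CubicRoots where

  open CauchySequences
  open ℝ
  open Real
  open _≤_
  open RealProperties
  open IntegerEmbedding

  module Bisection (g : ℚ → ℚ) (l₀ r₀ : ℚ) (l₀<r₀ : l₀ ℚ.< r₀)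
      (gl₀≤0 : g l₀ ℚ.≤ ℚ.0ℚ) (0≤gr₀ : ℚ.0ℚ ℚ.≤ g r₀) where

    record Bracket : Set where
      constructor bracket
      field
        l r : ℚ
        l≤r : l ℚ.≤ r
        gl≤0 : g l ℚ.≤ ℚ.0ℚ
        0≤gr : ℚ.0ℚ ℚ.≤ g r

    open Bracket

    mid : Bracket → ℚ
    mid b = ℚ.½ ℚ.* (l b ℚ.+ r b)

    0≤½* : ∀ {a} → ℚ.0ℚ ℚ.≤ a → ℚ.0ℚ ℚ.≤ ℚ.½ ℚ.* a
    0≤½* {a} 0≤a = ≡.subst (ℚ._≤ ℚ.½ ℚ.* a) (ℚP.*-zeroʳ ℚ.½) (ℚP.*-monoˡ-≤-nonNeg ℚ.½ 0≤a)

    0≤half-width : ∀ b → ℚ.0ℚ ℚ.≤ ℚ.½ ℚ.* (r b ℚ.- l b)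
    0≤half-width b = 0≤½* {r b ℚ.- l b} (shift-≤ (l≤r b) (rearrange (l b) (r b)))
      where
      open ℚSolver
      rearrange : ∀ l r → ℚ.0ℚ ℚ.+ r ≡ (r ℚ.- l) ℚ.+ l
      rearrange = solve 2 (λ l r → con ℚ.0ℚ :+ r := (r :- l) :+ l) ≡.refl

    l≤mid : ∀ b → l b ℚ.≤ mid b
    l≤mid b = shift-≤ (0≤half-width b) (rearrange (l b) (r b))
      where
      open ℚSolver
      rearrange : ∀ l r → l ℚ.+ ℚ.½ ℚ.* (r ℚ.- l) ≡ ℚ.½ ℚ.* (l ℚ.+ r) ℚ.+ ℚ.0ℚ
      rearrange = solve 2 (λ l r → l :+ con ℚ.½ :* (r :- l) := con ℚ.½ :* (l :+ r) :+ con ℚ.0ℚ) ≡.refl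

    mid≤r : ∀ b → mid b ℚ.≤ r b
    mid≤r b = shift-≤ (0≤half-width b) (rearrange (l b) (r b))
      where
      open ℚSolver
      rearrange : ∀ l r → ℚ.½ ℚ.* (l ℚ.+ r) ℚ.+ ℚ.½ ℚ.* (r ℚ.- l) ≡ r ℚ.+ ℚ.0ℚ
      rearrange = solve 2 (λ l r → con ℚ.½ :* (l :+ r) :+ con ℚ.½ :* (r :- l) := r :+ con ℚ.0ℚ) ≡.refl

    refine : Bracket → Bracket
    refine b with ℚP.≤-total (g (mid b)) ℚ.0ℚ
    ... | inj₁ g≤0 = bracket (mid b) (r b) (mid≤r b) g≤0 (0≤gr b)
    ... | inj₂ 0≤g = bracket (l b) (mid b) (l≤mid b) (gl≤0 b) 0≤g

    width : Bracket → ℚ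
    width b = r b ℚ.- l b

    refine-l : ∀ b → l b ℚ.≤ l (refine b)
    refine-l b with ℚP.≤-total (g (mid b)) ℚ.0ℚ
    ... | inj₁ _ = l≤mid b
    ... | inj₂ _ = ℚP.≤-refl

    refine-r : ∀ b → r (refine b) ℚ.≤ r b
    refine-r b with ℚP.≤-total (g (mid b)) ℚ.0ℚ
    ... | inj₁ _ = ℚP.≤-refl
    ... | inj₂ _ = mid≤r b

    refine-width : ∀ b → width (refine b) ≡ ℚ.½ ℚ.* width b
    refine-width b with ℚP.≤-total (g (mid b)) ℚ.0ℚ
    ... | inj₁ _ = rearrange (l b) (r b)
      where
      open ℚSolver
      rearrange : ∀ l r → r ℚ.- ℚ.½ ℚ.* (l ℚ.+ r) ≡ ℚ.½ ℚ.* (r ℚ.- l)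
      rearrange = solve 2 (λ l r → r :- con ℚ.½ :* (l :+ r) := con ℚ.½ :* (r :- l)) ≡.refl
    ... | inj₂ _ = rearrange (l b) (r b)
      where
      open ℚSolver
      rearrange : ∀ l r → ℚ.½ ℚ.* (l ℚ.+ r) ℚ.- l ≡ ℚ.½ ℚ.* (r ℚ.- l)
      rearrange = solve 2 (λ l r → con ℚ.½ :* (l :+ r) :- l := con ℚ.½ :* (r :- l)) ≡.refl

    b : ℕ → Bracket
    b zero = bracket l₀ r₀ (ℚP.<⇒≤ l₀<r₀) gl₀≤0 0≤gr₀
    b (suc n) = refine (b n)

    nested : ∀ m n → m ℕ.≤′ n → l (b m) ℚ.≤ l (b n) × r (b n) ℚ.≤ r (b m)
    nested m n ℕ.≤′-refl = ℚP.≤-refl , ℚP.≤-refl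
    nested m (suc n) (ℕ.≤′-step m≤n) = let p , q = nested m n m≤n in
      ℚP.≤-trans p (refine-l (b n)) , ℚP.≤-trans (refine-r (b n)) q

    0<w₀ : ℚ.0ℚ ℚ.< r₀ ℚ.- l₀
    0<w₀ = shift-< l₀<r₀ (rearrange l₀ r₀)
      where
      open ℚSolver
      rearrange : ∀ l r → ℚ.0ℚ ℚ.+ r ≡ (r ℚ.- l) ℚ.+ l
      rearrange = solve 2 (λ l r → con ℚ.0ℚ :+ r := (r :- l) :+ l) ≡.refl

    -- Halving gives more, but 1/(n+1) is the scale used in `archimedean`.
    width-≤ : ∀ n → width (b n) ℚ.≤ (r₀ ℚ.- l₀) ℚ.* (+ 1 ℚ./ suc n)
    width-≤ zero = ℚP.≤-reflexive (≡.sym (ℚP.*-identityʳ (r₀ ℚ.- l₀)))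
    width-≤ (suc n) = begin
      width (refine (b n))                             ≡⟨ refine-width (b n) ⟩
      ℚ.½ ℚ.* width (b n)                              ≤⟨ ℚP.*-monoˡ-≤-nonNeg ℚ.½ (width-≤ n) ⟩
      ℚ.½ ℚ.* ((r₀ ℚ.- l₀) ℚ.* (+ 1 ℚ./ suc n))        ≡⟨ rearrange (r₀ ℚ.- l₀) (+ 1 ℚ./ suc n) ⟩
      (r₀ ℚ.- l₀) ℚ.* (ℚ.½ ℚ.* (+ 1 ℚ./ suc n))
        ≤⟨ ℚP.*-monoˡ-≤-nonNeg (r₀ ℚ.- l₀) {{ℚ.nonNegative (ℚP.<⇒≤ 0<w₀)}} half-1/ ⟩
      (r₀ ℚ.- l₀) ℚ.* (+ 1 ℚ./ suc (suc n))            ∎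
      where
      open ℚP.≤-Reasoning
      open ℚSolver
      rearrange : ∀ w t → ℚ.½ ℚ.* (w ℚ.* t) ≡ w ℚ.* (ℚ.½ ℚ.* t)
      rearrange = solve 2 (λ w t → con ℚ.½ :* (w :* t) := w :* (con ℚ.½ :* t)) ≡.refl
      1/n+1≤2/n+2 : + 1 ℚ./ suc n ℚ.≤ + 1 ℚ./ suc (suc n) ℚ.+ + 1 ℚ./ suc (suc n)
      1/n+1≤2/n+2 = ≡.subst (+ 1 ℚ./ suc n ℚ.≤_) (suc/ 1 (suc n))
        (/-≤ 1 n 2 (suc n) (≡.subst₂ ℕ._≤_ (≡.sym (ℕP.*-identityˡ (suc (suc n))))
          (≡.cong (suc n ℕ.+_) (≡.sym (ℕP.+-identityʳ (suc n))))
          (ℕ.s≤s (ℕP.m≤n+m (suc n) n))))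
      half-1/ : ℚ.½ ℚ.* (+ 1 ℚ./ suc n) ℚ.≤ + 1 ℚ./ suc (suc n)
      half-1/ = ℚP.≤-trans (ℚP.*-monoˡ-≤-nonNeg ℚ.½ 1/n+1≤2/n+2)
        (ℚP.≤-reflexive (≡.trans (ℚP.*-distribˡ-+ ℚ.½ t t) (half+half t)))
        where
        t = + 1 ℚ./ suc (suc n)

    narrow : ∀ ε → ℚ.0ℚ ℚ.< ε → Eventually (λ n → r (b n) ℚ.< l (b n) ℚ.+ ε)
    narrow ε 0<ε =
      let δ , 0<δ , e = divide (r₀ ℚ.- l₀) 0<w₀ 0<ε
          N , p = archimedean δ 0<δ
      in N , λ n N≤n → shift-< (ℚP.≤-<-trans (width-≤ n)
           (≡.subst ((r₀ ℚ.- l₀) ℚ.* (+ 1 ℚ./ suc n) ℚ.<_) e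
             (ℚP.*-monoʳ-<-pos (r₀ ℚ.- l₀) {{ℚ.positive 0<w₀}} (p n N≤n))))
           (rearrange (l (b n)) (r (b n)) ε)
      where
      open ℚSolver
      rearrange : ∀ l r e → r ℚ.+ e ≡ (l ℚ.+ e) ℚ.+ (r ℚ.- l)
      rearrange = solve 3 (λ l r e → r :+ e := (l :+ e) :+ (r :- l)) ≡.refl

    lo hi : ℝ
    lo = mkℝ (λ n → l (b n)) λ ε 0<ε → let N , p = narrow ε 0<ε in
      N , λ m n N≤m N≤n → ∣∣<-intro (close m n N N≤m N≤n (p N ℕP.≤-refl)) (close n m N N≤n N≤m (p N ℕP.≤-refl))
      where
      close : ∀ m n N {ε} → N ℕ.≤ m → N ℕ.≤ n → r (b N) ℚ.< l (b N) ℚ.+ ε → l (b m) ℚ.< l (b n) ℚ.+ ε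
      close m n N {ε} N≤m N≤n p = ℚP.≤-<-trans (ℚP.≤-trans (l≤r (b m)) (proj₂ (nested N m (ℕP.≤⇒≤′ N≤m))))
        (ℚP.<-≤-trans p (ℚP.+-monoˡ-≤ ε (proj₁ (nested N n (ℕP.≤⇒≤′ N≤n)))))
    hi = mkℝ (λ n → r (b n)) λ ε 0<ε → let N , p = narrow ε 0<ε in
      N , λ m n N≤m N≤n → ∣∣<-intro (close m n N N≤m N≤n (p N ℕP.≤-refl)) (close n m N N≤n N≤m (p N ℕP.≤-refl))
      where
      close : ∀ m n N {ε} → N ℕ.≤ m → N ℕ.≤ n → r (b N) ℚ.< l (b N) ℚ.+ ε → r (b m) ℚ.< r (b n) ℚ.+ ε
      close m n N {ε} N≤m N≤n p = ℚP.≤-<-trans (proj₂ (nested N m (ℕP.≤⇒≤′ N≤m)))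
        (ℚP.<-≤-trans p (ℚP.+-monoˡ-≤ ε (ℚP.≤-trans (proj₁ (nested N n (ℕP.≤⇒≤′ N≤n))) (l≤r (b n)))))

    lo≈hi : lo ≈ hi
    lo≈hi = ≤-antisym (pointwise-≤ λ n → l≤r (b n)) (mk≤ narrow)

    -- The sign of `g` is known along `lo` from one side and along `hi` from the other. Since
    -- `lo≈hi`, the congruence of `G` combines the two and stands in for continuity.
    root : ∀ (G : ℝ → ℝ) → (∀ x n → seq (G x) n ≡ g (seq x n)) → (∀ {x y} → x ≈ y → G x ≈ G y) → G lo ≈ fromℕ 0
    root G G≡g G-cong = ≤-antisym
      (pointwise-≤ λ n → ℚP.≤-trans (ℚP.≤-reflexive (G≡g lo n)) (gl≤0 (b n)))
      (≤-trans (pointwise-≤ λ n → ℚP.≤-trans (0≤gr (b n)) (ℚP.≤-reflexive (≡.sym (G≡g hi n)))) (≈⇒≥ (G-cong lo≈hi)))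

  -- In Horner form the signs at a large argument can be read off step by step.
  cubicℤ : ℤ → ℤ → ℤ → ℤ → ℤ
  cubicℤ a b c t = c ℤ.+ t ℤ.* (b ℤ.+ t ℤ.* (a ℤ.+ t))

  -- Adding a coefficient in Horner's scheme uses up its absolute value from the lower bound `R`;
  -- multiplying by `R ≥ 1` preserves the bound. After all three coefficients 1 is left.
  0≤cubicℤ : ∀ a b c R → ℤ.∣ a ∣ ℕ.+ (ℤ.∣ b ∣ ℕ.+ (ℤ.∣ c ∣ ℕ.+ 1)) ≡ R → + 0 ℤ.≤ cubicℤ a b c (+ R)
  0≤cubicℤ a b c R R≡ = ℤP.≤-trans (ℤ.+≤+ ℕ.z≤n)
    (absorb c 1 (grow (ℤ.∣ c ∣ ℕ.+ 1) (absorb b _ (grow (ℤ.∣ b ∣ ℕ.+ (ℤ.∣ c ∣ ℕ.+ 1)) (absorb a _ (ℤP.≤-reflexive (≡.cong +_ R≡)))))))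
    where
    -∣i∣≤i : ∀ i → ℤ.- (+ ℤ.∣ i ∣) ℤ.≤ i
    -∣i∣≤i i with ℤP.+∣i∣≡i⊎+∣i∣≡-i i
    ... | inj₁ e = ≡.subst (λ t → ℤ.- (+ ℤ.∣ i ∣) ℤ.≤ t) e ℤP.neg-≤-pos
    ... | inj₂ e = ℤP.≤-reflexive (≡.trans (≡.cong ℤ.-_ e) (ℤP.neg-involutive i))
    absorb : ∀ i m {n} → + (ℤ.∣ i ∣ ℕ.+ m) ℤ.≤ n → + m ℤ.≤ i ℤ.+ n
    absorb i m {n} p = ≡.subst (ℤ._≤ i ℤ.+ n) (cancel (+ ℤ.∣ i ∣) (+ m)) (ℤP.+-mono-≤ (-∣i∣≤i i) p)
      where
      open ℤSolver
      cancel : ∀ i m → ℤ.- i ℤ.+ (i ℤ.+ m) ≡ m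
      cancel = solve 2 (λ i m → :- i :+ (i :+ m) := m) ≡.refl
    1≤R : 1 ℕ.≤ R
    1≤R = ≡.subst (1 ℕ.≤_) R≡ (ℕP.m≤n⇒m≤o+n ℤ.∣ a ∣ (ℕP.m≤n⇒m≤o+n ℤ.∣ b ∣ (ℕP.m≤n+m 1 ℤ.∣ c ∣)))
    grow : ∀ m {n} → + m ℤ.≤ n → + m ℤ.≤ + R ℤ.* n
    grow m {n} p = ℤP.≤-trans (≡.subst (ℤ._≤ + R ℤ.* + m) (ℤP.*-identityˡ (+ m)) (ℤP.*-monoʳ-≤-nonNeg (+ m) (ℤ.+≤+ 1≤R)))
      (ℤP.*-monoˡ-≤-nonNeg (+ R) p)

  -- Bisection needs only rational arguments, since arithmetic on reals is termwise: the real cubic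
  -- has `cubicℚ` of the terms as its terms, by definition.
  cubic-root : ∀ a b c → ∃ λ y → fromℤ c + y * (fromℤ b + y * (fromℤ a + y)) ≈ fromℕ 0
  cubic-root a b c = lo , root (λ y → fromℤ c + y * (fromℤ b + y * (fromℤ a + y))) (λ _ _ → ≡.refl)
      (λ p → +-cong ≈-refl (*-cong p (+-cong ≈-refl (*-cong p (+-cong ≈-refl p)))))
    where
    R = ℤ.∣ a ∣ ℕ.+ (ℤ.∣ b ∣ ℕ.+ (ℤ.∣ c ∣ ℕ.+ 1))
    cubicℚ : ℚ → ℚ
    cubicℚ t = c ℚ./ 1 ℚ.+ t ℚ.* (b ℚ./ 1 ℚ.+ t ℚ.* (a ℚ./ 1 ℚ.+ t))
    cubicℚ-/1 : ∀ t → cubicℤ a b c t ℚ./ 1 ≡ cubicℚ (t ℚ./ 1)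
    cubicℚ-/1 t = ≡.trans (/1-homo-+ c _) (≡.cong (c ℚ./ 1 ℚ.+_) (≡.trans (/1-homo-* t _) (≡.cong (t ℚ./ 1 ℚ.*_)
      (≡.trans (/1-homo-+ b _) (≡.cong (b ℚ./ 1 ℚ.+_) (≡.trans (/1-homo-* t _) (≡.cong (t ℚ./ 1 ℚ.*_) (/1-homo-+ a t))))))))
    cubic-odd : ∀ a b c t → cubicℤ a b c (ℤ.- t) ≡ ℤ.- cubicℤ (ℤ.- a) b (ℤ.- c) t
    cubic-odd = solve 4 (λ a b c t → c :+ :- t :* (b :+ :- t :* (a :+ :- t)) := :- (:- c :+ t :* (b :+ t :* (:- a :+ t)))) ≡.refl
      where
      open ℤSolver
    -R<R : (ℤ.- (+ R)) ℚ./ 1 ℚ.< + R ℚ./ 1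
    -R<R = ≡.subst (ℚ._< + R ℚ./ 1) (≡.sym (/1-homo-neg (+ R))) (ℚP.≤-<-trans (ℚP.neg-antimono-≤ (0≤/ R 0)) 0<R)
      where
      0<R : ℚ.0ℚ ℚ.< + R ℚ./ 1
      0<R = /-< 0 0 R 0 (≡.subst (0 ℕ.<_) (≡.sym (ℕP.*-identityʳ R))
        (ℕP.m≤n⇒m≤o+n ℤ.∣ a ∣ (ℕP.m≤n⇒m≤o+n ℤ.∣ b ∣ (ℕP.m≤n+m 1 ℤ.∣ c ∣))))
    ≤0-at-R : cubicℚ ((ℤ.- (+ R)) ℚ./ 1) ℚ.≤ ℚ.0ℚ
    -- Up to sign, the value at `-R` is the value at `R` of the cubic with coefficients `-a`, `b`,
    -- `-c`, whose absolute values give the same `R`.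
    ≤0-at-R = ≡.subst (ℚ._≤ ℚ.0ℚ) (cubicℚ-/1 (ℤ.- (+ R))) (/1-mono-≤ (≡.subst (ℤ._≤ + 0) (≡.sym (cubic-odd a b c (+ R)))
      (ℤP.neg-mono-≤ (0≤cubicℤ (ℤ.- a) b (ℤ.- c) R
        (≡.cong₂ (λ m n → m ℕ.+ (ℤ.∣ b ∣ ℕ.+ (n ℕ.+ 1))) (ℤP.∣-i∣≡∣i∣ a) (ℤP.∣-i∣≡∣i∣ c))))))
    0≤-at-R : ℚ.0ℚ ℚ.≤ cubicℚ (+ R ℚ./ 1)
    0≤-at-R = ≡.subst (ℚ.0ℚ ℚ.≤_) (cubicℚ-/1 (+ R)) (/1-mono-≤ (0≤cubicℤ a b c R ≡.refl))
    open Bisection cubicℚ ((ℤ.- (+ R)) ℚ./ 1) (+ R ℚ./ 1) -R<R ≤0-at-R 0≤-at-R using (lo; root)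

  fromℤ-homo-+ : ∀ a b → fromℤ (a ℤ.+ b) ≈ fromℤ a + fromℤ b
  fromℤ-homo-+ a b = pointwise-≈ λ _ → /1-homo-+ a b

  fromℤ-homo-* : ∀ a b → fromℤ (a ℤ.* b) ≈ fromℤ a * fromℤ b
  fromℤ-homo-* a b = pointwise-≈ λ _ → /1-homo-* a b

  fromℤ-homo-neg : ∀ a → fromℤ (ℤ.- a) ≈ - fromℤ a
  fromℤ-homo-neg a = pointwise-≈ λ _ → /1-homo-neg a

  fromℤ-mono-≤ : ∀ {a b} → a ℤ.≤ b → fromℤ a ≤ fromℤ b
  fromℤ-mono-≤ a≤b = pointwise-≤ λ _ → /1-mono-≤ a≤b

-- The commutative ring of coefficient lists, and evaluation.

IsCommutative : RawRing 0ℓ 0ℓ → Set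
IsCommutative R = IsCommutativeRing _≈_ _+_ _*_ -_ 0# 1#
  where
  open RawRing R

module PolynomialProperties (R : RawRing 0ℓ 0ℓ) (isCR : IsCommutative R) where

  private
    commutativeRing : CommutativeRing 0ℓ 0ℓ
    commutativeRing = record { isCommutativeRing = isCR }
    module R = CommutativeRing commutativeRing
    module R-Reasoning = Relation.Binary.Reasoning.Setoid R.setoid

  open Polynomial R
  open _≈_

  ≈-refl : ∀ {p} → p ≈ p
  ≈-refl .coeff-≈ i = R.refl

  ≈-sym : ∀ {p q} → p ≈ q → q ≈ p
  ≈-sym p≈q .coeff-≈ i = R.sym (coeff-≈ p≈q i)

  ≈-trans : ∀ {p q r} → p ≈ q → q ≈ r → p ≈ r
  ≈-trans p≈q q≈r .coeff-≈ i = R.trans (coeff-≈ p≈q i) (coeff-≈ q≈r i)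

  ∷-cong : ∀ {a b p q} → a R.≈ b → p ≈ q → a ∷ p ≈ b ∷ q
  ∷-cong a≈b p≈q .coeff-≈ zero = a≈b
  ∷-cong a≈b p≈q .coeff-≈ (suc i) = coeff-≈ p≈q i

  ∷-head : ∀ {a b p q} → a ∷ p ≈ b ∷ q → a R.≈ b
  ∷-head ap≈bq = coeff-≈ ap≈bq 0

  ∷-tail : ∀ {a b p q} → a ∷ p ≈ b ∷ q → p ≈ q
  ∷-tail ap≈bq .coeff-≈ i = coeff-≈ ap≈bq (suc i)

  0∷[]≈[] : R.0# ∷ [] ≈ []
  0∷[]≈[] .coeff-≈ zero = R.refl
  0∷[]≈[] .coeff-≈ (suc i) = R.refl

  coeff-+ : ∀ p q i → coeff (p + q) i R.≈ coeff p i R.+ coeff q i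
  coeff-+ [] q i = R.sym (R.+-identityˡ _)
  coeff-+ (a ∷ p) [] i = R.sym (R.+-identityʳ _)
  coeff-+ (a ∷ p) (b ∷ q) zero = R.refl
  coeff-+ (a ∷ p) (b ∷ q) (suc i) = coeff-+ p q i

  coeff-map : ∀ f → f R.0# R.≈ R.0# → ∀ p i → coeff (List.map f p) i R.≈ f (coeff p i)
  coeff-map f f0≈0 [] i = R.sym f0≈0
  coeff-map f f0≈0 (a ∷ p) zero = R.refl
  coeff-map f f0≈0 (a ∷ p) (suc i) = coeff-map f f0≈0 p i

  +-cong : ∀ {p q r s} → p ≈ q → r ≈ s → p + r ≈ q + s
  +-cong {p} {q} {r} {s} p≈q r≈s .coeff-≈ i = R.trans (coeff-+ p r i)
    (R.trans (R.+-cong (coeff-≈ p≈q i) (coeff-≈ r≈s i)) (R.sym (coeff-+ q s i)))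

  +-assoc : ∀ p q r → (p + q) + r ≈ p + (q + r)
  +-assoc p q r .coeff-≈ i = begin
    coeff ((p + q) + r) i                      ≈⟨ coeff-+ (p + q) r i ⟩
    coeff (p + q) i R.+ coeff r i              ≈⟨ R.+-congʳ (coeff-+ p q i) ⟩
    (coeff p i R.+ coeff q i) R.+ coeff r i    ≈⟨ R.+-assoc _ _ _ ⟩
    coeff p i R.+ (coeff q i R.+ coeff r i)    ≈⟨ R.+-congˡ (coeff-+ q r i) ⟨
    coeff p i R.+ coeff (q + r) i              ≈⟨ coeff-+ p (q + r) i ⟨
    coeff (p + (q + r)) i                      ∎
    where
    open R-Reasoning

  +-comm : ∀ p q → p + q ≈ q + p
  +-comm p q .coeff-≈ i = R.trans (coeff-+ p q i) (R.trans (R.+-comm _ _) (R.sym (coeff-+ q p i)))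

  +-identityʳ : ∀ p → p + [] ≈ p
  +-identityʳ p = +-comm p []

  coeff-neg : ∀ p i → coeff (List.map R.-_ p) i R.≈ R.- coeff p i
  coeff-neg = coeff-map R.-_ (Algebra.Properties.Ring.-0#≈0# R.ring)

  neg-cong : ∀ {p q} → p ≈ q → List.map R.-_ p ≈ List.map R.-_ q
  neg-cong {p} {q} p≈q .coeff-≈ i =
    R.trans (coeff-neg p i) (R.trans (R.-‿cong (coeff-≈ p≈q i)) (R.sym (coeff-neg q i)))

  neg-inverseʳ : ∀ p → p + List.map R.-_ p ≈ []
  neg-inverseʳ p .coeff-≈ i = R.trans (coeff-+ p _ i) (R.trans (R.+-congˡ (coeff-neg p i)) (R.-‿inverseʳ _))

  +-commutativeMonoid : CommutativeMonoid 0ℓ 0ℓ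
  +-commutativeMonoid = record
    { Carrier = Poly ; _≈_ = _≈_ ; _∙_ = _+_ ; ε = []
    ; isCommutativeMonoid = record
      { isMonoid = record
        { isSemigroup = record
          { isMagma = record
            { isEquivalence = record { refl = ≈-refl ; sym = ≈-sym ; trans = ≈-trans }
            ; ∙-cong = +-cong }
          ; assoc = +-assoc }
        ; identity = (λ p → ≈-refl) , +-identityʳ }
      ; comm = +-comm } }

  open CommutativeMonoid +-commutativeMonoid using () renaming (setoid to setoid; ∙-congˡ to +-congˡ; ∙-congʳ to +-congʳ)
  open Algebra.Properties.CommutativeSemigroup (CommutativeMonoid.commutativeSemigroup +-commutativeMonoid)
    using (interchange; x∙yz≈y∙xz)
  open Relation.Binary.Reasoning.Setoid setoid

  scale : R.Carrier → Poly → Poly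
  scale a = List.map (a R.*_)

  coeff-scale : ∀ a p i → coeff (scale a p) i R.≈ a R.* coeff p i
  coeff-scale a = coeff-map (a R.*_) (R.zeroʳ a)

  scale-cong : ∀ {a b p q} → a R.≈ b → p ≈ q → scale a p ≈ scale b q
  scale-cong {a} {b} {p} {q} a≈b p≈q .coeff-≈ i =
    R.trans (coeff-scale a p i) (R.trans (R.*-cong a≈b (coeff-≈ p≈q i)) (R.sym (coeff-scale b q i)))

  scale-+ : ∀ a p q → scale a (p + q) ≈ scale a p + scale a q
  scale-+ a [] q = ≈-refl
  scale-+ a (b ∷ p) [] = ≈-refl
  scale-+ a (b ∷ p) (c ∷ q) = ∷-cong (R.distribˡ a b c) (scale-+ a p q)

  +-scale : ∀ a b p → scale (a R.+ b) p ≈ scale a p + scale b p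
  +-scale a b [] = ≈-refl
  +-scale a b (c ∷ p) = ∷-cong (R.distribʳ c a b) (+-scale a b p)

  *-scale : ∀ a b p → scale (a R.* b) p ≈ scale a (scale b p)
  *-scale a b [] = ≈-refl
  *-scale a b (c ∷ p) = ∷-cong (R.*-assoc a b c) (*-scale a b p)

  1-scale : ∀ p → scale R.1# p ≈ p
  1-scale p .coeff-≈ i = R.trans (coeff-scale R.1# p i) (R.*-identityˡ _)

  0-scale : ∀ p → scale R.0# p ≈ []
  0-scale p .coeff-≈ i = R.trans (coeff-scale R.0# p i) (R.zeroˡ _)

  shift-+ : ∀ p q → R.0# ∷ (p + q) ≈ (R.0# ∷ p) + (R.0# ∷ q)
  shift-+ p q = ∷-cong (R.sym (R.+-identityˡ R.0#)) ≈-refl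

  *-congˡ : ∀ p {q r} → q ≈ r → p * q ≈ p * r
  *-congˡ [] q≈r = ≈-refl
  *-congˡ (a ∷ p) q≈r = +-cong (scale-cong R.refl q≈r) (∷-cong R.refl (*-congˡ p q≈r))

  -- Equal polynomials may be lists of different lengths. Where one list ends first, the rest of the
  -- other is a list of zeros, and this is the case that congruence of the product cannot treat
  -- coefficient by coefficient.
  ≈[]⇒*≈[] : ∀ p q → p ≈ [] → p * q ≈ []
  ≈[]⇒*≈[] [] q p≈[] = ≈-refl
  ≈[]⇒*≈[] (a ∷ p) q ap≈[] = begin
    scale a q + (R.0# ∷ p * q)      ≈⟨ +-cong (scale-cong a≈0 ≈-refl) (∷-cong R.refl (≈[]⇒*≈[] p q p≈[])) ⟩
    scale R.0# q + (R.0# ∷ [])      ≈⟨ +-cong (0-scale q) 0∷[]≈[] ⟩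
    []                              ∎
    where
    a≈0 : a R.≈ R.0#
    a≈0 = coeff-≈ ap≈[] 0
    p≈[] : p ≈ []
    p≈[] .coeff-≈ i = coeff-≈ ap≈[] (suc i)

  *-congʳ : ∀ {p q} r → p ≈ q → p * r ≈ q * r
  *-congʳ {[]} {q} r p≈q = ≈-sym (≈[]⇒*≈[] q r (≈-sym p≈q))
  *-congʳ {a ∷ p} {[]} r p≈q = ≈[]⇒*≈[] (a ∷ p) r p≈q
  *-congʳ {a ∷ p} {b ∷ q} r p≈q = +-cong (scale-cong (∷-head p≈q) ≈-refl) (∷-cong R.refl (*-congʳ r (∷-tail p≈q)))

  *-cong : ∀ {p q r s} → p ≈ q → r ≈ s → p * r ≈ q * s
  *-cong {p} {q} {r} p≈q r≈s = ≈-trans (*-congʳ r p≈q) (*-congˡ q r≈s)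

  *-distribʳ : ∀ r p q → (p + q) * r ≈ p * r + q * r
  *-distribʳ r [] q = ≈-refl
  *-distribʳ r (a ∷ p) [] = ≈-sym (+-identityʳ _)
  *-distribʳ r (a ∷ p) (b ∷ q) = begin
    scale (a R.+ b) r + (R.0# ∷ (p + q) * r)
      ≈⟨ +-cong (+-scale a b r) (≈-trans (∷-cong R.refl (*-distribʳ r p q)) (shift-+ (p * r) (q * r))) ⟩
    (scale a r + scale b r) + ((R.0# ∷ p * r) + (R.0# ∷ q * r))
      ≈⟨ interchange (scale a r) (scale b r) (R.0# ∷ p * r) (R.0# ∷ q * r) ⟩
    (a ∷ p) * r + (b ∷ q) * r ∎

  *-zeroʳ : ∀ p → p * [] ≈ []
  *-zeroʳ [] = ≈-refl
  *-zeroʳ (a ∷ p) = ≈-trans (∷-cong R.refl (*-zeroʳ p)) 0∷[]≈[]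

  -- The mirror image of the defining clause of `_*_`, from which commutativity follows by
  -- induction.
  *-∷ : ∀ p b q → p * (b ∷ q) ≈ scale b p + (R.0# ∷ p * q)
  *-∷ [] b q = ≈-sym 0∷[]≈[]
  *-∷ (a ∷ p) b q = ∷-cong (R.+-congʳ (R.*-comm a b)) (begin
    scale a q + p * (b ∷ q)                       ≈⟨ +-congˡ (*-∷ p b q) ⟩
    scale a q + (scale b p + (R.0# ∷ p * q))      ≈⟨ x∙yz≈y∙xz (scale a q) (scale b p) _ ⟩
    scale b p + (scale a q + (R.0# ∷ p * q))      ∎)

  *-comm : ∀ p q → p * q ≈ q * p
  *-comm [] q = ≈-sym (*-zeroʳ q)
  *-comm (a ∷ p) q = ≈-trans (+-congˡ (∷-cong R.refl (*-comm p q))) (≈-sym (*-∷ q a p))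

  scale-* : ∀ a p q → scale a p * q ≈ scale a (p * q)
  scale-* a [] q = ≈-refl
  scale-* a (b ∷ p) q = begin
    scale (a R.* b) q + (R.0# ∷ scale a p * q)
      ≈⟨ +-cong (*-scale a b q) (∷-cong (R.sym (R.zeroʳ a)) (scale-* a p q)) ⟩
    scale a (scale b q) + scale a (R.0# ∷ p * q)
      ≈⟨ scale-+ a (scale b q) (R.0# ∷ p * q) ⟨
    scale a ((b ∷ p) * q) ∎

  shift-* : ∀ p q → (R.0# ∷ p) * q ≈ R.0# ∷ (p * q)
  shift-* p q = +-congʳ (0-scale q)

  *-assoc : ∀ p q r → (p * q) * r ≈ p * (q * r)
  *-assoc [] q r = ≈-refl
  *-assoc (a ∷ p) q r = begin
    (scale a q + (R.0# ∷ p * q)) * r              ≈⟨ *-distribʳ r (scale a q) (R.0# ∷ p * q) ⟩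
    scale a q * r + (R.0# ∷ p * q) * r            ≈⟨ +-cong (scale-* a q r) (shift-* (p * q) r) ⟩
    scale a (q * r) + (R.0# ∷ (p * q) * r)        ≈⟨ +-congˡ (∷-cong R.refl (*-assoc p q r)) ⟩
    (a ∷ p) * (q * r)                             ∎

  *-identityˡ : ∀ p → (R.1# ∷ []) * p ≈ p
  *-identityˡ p = begin
    scale R.1# p + (R.0# ∷ [])   ≈⟨ +-cong (1-scale p) 0∷[]≈[] ⟩
    p + []                       ≈⟨ +-identityʳ p ⟩
    p                            ∎

  isCommutativeRing : IsCommutative rawRing
  isCommutativeRing = record
    { isRing = record
      { +-isAbelianGroup = record
        { isGroup = record
          { isMonoid = CommutativeMonoid.isMonoid +-commutativeMonoid
          ; inverse = (λ p → ≈-trans (+-comm _ p) (neg-inverseʳ p)) , neg-inverseʳ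
          ; ⁻¹-cong = neg-cong }
        ; comm = +-comm }
      ; *-cong = *-cong
      ; *-assoc = *-assoc
      ; *-identity = *-identityˡ , λ p → ≈-trans (*-comm p _) (*-identityˡ p)
      ; distrib = (λ p q r → ≈-trans (*-comm p (q + r)) (≈-trans (*-distribʳ p q r) (+-cong (*-comm q p) (*-comm r p))))
                , *-distribʳ }
    ; *-comm = *-comm }

  polynomialRing : CommutativeRing 0ℓ 0ℓ
  polynomialRing = record { isCommutativeRing = isCommutativeRing }

  ^-cong : ∀ {p q} n → p ≈ q → p ^ n ≈ q ^ n
  ^-cong zero p≈q = ≈-refl
  ^-cong (suc n) p≈q = *-cong p≈q (^-cong n p≈q)

  eval-≈[] : ∀ p x → p ≈ [] → eval p x R.≈ R.0#
  eval-≈[] [] x p≈[] = R.refl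
  eval-≈[] (a ∷ p) x ap≈[] = R.trans (R.+-cong (coeff-≈ ap≈[] 0) (R.trans (R.*-congˡ (eval-≈[] p x p≈[])) (R.zeroʳ x))) (R.+-identityˡ _)
    where
    p≈[] : p ≈ []
    p≈[] .coeff-≈ i = coeff-≈ ap≈[] (suc i)

  eval-cong : ∀ p q x → p ≈ q → eval p x R.≈ eval q x
  eval-cong [] q x p≈q = R.sym (eval-≈[] q x (≈-sym p≈q))
  eval-cong (a ∷ p) [] x p≈q = eval-≈[] (a ∷ p) x p≈q
  eval-cong (a ∷ p) (b ∷ q) x p≈q = R.+-cong (∷-head p≈q) (R.*-congˡ (eval-cong p q x (∷-tail p≈q)))

  eval-+ : ∀ p q x → eval (p + q) x R.≈ eval p x R.+ eval q x
  eval-+ [] q x = R.sym (R.+-identityˡ _)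
  eval-+ (a ∷ p) [] x = R.sym (R.+-identityʳ _)
  eval-+ (a ∷ p) (b ∷ q) x = R.trans (R.+-congˡ (R.trans (R.*-congˡ (eval-+ p q x)) (R.distribˡ x _ _)))
    (R-interchange a b _ _)
    where
    open Algebra.Properties.CommutativeSemigroup (CommutativeMonoid.commutativeSemigroup R.+-commutativeMonoid)
      using () renaming (interchange to R-interchange)

  eval-scale : ∀ a p x → eval (scale a p) x R.≈ a R.* eval p x
  eval-scale a [] x = R.sym (R.zeroʳ a)
  eval-scale a (b ∷ p) x = R.trans (R.+-congˡ (R.trans (R.*-congˡ (eval-scale a p x)) (x∙yz≈y∙xz′ x a _))) (R.sym (R.distribˡ a _ _))
    where
    open Algebra.Properties.CommutativeSemigroup (CommutativeMonoid.commutativeSemigroup R.*-commutativeMonoid)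
      using () renaming (x∙yz≈y∙xz to x∙yz≈y∙xz′)

  eval-* : ∀ p q x → eval (p * q) x R.≈ eval p x R.* eval q x
  eval-* [] q x = R.sym (R.zeroˡ _)
  eval-* (a ∷ p) q x = R.trans (eval-+ (scale a q) (R.0# ∷ p * q) x) (R.trans
    (R.+-cong (eval-scale a q x) (R.trans (R.+-identityˡ _) (R.trans (R.*-congˡ (eval-* p q x)) (R.sym (R.*-assoc x _ _)))))
    (R.sym (R.distribʳ (eval q x) a _)))

-- Ring homomorphisms applied to coefficients.

module PolynomialMap
  (R S : RawRing 0ℓ 0ℓ) (isCR : IsCommutative S)
  (φ : RawRing.Carrier R → RawRing.Carrier S)
  (φ-cong : ∀ {x y} → RawRing._≈_ R x y → RawRing._≈_ S (φ x) (φ y))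
  (φ-+ : ∀ x y → RawRing._≈_ S (φ (RawRing._+_ R x y)) (RawRing._+_ S (φ x) (φ y)))
  (φ-* : ∀ x y → RawRing._≈_ S (φ (RawRing._*_ R x y)) (RawRing._*_ S (φ x) (φ y)))
  (φ-0 : RawRing._≈_ S (φ (RawRing.0# R)) (RawRing.0# S))
  (φ-1 : RawRing._≈_ S (φ (RawRing.1# R)) (RawRing.1# S))
  where

  private
    commutativeRing : CommutativeRing 0ℓ 0ℓ
    commutativeRing = record { isCommutativeRing = isCR }
    module S = CommutativeRing commutativeRing
    module P = Polynomial R
    module Q = Polynomial S
    open PolynomialProperties S isCR

  coeff-map-φ : ∀ p i → Q.coeff (List.map φ p) i S.≈ φ (P.coeff p i)
  coeff-map-φ [] i = S.sym φ-0
  coeff-map-φ (a ∷ p) zero = S.refl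
  coeff-map-φ (a ∷ p) (suc i) = coeff-map-φ p i

  map-cong : ∀ {p q} → p P.≈ q → List.map φ p Q.≈ List.map φ q
  map-cong {p} {q} p≈q .Q._≈_.coeff-≈ i =
    S.trans (coeff-map-φ p i) (S.trans (φ-cong (P._≈_.coeff-≈ p≈q i)) (S.sym (coeff-map-φ q i)))

  map-+ : ∀ p q → List.map φ (p P.+ q) Q.≈ List.map φ p Q.+ List.map φ q
  map-+ [] q = ≈-refl
  map-+ (a ∷ p) [] = ≈-refl
  map-+ (a ∷ p) (b ∷ q) = ∷-cong (φ-+ a b) (map-+ p q)

  map-scale : ∀ a p → List.map φ (List.map (RawRing._*_ R a) p) Q.≈ scale (φ a) (List.map φ p)
  map-scale a [] = ≈-refl
  map-scale a (b ∷ p) = ∷-cong (φ-* a b) (map-scale a p)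

  map-* : ∀ p q → List.map φ (p P.* q) Q.≈ List.map φ p Q.* List.map φ q
  map-* [] q = ≈-refl
  map-* (a ∷ p) q = ≈-trans (map-+ (List.map (RawRing._*_ R a) q) (RawRing.0# R ∷ p P.* q))
    (+-cong (map-scale a q) (∷-cong φ-0 (map-* p q)))

  map-^ : ∀ p n → List.map φ (p P.^ n) Q.≈ List.map φ p Q.^ n
  map-^ p zero = ∷-cong φ-1 ≈-refl
  map-^ p (suc n) = ≈-trans (map-* p (p P.^ n)) (*-congˡ (List.map φ p) (map-^ p n))

-- The order is only assumed total up to double negation, but
-- ≤ is stable, so inequalities and equations may be proved classically.
record RealStructure : Set₁ where
  infix 8 -_
  infixl 7 _*_
  infixl 6 _+_
  infix 4 _≈_ _≤_
  field
    Carrier : Set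
    _≈_ _≤_ : Carrier → Carrier → Set
    _+_ _*_ : Carrier → Carrier → Carrier
    -_ : Carrier → Carrier
    num : ℤ → Carrier

  rawRing : RawRing 0ℓ 0ℓ
  rawRing = record
    { Carrier = Carrier ; _≈_ = _≈_ ; _+_ = _+_ ; _*_ = _*_ ; -_ = -_ ; 0# = num (+ 0) ; 1# = num (+ 1) }

  field
    isCommutative : IsCommutative rawRing
    num-+ : ∀ a b → num (a ℤ.+ b) ≈ num a + num b
    num-* : ∀ a b → num (a ℤ.* b) ≈ num a * num b
    num-neg : ∀ a → num (ℤ.- a) ≈ - num a
    num-mono : ∀ {a b} → a ℤ.≤ b → num a ≤ num b
    ≈⇒≤ : ∀ {x y} → x ≈ y → x ≤ y
    ≤-trans : ∀ {x y z} → x ≤ y → y ≤ z → x ≤ z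
    ≤-antisym : ∀ {x y} → x ≤ y → y ≤ x → x ≈ y
    ≤-stable : ∀ {x y} → ¬ ¬ (x ≤ y) → x ≤ y
    ≤-total : ∀ {x y} → ¬ (x ≤ y) → ¬ (y ≤ x) → ⊥
    +-mono-≤ : ∀ {x y u v} → x ≤ y → u ≤ v → x + u ≤ y + v
    0≤-* : ∀ {x y} → num (+ 0) ≤ x → num (+ 0) ≤ y → num (+ 0) ≤ x * y
    *≈0⇒≈0 : ∀ {x y} → x * y ≈ num (+ 0) → ¬ (x ≈ num (+ 0)) → y ≈ num (+ 0)
    ¬1≤0 : ¬ (num (+ 1) ≤ num (+ 0))
    ½ : Carrier
    2*½≈1 : num (+ 2) * ½ ≈ num (+ 1)
    √ : Carrier → Carrier
    0≤√ : ∀ x → num (+ 0) ≤ √ x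
    √*√≈ : ∀ {x} → num (+ 0) ≤ x → √ x * √ x ≈ x
    cubic-root : ∀ a b c → ∃ λ y → num c + y * (num b + y * (num a + y)) ≈ num (+ 0)

-- Consequences of the axioms, with equations left to a ring solver.

module RealAlgebra (S : RealStructure) where

  open RealStructure S

  commutativeRing : CommutativeRing 0ℓ 0ℓ
  commutativeRing = record { isCommutativeRing = isCommutative }

  open CommutativeRing commutativeRing
    using (_-_; refl; sym; trans; setoid; +-cong; +-congˡ; +-congʳ; *-cong; *-congˡ; *-congʳ; -‿cong; *-comm; +-comm)
  module R = CommutativeRing commutativeRing
  open Relation.Binary.Reasoning.Setoid setoid

  -- Coefficients are taken in the integers, so that the solver can decide which ones cancel
  -- although equality in `Carrier` is undecidable.
  numHomomorphism : ℤ.+-*-rawRing -Raw-AlmostCommutative⟶ fromCommutativeRing commutativeRing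
  numHomomorphism = record
    { ⟦_⟧ = num ; +-homo = num-+ ; *-homo = num-* ; -‿homo = num-neg ; 0-homo = refl ; 1-homo = refl }

  module Solver = Algebra.Solver.Ring ℤ.+-*-rawRing (fromCommutativeRing commutativeRing) numHomomorphism
    (λ a b → Maybe.map (λ e → R.reflexive (≡.cong num e)) (dec⇒maybe (a ℤP.≟ b)))
  open Solver using (con; _:=_; _:+_; _:*_; _:-_; :-_) renaming (Polynomial to Expr)

  -- Unlike Solver.solve this compares the normal forms as data: the proof terms then do not
  -- contain the values of the normal forms, which are large.
  solve : ∀ n (f : N-ary n (Expr n) (Expr n × Expr n)) →
    let e₁ , e₂ = f $ⁿ Vec.map Solver.var (Vec.allFin n) in
    {T (Maybe.is-just (Solver.normalise e₁ Solver.≟N Solver.normalise e₂))} →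
    Eq n _≈_ (curryⁿ Solver.⟦ e₁ ⟧) (curryⁿ Solver.⟦ e₂ ⟧)
  solve n f {same} =
    let e₁ , e₂ = f $ⁿ Vec.map Solver.var (Vec.allFin n) in
    curryⁿ-cong _≈_ Solver.⟦ e₁ ⟧ Solver.⟦ e₂ ⟧ λ ρ →
      Solver.prove ρ e₁ e₂ (Solver.⟦ Maybe.to-witness-T (Solver.normalise e₁ Solver.≟N Solver.normalise e₂) same ⟧N-cong ρ)

  open Polynomial rawRing using (Poly; coeff; eval; C; X) renaming (_+_ to _⊞_; _*_ to _⊠_; _≈_ to _≋_; _^_ to _⊠^_)
  open RawRing rawRing using (0#; 1#)
  module P = PolynomialProperties rawRing isCommutative

  0≤-resp : ∀ {x y} → x ≈ y → 0# ≤ x → 0# ≤ y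
  0≤-resp x≈y 0≤x = ≤-trans 0≤x (≈⇒≤ x≈y)

  ≈⇒≥ : ∀ {x y} → x ≈ y → y ≤ x
  ≈⇒≥ x≈y = ≈⇒≤ (sym x≈y)

  ≤⇒0≤- : ∀ {x y} → x ≤ y → 0# ≤ y - x
  ≤⇒0≤- {x} {y} x≤y = ≤-trans (≈⇒≥ (R.-‿inverseʳ x)) (+-mono-≤ x≤y (≈⇒≤ refl))

  0≤-⇒≤ : ∀ {x y} → 0# ≤ y - x → x ≤ y
  0≤-⇒≤ {x} {y} 0≤y-x = ≤-trans (≈⇒≥ (R.+-identityˡ x)) (≤-trans (+-mono-≤ 0≤y-x (≈⇒≤ refl)) (≈⇒≤ (cancel x y)))
    where
    cancel : ∀ x y → (y - x) + x ≈ y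
    cancel = solve 2 (λ x y → (y :- x) :+ x := y)

  0≤⇒≤ : ∀ {x y z} → 0# ≤ z → z ≈ y - x → x ≤ y
  0≤⇒≤ 0≤z e = 0≤-⇒≤ (0≤-resp e 0≤z)

  0≤-+ : ∀ {x y} → 0# ≤ x → 0# ≤ y → 0# ≤ x + y
  0≤-+ 0≤x 0≤y = ≤-trans (≈⇒≥ (R.+-identityˡ 0#)) (+-mono-≤ 0≤x 0≤y)

  0≤-neg : ∀ {x} → x ≤ 0# → 0# ≤ - x
  0≤-neg {x} x≤0 = 0≤-resp (R.+-identityˡ (- x)) (≤⇒0≤- x≤0)

  0≤-num : ∀ n → 0# ≤ num (+ n)
  0≤-num n = num-mono (ℤ.+≤+ ℕ.z≤n)

  ≰⇒≥ : ∀ {x y} → ¬ (x ≤ y) → y ≤ x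
  ≰⇒≥ x≰y = ≤-stable (≤-total x≰y)

  -- Case distinction along the order is admissible here because the goal is stable.
  by-cases : ∀ {x y u v} → (u ≤ v → x ≤ y) → (v ≤ u → x ≤ y) → x ≤ y
  by-cases f g = ≤-stable λ x≰y → x≰y (g (≰⇒≥ λ u≤v → x≰y (f u≤v)))

  ≈-stable : ∀ {x y} → ¬ ¬ (x ≈ y) → x ≈ y
  ≈-stable ¬¬x≈y = ≤-antisym (≤-stable λ x≰y → ¬¬x≈y λ x≈y → x≰y (≈⇒≤ x≈y))
    (≤-stable λ y≰x → ¬¬x≈y λ x≈y → y≰x (≈⇒≥ x≈y))

  0≤-square : ∀ x → 0# ≤ x * x
  0≤-square x = by-cases (λ 0≤x → 0≤-* 0≤x 0≤x) (λ x≤0 → 0≤-resp (neg-square x) (0≤-* (0≤-neg x≤0) (0≤-neg x≤0)))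
    where
    neg-square : ∀ x → - x * - x ≈ x * x
    neg-square = solve 1 (λ x → :- x :* :- x := x :* x)

  +≈0⇒≈0 : ∀ {x y} → 0# ≤ x → 0# ≤ y → x + y ≈ 0# → x ≈ 0#
  +≈0⇒≈0 {x} {y} 0≤x 0≤y x+y≈0 = ≤-antisym (0≤⇒≤ 0≤y (trans (difference x y) (+-congʳ x+y≈0))) 0≤x
    where
    difference : ∀ x y → y ≈ (x + y) - x
    difference = solve 2 (λ x y → y := (x :+ y) :- x)

  square≈0⇒≈0 : ∀ {x} → x * x ≈ 0# → x ≈ 0#
  square≈0⇒≈0 xx≈0 = ≈-stable λ x≉0 → x≉0 (*≈0⇒≈0 xx≈0 x≉0)

  *≈0 : ∀ {x y} → x * y ≈ 0# → ¬ ¬ (x ≈ 0# ⊎ y ≈ 0#)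
  *≈0 xy≈0 ¬xy = ¬xy (inj₂ (*≈0⇒≈0 xy≈0 λ x≈0 → ¬xy (inj₁ x≈0)))

  -0≈0 : - 0# ≈ 0#
  -0≈0 = solve 0 (:- con (+ 0) := con (+ 0))

  -≈0⇒≈ : ∀ {x y} → x - y ≈ 0# → x ≈ y
  -≈0⇒≈ {x} {y} x-y≈0 = begin
    x              ≈⟨ solve 2 (λ x y → x := (x :- y) :+ y) x y ⟩
    (x - y) + y    ≈⟨ +-congʳ x-y≈0 ⟩
    0# + y         ≈⟨ R.+-identityˡ y ⟩
    y              ∎

  ≈⇒-≈0 : ∀ {x y} → x ≈ y → x - y ≈ 0#
  ≈⇒-≈0 {x} {y} x≈y = trans (+-congʳ x≈y) (R.-‿inverseʳ y)

  -- The solver knows no relations such as `s * s ≈ Q` or `2 * ½ ≈ 1`. An identity that holds modulo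
  -- such a relation becomes a plain ring identity once the cofactor `k` is written out.
  modulo : ∀ {x y e} k → e ≈ 0# → x ≈ y + e * k → x ≈ y
  modulo {x} {y} {e} k e≈0 p = begin
    x            ≈⟨ p ⟩
    y + e * k    ≈⟨ +-congˡ (trans (*-congʳ e≈0) (R.zeroˡ k)) ⟩
    y + 0#       ≈⟨ R.+-identityʳ y ⟩
    y            ∎

  -- If `y < x`, then `(x - y)(x + y)` and `y² - x²` are non-negative with sum 0, so the product
  -- vanishes. As `x ≉ y`, this leaves `x + y ≈ 0`, hence `x ≈ 0 ≤ y`.
  square-cancel-≤ : ∀ {x y} → 0# ≤ y → x * x ≤ y * y → x ≤ y
  square-cancel-≤ {x} {y} 0≤y xx≤yy = ≤-stable λ x≰y →
    let 0≤x = ≤-trans 0≤y (≰⇒≥ x≰y)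
        product≈0 = +≈0⇒≈0 (0≤-* (≤⇒0≤- (≰⇒≥ x≰y)) (0≤-+ 0≤x 0≤y)) (≤⇒0≤- xx≤yy) (difference-of-squares x y)
        x+y≈0 = *≈0⇒≈0 product≈0 λ x-y≈0 → x≰y (≈⇒≤ (-≈0⇒≈ x-y≈0))
    in x≰y (≤-trans (≈⇒≤ (+≈0⇒≈0 0≤x 0≤y x+y≈0)) 0≤y)
    where
    difference-of-squares : ∀ x y → (x - y) * (x + y) + (y * y - x * x) ≈ 0#
    difference-of-squares = solve 2 (λ x y → (x :- y) :* (x :+ y) :+ (y :* y :- x :* x) := con (+ 0))

  square-injective : ∀ {x y} → 0# ≤ x → 0# ≤ y → x * x ≈ y * y → x ≈ y
  square-injective 0≤x 0≤y xx≈yy = ≤-antisym (square-cancel-≤ 0≤y (≈⇒≤ xx≈yy)) (square-cancel-≤ 0≤x (≈⇒≥ xx≈yy))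

  -- For negative `y`, both `xy` and `x(-y)` would be non-negative with sum 0.
  0≤-*⁻ : ∀ {x y} → ¬ (x ≤ 0#) → 0# ≤ x * y → 0# ≤ y
  0≤-*⁻ {x} {y} x≰0 0≤xy = ≤-stable λ 0≰y →
    let 0≤-xy = 0≤-* (≰⇒≥ x≰0) (0≤-neg (≰⇒≥ 0≰y))
    in 0≰y (≈⇒≥ (*≈0⇒≈0 (+≈0⇒≈0 0≤xy 0≤-xy (solve 2 (λ x y → x :* y :+ x :* :- y := con (+ 0)) x y)) λ x≈0 → x≰0 (≈⇒≤ x≈0)))

  num-cancel-≤ : ∀ {a b} → num a ≤ num b → a ℤ.≤ b
  num-cancel-≤ {a} {b} p with a ℤP.≤? b
  ... | yes a≤b = a≤b
  ... | no a≰b = contradiction (0≤⇒≤ (≤⇒0≤- (≤-trans (num-mono (ℤP.i<j⇒suc[i]≤j (ℤP.≰⇒> a≰b))) p))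
      (trans (+-congˡ (-‿cong (num-+ (+ 1) b))) (solve 1 (λ b → b :- (con (+ 1) :+ b) := con (+ 0) :- con (+ 1)) (num b)))) ¬1≤0

  num-injective : ∀ {a b} → num a ≈ num b → a ≡ b
  num-injective p = ℤP.≤-antisym (num-cancel-≤ (≈⇒≤ p)) (num-cancel-≤ (≈⇒≥ p))

  num-suc≰0 : ∀ n → ¬ (num (+ suc n) ≤ 0#)
  num-suc≰0 n p = contradiction (num-cancel-≤ p) λ { (ℤ.+≤+ ()) }

  num-∣∣ : ∀ a → num (+ ℤ.∣ a ∣) ≈ num a ⊎ num (+ ℤ.∣ a ∣) ≈ - num a
  num-∣∣ a = Sum.map (λ e → R.reflexive (≡.cong num e)) (λ e → trans (R.reflexive (≡.cong num e)) (num-neg a)) (ℤP.+∣i∣≡i⊎+∣i∣≡-i a)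

  -- If u < 0, then all terms of (-u)³ + e₁u² + e₂(-u) + e₃ ≈ 0 are non-negative.
  nonNegative-root : ∀ e₁ e₂ e₃ u → 0# ≤ e₁ → 0# ≤ e₂ → 0# ≤ e₃ →
    u * u * u + e₂ * u ≈ e₁ * (u * u) + e₃ → 0# ≤ u
  nonNegative-root e₁ e₂ e₃ u 0≤e₁ 0≤e₂ 0≤e₃ e = ≤-stable λ 0≰u →
    let v = - u
        0≤v = 0≤-neg (≰⇒≥ 0≰u)
        0≤vvv = 0≤-* (0≤-* 0≤v 0≤v) 0≤v
        vvv≈0 = +≈0⇒≈0 0≤vvv (0≤-+ (0≤-* 0≤e₂ 0≤v) (0≤-+ (0≤-* 0≤e₁ (0≤-square u)) 0≤e₃))
          (trans (solve 4 (λ e₁ e₂ e₃ u → :- u :* :- u :* :- u :+ (e₂ :* :- u :+ (e₁ :* (u :* u) :+ e₃)) :=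
              (e₁ :* (u :* u) :+ e₃) :- (u :* u :* u :+ e₂ :* u)) e₁ e₂ e₃ u) (≈⇒-≈0 (sym e)))
        -- The cube is removed through `v⁴ = v³ v`, so that cancelling squares twice is enough.
        vv≈0 = ≈-stable λ vv≉0 → vv≉0 (square≈0⇒≈0 (trans (solve 1 (λ v → (v :* v) :* (v :* v) := (v :* v :* v) :* v) v)
          (trans (*-congʳ vvv≈0) (R.zeroˡ v))))
        v≈0 = square≈0⇒≈0 vv≈0
    in 0≰u (≈⇒≥ (trans (solve 1 (λ u → u := :- (:- u)) u) (trans (-‿cong v≈0) -0≈0)))

  -- Complex identities, reduced to real ones for the solver.

  module ComplexIdentities where


    -- Generic in the base ring, so that it applies to solver expressions as well: the components of
    -- a product of pairs of expressions are the syntax of the real and imaginary parts.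
    complex : RawRing 0ℓ 0ℓ → RawRing 0ℓ 0ℓ
    complex R = record
      { Carrier = A × A ; _≈_ = λ z w → proj₁ z ≈ᴿ proj₁ w × proj₂ z ≈ᴿ proj₂ w
      ; _+_ = λ z w → (proj₁ z +ᴿ proj₁ w) , (proj₂ z +ᴿ proj₂ w)
      ; _*_ = λ z w → (proj₁ z *ᴿ proj₁ w +ᴿ -ᴿ (proj₂ z *ᴿ proj₂ w)) , (proj₁ z *ᴿ proj₂ w +ᴿ proj₂ z *ᴿ proj₁ w)
      ; -_ = λ z → -ᴿ proj₁ z , -ᴿ proj₂ z ; 0# = 0ᴿ , 0ᴿ ; 1# = 1ᴿ , 0ᴿ }
      where
      open RawRing R using () renaming (Carrier to A; _≈_ to _≈ᴿ_; _+_ to _+ᴿ_; _*_ to _*ᴿ_; -_ to -ᴿ_; 0# to 0ᴿ; 1# to 1ᴿ)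

    private
      Exprᶜ : ∀ n → RawRing 0ℓ 0ℓ
      Exprᶜ n = complex record
        { Carrier = Expr n ; _≈_ = _≡_ ; _+_ = _:+_ ; _*_ = _:*_ ; -_ = :-_ ; 0# = con (+ 0) ; 1# = con (+ 1) }

    module Cx = RawRing (complex rawRing)

    *-assocᶜ : ∀ z w v → (z Cx.* w) Cx.* v Cx.≈ z Cx.* (w Cx.* v)
    *-assocᶜ (a , b) (c , d) (e , f) =
      solve 6 (λ a b c d e f → proj₁ (((a , b) E* (c , d)) E* (e , f)) := proj₁ ((a , b) E* ((c , d) E* (e , f)))) a b c d e f ,
      solve 6 (λ a b c d e f → proj₂ (((a , b) E* (c , d)) E* (e , f)) := proj₂ ((a , b) E* ((c , d) E* (e , f)))) a b c d e f
      where
      _E*_ = RawRing._*_ (Exprᶜ 6)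

    *-commᶜ : ∀ z w → z Cx.* w Cx.≈ w Cx.* z
    *-commᶜ (a , b) (c , d) =
      solve 4 (λ a b c d → proj₁ ((a , b) E* (c , d)) := proj₁ ((c , d) E* (a , b))) a b c d ,
      solve 4 (λ a b c d → proj₂ ((a , b) E* (c , d)) := proj₂ ((c , d) E* (a , b))) a b c d
      where
      _E*_ = RawRing._*_ (Exprᶜ 4)

    *-distribʳᶜ : ∀ z w v → (w Cx.+ v) Cx.* z Cx.≈ w Cx.* z Cx.+ v Cx.* z
    *-distribʳᶜ (a , b) (c , d) (e , f) =
      solve 6 (λ a b c d e f → proj₁ (((c , d) E+ (e , f)) E* (a , b)) := proj₁ (((c , d) E* (a , b)) E+ ((e , f) E* (a , b)))) a b c d e f ,
      solve 6 (λ a b c d e f → proj₂ (((c , d) E+ (e , f)) E* (a , b)) := proj₂ (((c , d) E* (a , b)) E+ ((e , f) E* (a , b)))) a b c d e f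
      where
      _E*_ = RawRing._*_ (Exprᶜ 6)
      _E+_ = RawRing._+_ (Exprᶜ 6)

    *-identityˡᶜ : ∀ z → Cx.1# Cx.* z Cx.≈ z
    *-identityˡᶜ (a , b) =
      solve 2 (λ a b → proj₁ (RawRing.1# (Exprᶜ 2) E* (a , b)) := a) a b ,
      solve 2 (λ a b → proj₂ (RawRing.1# (Exprᶜ 2) E* (a , b)) := b) a b
      where
      _E*_ = RawRing._*_ (Exprᶜ 2)

    *-distribˡᶜ : ∀ z w v → z Cx.* (w Cx.+ v) Cx.≈ z Cx.* w Cx.+ z Cx.* v
    *-distribˡᶜ (a , b) (c , d) (e , f) =
      solve 6 (λ a b c d e f → proj₁ ((a , b) E* ((c , d) E+ (e , f))) := proj₁ (((a , b) E* (c , d)) E+ ((a , b) E* (e , f)))) a b c d e f ,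
      solve 6 (λ a b c d e f → proj₂ ((a , b) E* ((c , d) E+ (e , f))) := proj₂ (((a , b) E* (c , d)) E+ ((a , b) E* (e , f)))) a b c d e f
      where
      _E*_ = RawRing._*_ (Exprᶜ 6)
      _E+_ = RawRing._+_ (Exprᶜ 6)

    *-identityʳᶜ : ∀ z → z Cx.* Cx.1# Cx.≈ z
    *-identityʳᶜ (a , b) =
      solve 2 (λ a b → proj₁ ((a , b) E* RawRing.1# (Exprᶜ 2)) := a) a b ,
      solve 2 (λ a b → proj₂ ((a , b) E* RawRing.1# (Exprᶜ 2)) := b) a b
      where
      _E*_ = RawRing._*_ (Exprᶜ 2)

    private
      module PE = Polynomial (Exprᶜ 2)
      module PC = Polynomial (complex rawRing)

      conjugatesᴱ : Expr 2 → Expr 2 → PE.Poly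
      conjugatesᴱ a b = (PE.X PE.+ PE.C (-ᴱ (a , b))) PE.* (PE.X PE.+ PE.C (-ᴱ (a , :- b)))
        where
        -ᴱ_ = RawRing.-_ (Exprᶜ 2)

    conjugates : Carrier → Carrier → PC.Poly
    conjugates a b = (PC.X PC.+ PC.C (Cx.- (a , b))) PC.* (PC.X PC.+ PC.C (Cx.- (a , - b)))

    conjugates₀ : ∀ a b → PC.coeff (conjugates a b) 0 Cx.≈ (a * a + b * b , 0#)
    conjugates₀ a b =
      solve 2 (λ a b → proj₁ (PE.coeff (conjugatesᴱ a b) 0) := a :* a :+ b :* b) a b ,
      solve 2 (λ a b → proj₂ (PE.coeff (conjugatesᴱ a b) 0) := con (+ 0)) a b

    conjugates₁ : ∀ a b → PC.coeff (conjugates a b) 1 Cx.≈ (- (num (+ 2) * a) , 0#)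
    conjugates₁ a b =
      solve 2 (λ a b → proj₁ (PE.coeff (conjugatesᴱ a b) 1) := :- (con (+ 2) :* a)) a b ,
      solve 2 (λ a b → proj₂ (PE.coeff (conjugatesᴱ a b) 1) := con (+ 0)) a b

    conjugates₂ : ∀ a b → PC.coeff (conjugates a b) 2 Cx.≈ Cx.1#
    conjugates₂ a b =
      solve 2 (λ a b → proj₁ (PE.coeff (conjugatesᴱ a b) 2) := con (+ 1)) a b ,
      solve 2 (λ a b → proj₂ (PE.coeff (conjugatesᴱ a b) 2) := con (+ 0)) a b

  -- The trace cubic, its bounds and its three real roots.

  module TraceCubic (Q s : Carrier) (0≤s : 0# ≤ s) (ss≈Q : s * s ≈ Q) where

    open import Algebra.Definitions.RawSemiring (RawRing.rawSemiring rawRing) using (_^_)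

    -- The monic cubic f with x³ f(x + Q/x) = x⁶ + α₁x⁵ + α₂x⁴ + α₃x³ + α₂Qx² + α₁Q²x + Q³.
    cubic : Carrier → Carrier → Carrier → Carrier → Carrier
    cubic α₁ α₂ α₃ y = (α₃ - num (+ 2) * Q * α₁) + y * ((α₂ - num (+ 3) * Q) + y * (α₁ + y))

    radicand : Carrier → Carrier → Carrier
    radicand α₁ α₂ = α₁ ^ 2 - num (+ 3) * α₂ + num (+ 9) * Q

    -- 27 f(y) = t³ - 3 radicand t + constant for t = 3y + α₁.
    constant : Carrier → Carrier → Carrier → Carrier
    constant α₁ α₂ α₃ = num (+ 2) * (α₁ * α₁ * α₁) - num (+ 9) * α₁ * α₂ - num (+ 27) * Q * α₁ + num (+ 27) * α₃

    -- f″(2s)/2, f′(2s) and f(2s), simplified by s² = Q.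
    f″[2s] : Carrier → Carrier
    f″[2s] α₁ = num (+ 6) * s + α₁
    f′[2s] : Carrier → Carrier → Carrier
    f′[2s] α₁ α₂ = α₂ + num (+ 9) * Q + num (+ 4) * s * α₁
    f[2s] : Carrier → Carrier → Carrier → Carrier
    f[2s] α₁ α₂ α₃ = α₃ + num (+ 2) * Q * α₁ + num (+ 2) * s * α₂ + num (+ 2) * Q * s

    ss-Q≈0 : s * s - Q ≈ 0#
    ss-Q≈0 = ≈⇒-≈0 ss≈Q

    cubic-odd : ∀ α₁ α₂ α₃ y → cubic (- α₁) α₂ (- α₃) (- y) ≈ - cubic α₁ α₂ α₃ y
    cubic-odd = solve 5 (λ Q α₁ α₂ α₃ y →
      (:- α₃ :- con (+ 2) :* Q :* :- α₁) :+ :- y :* ((α₂ :- con (+ 3) :* Q) :+ :- y :* (:- α₁ :+ :- y))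
      := :- ((α₃ :- con (+ 2) :* Q :* α₁) :+ y :* ((α₂ :- con (+ 3) :* Q) :+ y :* (α₁ :+ y)))) Q

    -- Taylor expansion at `2s` with `u = 2s - y` turns `f(y) = 0` into `u³ - e₁u² + e₂u - e₃ = 0`,
    -- where `e₁`, `e₂`, `e₃` are the values of `f″/2`, `f′`, `f` at `2s`. Such alternating signs
    -- exclude a negative `u`.
    root≤2s : ∀ {α₁ α₂ α₃ y} → cubic α₁ α₂ α₃ y ≈ 0# →
      0# ≤ f″[2s] α₁ → 0# ≤ f′[2s] α₁ α₂ → 0# ≤ f[2s] α₁ α₂ α₃ → 0# ≤ num (+ 2) * s - y
    root≤2s {α₁} {α₂} {α₃} {y} fy≈0 0≤e₁ 0≤e₂ 0≤e₃ =
      nonNegative-root _ _ _ _ 0≤e₁ 0≤e₂ 0≤e₃ (-≈0⇒≈ (trans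
        (modulo _ ss-Q≈0 (solve 6 (λ s Q α₁ α₂ α₃ y →
          let u = con (+ 2) :* s :- y
              e₁ = con (+ 6) :* s :+ α₁
              e₂ = α₂ :+ con (+ 9) :* Q :+ con (+ 4) :* s :* α₁
              e₃ = α₃ :+ con (+ 2) :* Q :* α₁ :+ con (+ 2) :* s :* α₂ :+ con (+ 2) :* Q :* s
          in (u :* u :* u :+ e₂ :* u) :- (e₁ :* (u :* u) :+ e₃) :=
             (:- ((α₃ :- con (+ 2) :* Q :* α₁) :+ y :* ((α₂ :- con (+ 3) :* Q) :+ y :* (α₁ :+ y))))
             :+ (s :* s :- Q) :* (con (+ 12) :* y :+ con (+ 4) :* α₁ :- con (+ 16) :* s)) s Q α₁ α₂ α₃ y))
        (trans (-‿cong fy≈0) -0≈0)))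

    -- In the extreme case `B = -2r³` the cubic is `(t - 2r)(t + r)²`. In general it is this plus
    -- `2r³ + B`; beyond `2r` both parts are non-negative and would have to vanish, which forces
    -- `t ≈ 0`.
    depressed-root≤2r : ∀ {t r B} → 0# ≤ t → 0# ≤ r → 0# ≤ num (+ 2) * (r * r * r) + B →
      t * t * t - num (+ 3) * (r * r) * t + B ≈ 0# → 0# ≤ num (+ 2) * r - t
    depressed-root≤2r {t} {r} {B} 0≤t 0≤r 0≤2rrr+B root = ≤-stable λ 0≰2r-t →
      let w = t - num (+ 2) * r
          0≤w = 0≤-resp (solve 2 (λ r t → :- (con (+ 2) :* r :- t) := t :- con (+ 2) :* r) r t) (0≤-neg (≰⇒≥ 0≰2r-t))
          product≈0 = +≈0⇒≈0 (0≤-* 0≤w (0≤-square (t + r))) 0≤2rrr+B (trans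
            (solve 3 (λ t r B → (t :- con (+ 2) :* r) :* ((t :+ r) :* (t :+ r)) :+ (con (+ 2) :* (r :* r :* r) :+ B)
              := t :* t :* t :- con (+ 3) :* (r :* r) :* t :+ B) t r B) root)
          t≈0 = +≈0⇒≈0 0≤t 0≤r (square≈0⇒≈0 (*≈0⇒≈0 product≈0 λ w≈0 → 0≰2r-t
            (≈⇒≥ (trans (solve 2 (λ r t → con (+ 2) :* r :- t := :- (t :- con (+ 2) :* r)) r t) (trans (-‿cong w≈0) -0≈0)))))
      in 0≰2r-t (0≤-resp (+-congˡ (trans (sym -0≈0) (-‿cong (sym t≈0)))) (0≤-resp (sym (R.+-identityʳ _)) (0≤-* (0≤-num 2) 0≤r)))

    -- Half of the conditions: those that bound the roots from above, and one side of (c). The other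
    -- half is `Admissible (- α₁) α₂ (- α₃)`, which belongs to the reflected cubic `-f(-y)`.
    record Admissible (α₁ α₂ α₃ : Carrier) : Set where
      field
        0≤f″[2s] : 0# ≤ f″[2s] α₁
        0≤f′[2s] : 0# ≤ f′[2s] α₁ α₂
        0≤f[2s] : 0# ≤ f[2s] α₁ α₂ α₃
        0≤radicand : 0# ≤ radicand α₁ α₂
        0≤constant : 0# ≤ num (+ 2) * (√ (radicand α₁ α₂)) ^ 3 + constant α₁ α₂ α₃

    record Vieta (α₁ α₂ α₃ y₁ y₂ y₃ : Carrier) : Set where
      constructor vieta
      field
        α₁≈ : α₁ ≈ - (y₁ + y₂ + y₃)
        α₂≈ : α₂ ≈ y₁ * y₂ + y₂ * y₃ + y₃ * y₁ + num (+ 3) * Q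
        α₃≈ : α₃ ≈ - (y₁ * y₂ * y₃) - num (+ 2) * Q * (y₁ + y₂ + y₃)

    -- The squared form of `∣y∣ ≤ 2s`; it treats `y` and `- y` alike.
    Bounded : Carrier → Set
    Bounded y = y * y ≤ num (+ 4) * Q

    bounded-intro : ∀ {y} → 0# ≤ num (+ 2) * s - y → 0# ≤ num (+ 2) * s + y → Bounded y
    bounded-intro {y} p q = 0≤⇒≤ (0≤-* p q) (modulo _ ss-Q≈0 (solve 3 (λ s Q y →
      (con (+ 2) :* s :- y) :* (con (+ 2) :* s :+ y) := con (+ 4) :* Q :- y :* y :+ (s :* s :- Q) :* con (+ 4)) s Q y))

    bounded⇒≤2s : ∀ {y} → Bounded y → 0# ≤ num (+ 2) * s - y
    bounded⇒≤2s {y} b = ≤⇒0≤- (square-cancel-≤ (0≤-* (0≤-num 2) 0≤s) (≤-trans b (≈⇒≥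
      (modulo _ ss-Q≈0 (solve 2 (λ s Q → (con (+ 2) :* s) :* (con (+ 2) :* s) := con (+ 4) :* Q :+ (s :* s :- Q) :* con (+ 4)) s Q)))))

    bounded-neg : ∀ {y} → Bounded y → Bounded (- y)
    bounded-neg {y} b = ≤-trans (≈⇒≤ (solve 1 (λ y → :- y :* :- y := y :* y) y)) b

    vieta-neg : ∀ {α₁ α₂ α₃ y₁ y₂ y₃} → Vieta α₁ α₂ α₃ y₁ y₂ y₃ → Vieta (- α₁) α₂ (- α₃) (- y₁) (- y₂) (- y₃)
    vieta-neg {y₁ = y₁} {y₂} {y₃} (vieta p₁ p₂ p₃) = vieta
      (trans (-‿cong p₁) (solve 3 (λ y₁ y₂ y₃ → :- (:- (y₁ :+ y₂ :+ y₃)) := :- (:- y₁ :+ :- y₂ :+ :- y₃)) y₁ y₂ y₃))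
      (trans p₂ (solve 4 (λ Q y₁ y₂ y₃ → y₁ :* y₂ :+ y₂ :* y₃ :+ y₃ :* y₁ :+ con (+ 3) :* Q
        := :- y₁ :* :- y₂ :+ :- y₂ :* :- y₃ :+ :- y₃ :* :- y₁ :+ con (+ 3) :* Q) Q y₁ y₂ y₃))
      (trans (-‿cong p₃) (solve 4 (λ Q y₁ y₂ y₃ → :- (:- (y₁ :* y₂ :* y₃) :- con (+ 2) :* Q :* (y₁ :+ y₂ :+ y₃))
        := :- (:- y₁ :* :- y₂ :* :- y₃) :- con (+ 2) :* Q :* (:- y₁ :+ :- y₂ :+ :- y₃)) Q y₁ y₂ y₃))

    module _ {α₁ α₂ α₃ y₁ y₂ y₃} (v : Vieta α₁ α₂ α₃ y₁ y₂ y₃) where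

      open Vieta v

      factor : ∀ y → cubic α₁ α₂ α₃ y ≈ (y - y₁) * (y - y₂) * (y - y₃)
      factor y = trans (+-cong (+-cong α₃≈ (-‿cong (*-congˡ α₁≈))) (*-congˡ (+-cong (+-congʳ α₂≈) (*-congˡ (+-congʳ α₁≈)))))
        (solve 5 (λ Q y₁ y₂ y₃ y →
          ((:- (y₁ :* y₂ :* y₃) :- con (+ 2) :* Q :* (y₁ :+ y₂ :+ y₃)) :- con (+ 2) :* Q :* (:- (y₁ :+ y₂ :+ y₃)))
          :+ y :* ((y₁ :* y₂ :+ y₂ :* y₃ :+ y₃ :* y₁ :+ con (+ 3) :* Q :- con (+ 3) :* Q) :+ y :* (:- (y₁ :+ y₂ :+ y₃) :+ y))
          := (y :- y₁) :* (y :- y₂) :* (y :- y₃)) Q y₁ y₂ y₃ y)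

      private
        u₁ = num (+ 2) * s - y₁
        u₂ = num (+ 2) * s - y₂
        u₃ = num (+ 2) * s - y₃

      f″[2s]≈ : f″[2s] α₁ ≈ u₁ + (u₂ + u₃)
      f″[2s]≈ = trans (+-congˡ α₁≈) (solve 4 (λ s y₁ y₂ y₃ → con (+ 6) :* s :+ :- (y₁ :+ y₂ :+ y₃)
        := (con (+ 2) :* s :- y₁) :+ ((con (+ 2) :* s :- y₂) :+ (con (+ 2) :* s :- y₃))) s y₁ y₂ y₃)

      f′[2s]≈ : f′[2s] α₁ α₂ ≈ u₁ * u₂ + (u₂ * u₃ + u₃ * u₁)
      f′[2s]≈ = trans (+-cong (+-congʳ α₂≈) (*-congˡ α₁≈)) (modulo _ ss-Q≈0 (solve 5 (λ s Q y₁ y₂ y₃ →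
        let u₁ = con (+ 2) :* s :- y₁
            u₂ = con (+ 2) :* s :- y₂
            u₃ = con (+ 2) :* s :- y₃
        in (y₁ :* y₂ :+ y₂ :* y₃ :+ y₃ :* y₁ :+ con (+ 3) :* Q) :+ con (+ 9) :* Q :+ con (+ 4) :* s :* (:- (y₁ :+ y₂ :+ y₃))
        := (u₁ :* u₂ :+ (u₂ :* u₃ :+ u₃ :* u₁)) :+ (s :* s :- Q) :* con -[1+ 11 ]) s Q y₁ y₂ y₃))

      f[2s]≈ : f[2s] α₁ α₂ α₃ ≈ u₁ * u₂ * u₃
      f[2s]≈ = trans (+-congʳ (+-cong (+-cong α₃≈ (*-congˡ α₁≈)) (*-congˡ α₂≈))) (modulo _ ss-Q≈0 (solve 5 (λ s Q y₁ y₂ y₃ →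
        (:- (y₁ :* y₂ :* y₃) :- con (+ 2) :* Q :* (y₁ :+ y₂ :+ y₃)) :+ con (+ 2) :* Q :* (:- (y₁ :+ y₂ :+ y₃))
          :+ con (+ 2) :* s :* (y₁ :* y₂ :+ y₂ :* y₃ :+ y₃ :* y₁ :+ con (+ 3) :* Q) :+ con (+ 2) :* Q :* s
        := (con (+ 2) :* s :- y₁) :* (con (+ 2) :* s :- y₂) :* (con (+ 2) :* s :- y₃)
           :+ (s :* s :- Q) :* (con (+ 4) :* (y₁ :+ y₂ :+ y₃) :- con (+ 8) :* s)) s Q y₁ y₂ y₃))

      2radicand≈ : num (+ 2) * radicand α₁ α₂ ≈ (y₁ - y₂) * (y₁ - y₂) + ((y₂ - y₃) * (y₂ - y₃) + (y₃ - y₁) * (y₃ - y₁))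
      2radicand≈ = trans (*-congˡ (+-congʳ (+-cong (*-cong α₁≈ (*-congʳ α₁≈)) (-‿cong (*-congˡ α₂≈)))))
        (solve 4 (λ Q y₁ y₂ y₃ → let α₁ = :- (y₁ :+ y₂ :+ y₃) in
          con (+ 2) :* (α₁ :* (α₁ :* con (+ 1)) :- con (+ 3) :* (y₁ :* y₂ :+ y₂ :* y₃ :+ y₃ :* y₁ :+ con (+ 3) :* Q) :+ con (+ 9) :* Q)
          := (y₁ :- y₂) :* (y₁ :- y₂) :+ ((y₂ :- y₃) :* (y₂ :- y₃) :+ (y₃ :- y₁) :* (y₃ :- y₁))) Q y₁ y₂ y₃)

      -- `D²` is the discriminant of `f`, so `27 D² ≥ 0` is the squared form of (c) for real roots.
      discriminant : let A = radicand α₁ α₂ ; B = constant α₁ α₂ α₃ ; D = (y₁ - y₂) * (y₂ - y₃) * (y₃ - y₁) in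
        num (+ 4) * (A * A * A) - B * B ≈ num (+ 27) * (D * D)
      discriminant = trans (+-cong (*-congˡ (*-cong (*-cong A≈ A≈) A≈)) (-‿cong (*-cong B≈ B≈)))
        (solve 4 (λ Q y₁ y₂ y₃ →
          let α₁ = :- (y₁ :+ y₂ :+ y₃)
              α₂ = y₁ :* y₂ :+ y₂ :* y₃ :+ y₃ :* y₁ :+ con (+ 3) :* Q
              α₃ = :- (y₁ :* y₂ :* y₃) :- con (+ 2) :* Q :* (y₁ :+ y₂ :+ y₃)
              A = α₁ :* (α₁ :* con (+ 1)) :- con (+ 3) :* α₂ :+ con (+ 9) :* Q
              B = con (+ 2) :* (α₁ :* α₁ :* α₁) :- con (+ 9) :* α₁ :* α₂ :- con (+ 27) :* Q :* α₁ :+ con (+ 27) :* α₃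
              D = (y₁ :- y₂) :* (y₂ :- y₃) :* (y₃ :- y₁)
          in con (+ 4) :* (A :* A :* A) :- B :* B := con (+ 27) :* (D :* D)) Q y₁ y₂ y₃)
        where
        A≈ = +-congʳ (+-cong (*-cong α₁≈ (*-congʳ α₁≈)) (-‿cong (*-congˡ α₂≈)))
        B≈ = +-cong (+-cong (+-cong (*-congˡ (*-cong (*-cong α₁≈ α₁≈) α₁≈)) (-‿cong (*-cong (*-congˡ α₁≈) α₂≈)))
          (-‿cong (*-congˡ α₁≈))) (*-congˡ α₃≈)

    module _ {α₁ α₂ α₃ y₁ y₂ y₃} (v : Vieta α₁ α₂ α₃ y₁ y₂ y₃) (b₁ : Bounded y₁) (b₂ : Bounded y₂) (b₃ : Bounded y₃) where

      private
        0≤u₁ = bounded⇒≤2s b₁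
        0≤u₂ = bounded⇒≤2s b₂
        0≤u₃ = bounded⇒≤2s b₃

      vieta⇒admissible : Admissible α₁ α₂ α₃
      vieta⇒admissible = record
        { 0≤f″[2s] = 0≤-resp (sym (f″[2s]≈ v)) (0≤-+ 0≤u₁ (0≤-+ 0≤u₂ 0≤u₃))
        ; 0≤f′[2s] = 0≤-resp (sym (f′[2s]≈ v)) (0≤-+ (0≤-* 0≤u₁ 0≤u₂) (0≤-+ (0≤-* 0≤u₂ 0≤u₃) (0≤-* 0≤u₃ 0≤u₁)))
        ; 0≤f[2s] = 0≤-resp (sym (f[2s]≈ v)) (0≤-* (0≤-* 0≤u₁ 0≤u₂) 0≤u₃)
        ; 0≤radicand = 0≤A
        -- The inequality is read as `-B ≤ 2r³`, whose squared form is the non-negativity of the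
        -- discriminant.
        ; 0≤constant = 0≤-resp (-‿involutive-+ _ _) (≤⇒0≤- (square-cancel-≤ (0≤-* (0≤-num 2) (0≤-* 0≤r (0≤-* 0≤r (0≤-* 0≤r (0≤-num 1)))))
            (0≤⇒≤ (0≤-* (0≤-num 27) (0≤-square _)) (trans (sym (discriminant v)) square-difference))))
        }
        where
        A = radicand α₁ α₂
        B = constant α₁ α₂ α₃
        r = √ A
        0≤A = 0≤-*⁻ (num-suc≰0 1) (0≤-resp (sym (2radicand≈ v)) (0≤-+ (0≤-square _) (0≤-+ (0≤-square _) (0≤-square _))))
        0≤r = 0≤√ A
        -‿involutive-+ : ∀ x y → x - - y ≈ x + y
        -‿involutive-+ = solve 2 (λ x y → x :- :- y := x :+ y)
        square-difference : num (+ 4) * (A * A * A) - B * B ≈ (num (+ 2) * r ^ 3) * (num (+ 2) * r ^ 3) - - B * - B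
        square-difference = trans (+-congʳ (*-congˡ (*-cong (*-cong A≈rr A≈rr) A≈rr)))
          (solve 2 (λ r B → let 2rrr = con (+ 2) :* (r :* (r :* (r :* con (+ 1)))) in
            con (+ 4) :* ((r :* r) :* (r :* r) :* (r :* r)) :- B :* B := 2rrr :* 2rrr :- :- B :* :- B) r B)
          where
          A≈rr = sym (√*√≈ 0≤A)

    admissible-pair : ∀ {α₁ α₂ α₃ y₁ y₂ y₃} → Vieta α₁ α₂ α₃ y₁ y₂ y₃ → Bounded y₁ → Bounded y₂ → Bounded y₃ →
      Admissible α₁ α₂ α₃ × Admissible (- α₁) α₂ (- α₃)
    admissible-pair v b₁ b₂ b₃ =
      vieta⇒admissible v b₁ b₂ b₃ , vieta⇒admissible (vieta-neg v) (bounded-neg b₁) (bounded-neg b₂) (bounded-neg b₃)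

    -- The last two hypotheses say that `y₂` and `y₃` are the roots of the quadratic cofactor of
    -- `t - y` in `f(t)`.
    quotient⇒vieta : ∀ {α₁ α₂ α₃ y y₂ y₃} → cubic α₁ α₂ α₃ y ≈ 0# → y₂ + y₃ ≈ - (α₁ + y) →
      y₂ * y₃ ≈ (α₂ - num (+ 3) * Q) + y * (α₁ + y) → Vieta α₁ α₂ α₃ y y₂ y₃
    quotient⇒vieta {α₁} {α₂} {α₃} {y} {y₂} {y₃} fy≈0 sum product = vieta
      (trans (solve 2 (λ α₁ y → α₁ := :- (y :+ :- (α₁ :+ y))) α₁ y)
        (trans (-‿cong (+-congˡ (sym sum))) (solve 3 (λ y y₂ y₃ → :- (y :+ (y₂ :+ y₃)) := :- (y :+ y₂ :+ y₃)) y y₂ y₃)))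
      (trans (solve 4 (λ Q α₁ α₂ y → α₂ := (y :* :- (α₁ :+ y) :+ ((α₂ :- con (+ 3) :* Q) :+ y :* (α₁ :+ y))) :+ con (+ 3) :* Q) Q α₁ α₂ y)
        (trans (+-congʳ (+-cong (*-congˡ (sym sum)) (sym product)))
          (solve 4 (λ Q y y₂ y₃ → (y :* (y₂ :+ y₃) :+ y₂ :* y₃) :+ con (+ 3) :* Q := y :* y₂ :+ y₂ :* y₃ :+ y₃ :* y :+ con (+ 3) :* Q) Q y y₂ y₃)))
      (trans (modulo _ fy≈0 (solve 5 (λ Q α₁ α₂ α₃ y →
          let n = (α₂ :- con (+ 3) :* Q) :+ y :* (α₁ :+ y)
          in α₃ := (:- (y :* n) :- con (+ 2) :* Q :* (y :+ :- (α₁ :+ y))) :+ ((α₃ :- con (+ 2) :* Q :* α₁) :+ y :* n) :* con (+ 1)) Q α₁ α₂ α₃ y))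
        (trans (+-cong (-‿cong (*-congˡ (sym product))) (-‿cong (*-congˡ (+-congˡ (sym sum)))))
          (solve 4 (λ Q y y₂ y₃ → :- (y :* (y₂ :* y₃)) :- con (+ 2) :* Q :* (y :+ (y₂ :+ y₃))
            := :- (y :* y₂ :* y₃) :- con (+ 2) :* Q :* (y :+ y₂ :+ y₃)) Q y y₂ y₃)))

    quadratic-roots : ∀ m n → 0# ≤ m * m - num (+ 4) * n → ∃₂ λ x y → x + y ≈ - m × x * y ≈ n
    quadratic-roots m n 0≤D = ½ * (- m + d) , ½ * (- m - d) ,
      modulo _ 2½-1≈0 (solve 3 (λ h m d → h :* (:- m :+ d) :+ h :* (:- m :- d) := :- m :+ (con (+ 2) :* h :- con (+ 1)) :* :- m) ½ m d) ,
      modulo _ 2½-1≈0 (trans (solve 3 (λ h m d → h :* (:- m :+ d) :* (h :* (:- m :- d)) := h :* h :* (m :* m :- d :* d)) ½ m d)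
        (trans (*-congˡ (+-congˡ (-‿cong (√*√≈ 0≤D))))
          (solve 3 (λ h m n → h :* h :* (m :* m :- (m :* m :- con (+ 4) :* n))
            := n :+ (con (+ 2) :* h :- con (+ 1)) :* (n :* (con (+ 2) :* h :+ con (+ 1)))) ½ m n)))
      where
      d = √ (m * m - num (+ 4) * n)
      2½-1≈0 : num (+ 2) * ½ - 1# ≈ 0#
      2½-1≈0 = ≈⇒-≈0 2*½≈1

    cubic-cong : ∀ {α₁ α₂ α₃ β₁ β₂ β₃ y z} → α₁ ≈ β₁ → α₂ ≈ β₂ → α₃ ≈ β₃ → y ≈ z → cubic α₁ α₂ α₃ y ≈ cubic β₁ β₂ β₃ z
    cubic-cong e₁ e₂ e₃ e = +-cong (+-cong e₃ (-‿cong (*-congˡ e₁))) (*-cong e (+-cong (+-congʳ e₂) (*-cong e (+-cong e₁ e))))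

    root-neg : ∀ {α₁ α₂ α₃ y} → cubic α₁ α₂ α₃ y ≈ 0# → cubic (- α₁) α₂ (- α₃) (- y) ≈ 0#
    root-neg {α₁} {α₂} {α₃} {y} fy≈0 = trans (cubic-odd α₁ α₂ α₃ y) (trans (-‿cong fy≈0) -0≈0)

    module _ {α₁ α₂ α₃} (p : Admissible α₁ α₂ α₃ × Admissible (- α₁) α₂ (- α₃)) {y} (fy≈0 : cubic α₁ α₂ α₃ y ≈ 0#) where

      admissible⇒bounded : Bounded y
      admissible⇒bounded = bounded-intro
        (root≤2s fy≈0 (Admissible.0≤f″[2s] (proj₁ p)) (Admissible.0≤f′[2s] (proj₁ p)) (Admissible.0≤f[2s] (proj₁ p)))
        (0≤-resp (solve 2 (λ s y → con (+ 2) :* s :- :- y := con (+ 2) :* s :+ y) s y)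
          (root≤2s (root-neg fy≈0) (Admissible.0≤f″[2s] (proj₂ p)) (Admissible.0≤f′[2s] (proj₂ p)) (Admissible.0≤f[2s] (proj₂ p))))

      private
        Near : Carrier → Carrier → Carrier → Set
        Near α₁ α₂ y = (num (+ 3) * y + α₁) * (num (+ 3) * y + α₁) ≤ num (+ 4) * radicand α₁ α₂

        near : ∀ {α₁ α₂ α₃ y} → Admissible α₁ α₂ α₃ → cubic α₁ α₂ α₃ y ≈ 0# → 0# ≤ num (+ 3) * y + α₁ → Near α₁ α₂ y
        near {α₁} {α₂} {α₃} {y} a fy≈0 0≤t = 0≤⇒≤ (0≤-* 0≤2r-t (0≤-+ (0≤-* (0≤-num 2) 0≤r) 0≤t))
          (modulo _ rr-A≈0 (solve 3 (λ A r t → (con (+ 2) :* r :- t) :* (con (+ 2) :* r :+ t)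
            := con (+ 4) :* A :- t :* t :+ (r :* r :- A) :* con (+ 4)) (radicand α₁ α₂) r t))
          where
          r = √ (radicand α₁ α₂)
          t = num (+ 3) * y + α₁
          0≤r = 0≤√ (radicand α₁ α₂)
          rr-A≈0 = ≈⇒-≈0 (√*√≈ (Admissible.0≤radicand a))
          0≤2r-t : 0# ≤ num (+ 2) * r - t
          0≤2r-t = depressed-root≤2r 0≤t 0≤r
            (0≤-resp (+-congʳ (*-congˡ (solve 1 (λ r → r :* (r :* (r :* con (+ 1))) := r :* r :* r) r))) (Admissible.0≤constant a))
            (modulo _ rr-A≈0 (trans (solve 6 (λ Q α₁ α₂ α₃ y r →
                let A = α₁ :* (α₁ :* con (+ 1)) :- con (+ 3) :* α₂ :+ con (+ 9) :* Q
                    B = con (+ 2) :* (α₁ :* α₁ :* α₁) :- con (+ 9) :* α₁ :* α₂ :- con (+ 27) :* Q :* α₁ :+ con (+ 27) :* α₃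
                    t = con (+ 3) :* y :+ α₁
                in t :* t :* t :- con (+ 3) :* (r :* r) :* t :+ B
                   := con (+ 27) :* ((α₃ :- con (+ 2) :* Q :* α₁) :+ y :* ((α₂ :- con (+ 3) :* Q) :+ y :* (α₁ :+ y)))
                      :+ (r :* r :- A) :* (con (+ 0) :- con (+ 3) :* t)) Q α₁ α₂ α₃ y r)
              (+-congʳ (trans (*-congˡ fy≈0) (R.zeroʳ _)))))

        -- `Near` is invariant under reflection, so for `3y + α₁ ≤ 0` the argument is applied to the
        -- reflected cubic and the root `- y`.
        near-root : Near α₁ α₂ y
        near-root = by-cases (near (proj₁ p) fy≈0) λ t≤0 →
          ≤-trans (≈⇒≤ (solve 2 (λ α₁ y → (con (+ 3) :* y :+ α₁) :* (con (+ 3) :* y :+ α₁)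
              := (con (+ 3) :* :- y :+ :- α₁) :* (con (+ 3) :* :- y :+ :- α₁)) α₁ y))
            (≤-trans (near (proj₂ p) (root-neg fy≈0) (0≤-resp (solve 2 (λ α₁ y → :- (con (+ 3) :* y :+ α₁) := con (+ 3) :* :- y :+ :- α₁) α₁ y) (0≤-neg t≤0)))
              (≈⇒≤ (solve 3 (λ Q α₁ α₂ → con (+ 4) :* (:- α₁ :* (:- α₁ :* con (+ 1)) :- con (+ 3) :* α₂ :+ con (+ 9) :* Q)
                := con (+ 4) :* (α₁ :* (α₁ :* con (+ 1)) :- con (+ 3) :* α₂ :+ con (+ 9) :* Q)) Q α₁ α₂)))

      remaining-roots : ∃₂ λ y₂ y₃ → Vieta α₁ α₂ α₃ y y₂ y₃
      remaining-roots =
        -- For `t = 3y + α₁`, the number `4A - t²` is three times the discriminant of the quadratic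
        -- cofactor.
        let y₂ , y₃ , sum , product = quadratic-roots (α₁ + y) ((α₂ - num (+ 3) * Q) + y * (α₁ + y)) (0≤-*⁻ (num-suc≰0 2)
              (0≤-resp (solve 4 (λ Q α₁ α₂ y →
                  con (+ 4) :* (α₁ :* (α₁ :* con (+ 1)) :- con (+ 3) :* α₂ :+ con (+ 9) :* Q) :- (con (+ 3) :* y :+ α₁) :* (con (+ 3) :* y :+ α₁)
                  := con (+ 3) :* ((α₁ :+ y) :* (α₁ :+ y) :- con (+ 4) :* ((α₂ :- con (+ 3) :* Q) :+ y :* (α₁ :+ y)))) Q α₁ α₂ y)
                (≤⇒0≤- near-root)))
        in y₂ , y₃ , quotient⇒vieta fy≈0 sum product

    vieta-root : ∀ {α₁ α₂ α₃ y₁ y₂ y₃} → Vieta α₁ α₂ α₃ y₁ y₂ y₃ →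
      cubic α₁ α₂ α₃ y₁ ≈ 0# × cubic α₁ α₂ α₃ y₂ ≈ 0# × cubic α₁ α₂ α₃ y₃ ≈ 0#
    vieta-root {y₁ = y₁} {y₂} {y₃} v =
      trans (factor v y₁) (solve 3 (λ y₁ y₂ y₃ → (y₁ :- y₁) :* (y₁ :- y₂) :* (y₁ :- y₃) := con (+ 0)) y₁ y₂ y₃) ,
      trans (factor v y₂) (solve 3 (λ y₁ y₂ y₃ → (y₂ :- y₁) :* (y₂ :- y₂) :* (y₂ :- y₃) := con (+ 0)) y₁ y₂ y₃) ,
      trans (factor v y₃) (solve 3 (λ y₁ y₂ y₃ → (y₃ :- y₁) :* (y₃ :- y₂) :* (y₃ :- y₃) := con (+ 0)) y₁ y₂ y₃)

    -- If the sum of the non-negative `uᵢ = 2s - yᵢ` vanishes, so does `u₁`, and with it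
    -- `f(2s) = u₁u₂u₃`. With pairwise products in place of the `uᵢ` the same works for `f′`. So
    -- equality in (a) or (b*) forces equality in (d).
    f″[2s]≈0⇒f[2s]≈0 : ∀ {α₁ α₂ α₃ y₁ y₂ y₃} → Vieta α₁ α₂ α₃ y₁ y₂ y₃ → Bounded y₁ → Bounded y₂ → Bounded y₃ →
      f″[2s] α₁ ≈ 0# → f[2s] α₁ α₂ α₃ ≈ 0#
    f″[2s]≈0⇒f[2s]≈0 v b₁ b₂ b₃ e = trans (f[2s]≈ v) (trans (*-congʳ (trans (*-congʳ u₁≈0) (R.zeroˡ _))) (R.zeroˡ _))
      where
      u₁≈0 = +≈0⇒≈0 (bounded⇒≤2s b₁) (0≤-+ (bounded⇒≤2s b₂) (bounded⇒≤2s b₃)) (trans (sym (f″[2s]≈ v)) e)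

    f′[2s]≈0⇒f[2s]≈0 : ∀ {α₁ α₂ α₃ y₁ y₂ y₃} → Vieta α₁ α₂ α₃ y₁ y₂ y₃ → Bounded y₁ → Bounded y₂ → Bounded y₃ →
      f′[2s] α₁ α₂ ≈ 0# → f[2s] α₁ α₂ α₃ ≈ 0#
    f′[2s]≈0⇒f[2s]≈0 v b₁ b₂ b₃ e = trans (f[2s]≈ v) (trans (*-congʳ u₁u₂≈0) (R.zeroˡ _))
      where
      0≤u₁ = bounded⇒≤2s b₁
      0≤u₂ = bounded⇒≤2s b₂
      0≤u₃ = bounded⇒≤2s b₃
      u₁u₂≈0 = +≈0⇒≈0 (0≤-* 0≤u₁ 0≤u₂) (0≤-+ (0≤-* 0≤u₂ 0≤u₃) (0≤-* 0≤u₃ 0≤u₁)) (trans (sym (f′[2s]≈ v)) e)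

    -- Minus the discriminant of x² - yx + Q; for bounded y it vanishes iff that factor has a real root.
    gap : Carrier → Carrier
    gap y = num (+ 4) * Q - y * y

    gap-sum gap-sum₂ : Carrier → Carrier → Carrier → Carrier
    gap-sum y₁ y₂ y₃ = gap y₁ + (gap y₂ + gap y₃)
    gap-sum₂ y₁ y₂ y₃ = gap y₁ * gap y₂ + (gap y₂ * gap y₃ + gap y₃ * gap y₁)

    -- Both sums are symmetric in the `yᵢ²`, hence polynomials in the coefficients: `Σ yᵢ²` and
    -- `Σ yᵢ²yⱼ²` are `e₁² - 2e₂` and `e₂² - 2e₁e₃` in the elementary symmetric functions of the
    -- roots.
    gap-sums-unique : ∀ {α₁ α₂ α₃ y₁ y₂ y₃ z₁ z₂ z₃} → Vieta α₁ α₂ α₃ y₁ y₂ y₃ → Vieta α₁ α₂ α₃ z₁ z₂ z₃ →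
      gap-sum y₁ y₂ y₃ ≈ gap-sum z₁ z₂ z₃ × gap-sum₂ y₁ y₂ y₃ ≈ gap-sum₂ z₁ z₂ z₃
    gap-sums-unique {α₁} {α₂} {α₃} v w = trans (gap-sum≈ v) (sym (gap-sum≈ w)) , trans (gap-sum₂≈ v) (sym (gap-sum₂≈ w))
      where
      gap-sum≈ : ∀ {y₁ y₂ y₃} → Vieta α₁ α₂ α₃ y₁ y₂ y₃ →
        gap-sum y₁ y₂ y₃ ≈ num (+ 6) * Q - α₁ * α₁ + num (+ 2) * α₂
      gap-sum≈ {y₁} {y₂} {y₃} (vieta e₁ e₂ e₃) = sym (trans (+-cong (+-congˡ (-‿cong (*-cong e₁ e₁))) (*-congˡ e₂))
        (solve 4 (λ Q y₁ y₂ y₃ →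
          let α₁ = :- (y₁ :+ y₂ :+ y₃)
              α₂ = y₁ :* y₂ :+ y₂ :* y₃ :+ y₃ :* y₁ :+ con (+ 3) :* Q
              d = λ y → con (+ 4) :* Q :- y :* y
          in con (+ 6) :* Q :- α₁ :* α₁ :+ con (+ 2) :* α₂ := d y₁ :+ (d y₂ :+ d y₃)) Q y₁ y₂ y₃))
      gap-sum₂≈ : ∀ {y₁ y₂ y₃} → Vieta α₁ α₂ α₃ y₁ y₂ y₃ →
        gap-sum₂ y₁ y₂ y₃ ≈ num (+ 48) * Q * Q - num (+ 8) * Q * (α₁ * α₁ - num (+ 2) * (α₂ - num (+ 3) * Q))
          + ((α₂ - num (+ 3) * Q) * (α₂ - num (+ 3) * Q) + num (+ 2) * α₁ * (num (+ 2) * Q * α₁ - α₃))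
      gap-sum₂≈ {y₁} {y₂} {y₃} (vieta e₁ e₂ e₃) = sym (trans
        (+-cong (+-congˡ (-‿cong (*-congˡ (+-cong (*-cong e₁ e₁) (-‿cong (*-congˡ (+-congʳ e₂)))))))
          (+-cong (*-cong (+-congʳ e₂) (+-congʳ e₂)) (*-cong (*-congˡ e₁) (+-cong (*-congˡ e₁) (-‿cong e₃)))))
        (solve 4 (λ Q y₁ y₂ y₃ →
          let α₁ = :- (y₁ :+ y₂ :+ y₃)
              α₂ = y₁ :* y₂ :+ y₂ :* y₃ :+ y₃ :* y₁ :+ con (+ 3) :* Q
              α₃ = :- (y₁ :* y₂ :* y₃) :- con (+ 2) :* Q :* (y₁ :+ y₂ :+ y₃)
              d = λ y → con (+ 4) :* Q :- y :* y
          in con (+ 48) :* Q :* Q :- con (+ 8) :* Q :* (α₁ :* α₁ :- con (+ 2) :* (α₂ :- con (+ 3) :* Q))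
             :+ ((α₂ :- con (+ 3) :* Q) :* (α₂ :- con (+ 3) :* Q) :+ con (+ 2) :* α₁ :* (con (+ 2) :* Q :* α₁ :- α₃))
             := d y₁ :* d y₂ :+ (d y₂ :* d y₃ :+ d y₃ :* d y₁)) Q y₁ y₂ y₃))

    module _ {y₁ y₂ y₃ : Carrier} where

      gap-sum≈0 : gap y₁ ≈ 0# → gap y₂ ≈ 0# → gap y₃ ≈ 0# → gap-sum y₁ y₂ y₃ ≈ 0#
      gap-sum≈0 e₁ e₂ e₃ = trans (+-cong e₁ (trans (+-cong e₂ e₃) (R.+-identityˡ 0#))) (R.+-identityˡ 0#)

      gap-sum≈gap : gap y₁ ≈ 0# → gap y₂ ≈ 0# → gap-sum y₁ y₂ y₃ ≈ gap y₃
      gap-sum≈gap e₁ e₂ = trans (+-cong e₁ (trans (+-congʳ e₂) (R.+-identityˡ _))) (R.+-identityˡ _)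

      gap-sum₂≈gap*gap : gap y₁ ≈ 0# → gap-sum₂ y₁ y₂ y₃ ≈ gap y₂ * gap y₃
      gap-sum₂≈gap*gap e₁ = trans (+-cong (trans (*-congʳ e₁) (R.zeroˡ _)) (+-congˡ (trans (*-congˡ e₁) (R.zeroʳ _))))
        (trans (R.+-identityˡ _) (R.+-identityʳ _))


    -- Lists of expressions are multiplied by the same function as lists of numbers, so
    -- the solver can be given a coefficient of a product without writing it out.
    expr : ∀ n → RawRing 0ℓ 0ℓ
    expr n = record { Carrier = Expr n ; _≈_ = _≡_ ; _+_ = _:+_ ; _*_ = _:*_ ; -_ = :-_ ; 0# = con (+ 0) ; 1# = con (+ 1) }


    -- Products of the quadratic factors `x² - yx + Q`.

    private
      2½-1≈0 : num (+ 2) * ½ - 1# ≈ 0#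
      2½-1≈0 = ≈⇒-≈0 2*½≈1

    quad : Carrier → Poly
    quad y = Q ∷ - y ∷ 1# ∷ []

    quads : List Carrier → Poly
    quads [] = 1# ∷ []
    quads (y ∷ ys) = quad y ⊠ quads ys

    sexticᴿ : Carrier → Carrier → Carrier → Poly
    sexticᴿ α₁ α₂ α₃ = Q ^ 3 ∷ α₁ * Q ^ 2 ∷ α₂ * Q ∷ α₃ ∷ α₂ ∷ α₁ ∷ 1# ∷ []

    quad-cong : ∀ {x y} → x ≈ y → quad x ≋ quad y
    quad-cong x≈y = P.∷-cong refl (P.∷-cong (-‿cong x≈y) P.≈-refl)

    quads₁ : ∀ y → quads (y ∷ []) ≋ quad y
    quads₁ y = P.≈-trans (P.*-comm (quad y) (1# ∷ [])) (P.*-identityˡ (quad y))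

    private
      module E n = Polynomial (expr n)
      quadᴱ : ∀ {n} → Expr n → Expr n → List (Expr n)
      quadᴱ Q y = Q ∷ :- y ∷ con (+ 1) ∷ []
      1ᴱ : ∀ {n} → List (Expr n)
      1ᴱ = con (+ 1) ∷ []

    quads₂ : ∀ y z → quads (y ∷ z ∷ []) ≋
      Q * Q ∷ - (y + z) * Q ∷ y * z + num (+ 2) * Q ∷ - (y + z) ∷ 1# ∷ []
    quads₂ y z =
      P.∷-cong (solve 3 (λ Q y z → E.coeff 3 (p Q y z) 0 := Q :* Q) Q y z)
      (P.∷-cong (solve 3 (λ Q y z → E.coeff 3 (p Q y z) 1 := :- (y :+ z) :* Q) Q y z)
      (P.∷-cong (solve 3 (λ Q y z → E.coeff 3 (p Q y z) 2 := y :* z :+ con (+ 2) :* Q) Q y z)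
      (P.∷-cong (solve 3 (λ Q y z → E.coeff 3 (p Q y z) 3 := :- (y :+ z)) Q y z)
      (P.∷-cong (solve 3 (λ Q y z → E.coeff 3 (p Q y z) 4 := con (+ 1)) Q y z) P.≈-refl))))
      where
      p : ∀ {n} → Expr n → Expr n → Expr n → List (Expr n)
      p {n} Q y z = quadᴱ Q y E* (quadᴱ Q z E* 1ᴱ)
        where
        _E*_ = E._*_ n

    quads₃ : ∀ y₁ y₂ y₃ → quads (y₁ ∷ y₂ ∷ y₃ ∷ []) ≋ sexticᴿ (- (y₁ + y₂ + y₃))
      (y₁ * y₂ + y₂ * y₃ + y₃ * y₁ + num (+ 3) * Q) (- (y₁ * y₂ * y₃) - num (+ 2) * Q * (y₁ + y₂ + y₃))
    quads₃ y₁ y₂ y₃ =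
      P.∷-cong (solve 4 (λ Q y₁ y₂ y₃ → E.coeff 4 (p Q y₁ y₂ y₃) 0 := Q :* (Q :* (Q :* con (+ 1)))) Q y₁ y₂ y₃)
      (P.∷-cong (solve 4 (λ Q y₁ y₂ y₃ → E.coeff 4 (p Q y₁ y₂ y₃) 1 := :- (y₁ :+ y₂ :+ y₃) :* (Q :* (Q :* con (+ 1)))) Q y₁ y₂ y₃)
      (P.∷-cong (solve 4 (λ Q y₁ y₂ y₃ → E.coeff 4 (p Q y₁ y₂ y₃) 2 := (y₁ :* y₂ :+ y₂ :* y₃ :+ y₃ :* y₁ :+ con (+ 3) :* Q) :* Q) Q y₁ y₂ y₃)
      (P.∷-cong (solve 4 (λ Q y₁ y₂ y₃ → E.coeff 4 (p Q y₁ y₂ y₃) 3 := :- (y₁ :* y₂ :* y₃) :- con (+ 2) :* Q :* (y₁ :+ y₂ :+ y₃)) Q y₁ y₂ y₃)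
      (P.∷-cong (solve 4 (λ Q y₁ y₂ y₃ → E.coeff 4 (p Q y₁ y₂ y₃) 4 := y₁ :* y₂ :+ y₂ :* y₃ :+ y₃ :* y₁ :+ con (+ 3) :* Q) Q y₁ y₂ y₃)
      (P.∷-cong (solve 4 (λ Q y₁ y₂ y₃ → E.coeff 4 (p Q y₁ y₂ y₃) 5 := :- (y₁ :+ y₂ :+ y₃)) Q y₁ y₂ y₃)
      (P.∷-cong (solve 4 (λ Q y₁ y₂ y₃ → E.coeff 4 (p Q y₁ y₂ y₃) 6 := con (+ 1)) Q y₁ y₂ y₃) P.≈-refl))))))
      where
      p : ∀ {n} → Expr n → Expr n → Expr n → Expr n → List (Expr n)
      p {n} Q y₁ y₂ y₃ = quadᴱ Q y₁ E* (quadᴱ Q y₂ E* (quadᴱ Q y₃ E* 1ᴱ))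
        where
        _E*_ = E._*_ n

    sexticᴿ-cong : ∀ {α₁ α₂ α₃ β₁ β₂ β₃} → α₁ ≈ β₁ → α₂ ≈ β₂ → α₃ ≈ β₃ → sexticᴿ α₁ α₂ α₃ ≋ sexticᴿ β₁ β₂ β₃
    sexticᴿ-cong e₁ e₂ e₃ =
      P.∷-cong refl (P.∷-cong (*-congʳ e₁) (P.∷-cong (*-congʳ e₂) (P.∷-cong e₃ (P.∷-cong e₂ (P.∷-cong e₁ P.≈-refl)))))

    vieta⇒sextic≋quads : ∀ {α₁ α₂ α₃ y₁ y₂ y₃} → Vieta α₁ α₂ α₃ y₁ y₂ y₃ → sexticᴿ α₁ α₂ α₃ ≋ quads (y₁ ∷ y₂ ∷ y₃ ∷ [])
    vieta⇒sextic≋quads (vieta e₁ e₂ e₃) = P.≈-trans (sexticᴿ-cong e₁ e₂ e₃) (P.≈-sym (quads₃ _ _ _))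

    sextic≋quads⇒vieta : ∀ {α₁ α₂ α₃ y₁ y₂ y₃} → sexticᴿ α₁ α₂ α₃ ≋ quads (y₁ ∷ y₂ ∷ y₃ ∷ []) → Vieta α₁ α₂ α₃ y₁ y₂ y₃
    sextic≋quads⇒vieta {y₁ = y₁} {y₂} {y₃} e = vieta (c 5) (c 4) (c 3)
      where
      c = Polynomial._≈_.coeff-≈ (P.≈-trans e (quads₃ y₁ y₂ y₃))

    eval-quad : ∀ y r → eval (quad y) r ≈ Q - y * r + r * r
    eval-quad y r = solve 3 (λ Q y r → Q :+ r :* (:- y :+ r :* (con (+ 1) :+ r :* con (+ 0))) := Q :- y :* r :+ r :* r) Q y r

    -- For a root `r` of one factor, `4(r² - yr + Q) = gap y + (2r - y)²` is a vanishing sum of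
    -- non-negative terms. The double negation remains because a vanishing product does not reveal
    -- which factor vanishes.
    real-root⇒gap≈0 : ∀ {ys} r → All Bounded ys → eval (quads ys) r ≈ 0# → ¬ ¬ Any (λ y → gap y ≈ 0#) ys
    real-root⇒gap≈0 {[]} r [] e = contradiction (≈⇒≤ (trans (solve 1 (λ r → con (+ 1) := con (+ 1) :+ r :* con (+ 0)) r) e)) ¬1≤0
    real-root⇒gap≈0 {y ∷ ys} r (b ∷ bs) e ¬any = *≈0 (trans (sym (P.eval-* (quad y) (quads ys) r)) e) λ
      { (inj₁ quad≈0) → ¬any (here (gap≈0 quad≈0))
      ; (inj₂ quads≈0) → real-root⇒gap≈0 r bs quads≈0 λ any → ¬any (there any) }
      where
      gap≈0 : eval (quad y) r ≈ 0# → gap y ≈ 0#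
      gap≈0 quad≈0 = +≈0⇒≈0 (≤⇒0≤- b) (0≤-square (num (+ 2) * r - y)) (trans
        (solve 3 (λ Q y r → (con (+ 4) :* Q :- y :* y) :+ (con (+ 2) :* r :- y) :* (con (+ 2) :* r :- y)
          := con (+ 4) :* (Q :- y :* r :+ r :* r)) Q y r)
        (trans (*-congˡ (trans (sym (eval-quad y r)) quad≈0)) (R.zeroʳ _)))

    -- The double root of the indicated factor is `y/2`.
    gap≈0⇒real-root : ∀ {ys} → Any (λ y → gap y ≈ 0#) ys → ∃ λ r → eval (quads ys) r ≈ 0#
    gap≈0⇒real-root {y ∷ ys} (here gap≈0) = ½ * y , trans (P.eval-* (quad y) (quads ys) (½ * y)) (trans (*-congʳ (trans (eval-quad y (½ * y))
        (modulo _ 2½-1≈0 (trans (solve 3 (λ Q h y → Q :- y :* (h :* y) :+ (h :* y) :* (h :* y)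
          := h :* h :* (con (+ 4) :* Q :- y :* y) :+ (con (+ 2) :* h :- con (+ 1)) :* (h :* (y :* y) :- Q :* (con (+ 2) :* h :+ con (+ 1)))) Q ½ y)
          (+-congʳ (trans (*-congˡ gap≈0) (R.zeroʳ _))))))) (R.zeroˡ _))
    gap≈0⇒real-root {y ∷ ys} (there any) =
      let r , e = gap≈0⇒real-root any
      in r , trans (P.eval-* (quad y) (quads ys) r) (trans (*-congˡ e) (R.zeroʳ _))

    2s -2s : Carrier
    2s = num (+ 2) * s
    -2s = - 2s

    quad-2s : quad -2s ≋ (X ⊞ C s) ⊠^ 2
    quad-2s =
      P.∷-cong (sym (modulo _ ss-Q≈0 (solve 2 (λ s Q → E.coeff 2 (p s) 0 := Q :+ (s :* s :- Q) :* con (+ 1)) s Q)))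
      (P.∷-cong (solve 1 (λ s → :- (:- (con (+ 2) :* s)) := E.coeff 1 (p s) 1) s)
      (P.∷-cong (solve 1 (λ s → con (+ 1) := E.coeff 1 (p s) 2) s) P.≈-refl))
      where
      p : ∀ {n} → Expr n → List (Expr n)
      p {n} s = (E._+_ n (E.X n) (E.C n s)) E^2
        where
        _E^2 = λ q → E._^_ n q 2

    quad2s : quad 2s ≋ (X ⊞ C (- s)) ⊠^ 2
    quad2s =
      P.∷-cong (sym (modulo _ ss-Q≈0 (solve 2 (λ s Q → E.coeff 2 (p s) 0 := Q :+ (s :* s :- Q) :* con (+ 1)) s Q)))
      (P.∷-cong (solve 1 (λ s → :- (con (+ 2) :* s) := E.coeff 1 (p s) 1) s)
      (P.∷-cong (solve 1 (λ s → con (+ 1) := E.coeff 1 (p s) 2) s) P.≈-refl))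
      where
      p : ∀ {n} → Expr n → List (Expr n)
      p {n} s = (E._+_ n (E.X n) (E.C n (:- s))) E^2
        where
        _E^2 = λ q → E._^_ n q 2

    private
      module PExp = Algebra.Properties.Semiring.Exp (CommutativeRing.semiring P.polynomialRing)

    quads-replicate : ∀ k y ys → quads (replicate k y ++ ys) ≋ quad y ⊠^ k ⊠ quads ys
    quads-replicate zero y ys = P.≈-sym (P.*-identityˡ (quads ys))
    quads-replicate (suc k) y ys = P.≈-trans (P.*-congˡ (quad y) (quads-replicate k y ys))
      (P.≈-sym (P.*-assoc (quad y) (quad y ⊠^ k) (quads ys)))

    quad-power : ∀ {p} y k → quad y ≋ p ⊠^ 2 → quad y ⊠^ k ≋ p ⊠^ (2 ℕ.* k)
    quad-power {p} y k e = P.≈-trans (P.^-cong k e) (PExp.^-assocʳ p 2 k)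

    quads-real : ∀ k ℓ ys → quads (replicate k -2s ++ replicate ℓ 2s ++ ys) ≋
      (X ⊞ C s) ⊠^ (2 ℕ.* k) ⊠ (X ⊞ C (- s)) ⊠^ (2 ℕ.* ℓ) ⊠ quads ys
    quads-real k ℓ ys = P.≈-trans (quads-replicate k -2s _) (P.≈-trans
      (P.*-cong (quad-power {X ⊞ C s} -2s k quad-2s) (P.≈-trans (quads-replicate ℓ 2s ys) (P.*-congʳ (quads ys) (quad-power {X ⊞ C (- s)} 2s ℓ quad2s))))
      (P.≈-sym (P.*-assoc ((X ⊞ C s) ⊠^ (2 ℕ.* k)) ((X ⊞ C (- s)) ⊠^ (2 ℕ.* ℓ)) (quads ys))))

    quads-2s-2s : ∀ ys → quads (2s ∷ -2s ∷ ys) ≋ ((- Q) ∷ 0# ∷ 1# ∷ []) ⊠^ 2 ⊠ quads ys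
    quads-2s-2s ys = P.≈-trans (P.≈-sym (P.*-assoc (quad 2s) (quad -2s) (quads ys))) (P.*-congʳ {quad 2s ⊠ quad -2s} (quads ys)
      (P.∷-cong (solve 2 (λ Q s → E.coeff 2 (p Q s) 0 := E.coeff 2 (r Q) 0) Q s)
      (P.∷-cong (solve 2 (λ Q s → E.coeff 2 (p Q s) 1 := E.coeff 2 (r Q) 1) Q s)
      (P.∷-cong (sym (modulo _ ss-Q≈0 (solve 2 (λ Q s → E.coeff 2 (r Q) 2 := E.coeff 2 (p Q s) 2 :+ (s :* s :- Q) :* con (+ 4)) Q s)))
      (P.∷-cong (solve 2 (λ Q s → E.coeff 2 (p Q s) 3 := E.coeff 2 (r Q) 3) Q s)
      (P.∷-cong (solve 2 (λ Q s → E.coeff 2 (p Q s) 4 := E.coeff 2 (r Q) 4) Q s) P.≈-refl))))))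
      where
      p : ∀ {n} → Expr n → Expr n → List (Expr n)
      p {n} Q s = quadᴱ Q (con (+ 2) :* s) E* quadᴱ Q (:- (con (+ 2) :* s))
        where
        _E*_ = E._*_ n
      r : ∀ {n} → Expr n → List (Expr n)
      r {n} Q = (:- Q ∷ con (+ 0) ∷ con (+ 1) ∷ []) E^2
        where
        _E^2 = λ q → E._^_ n q 2

    gap-2s≈0 : gap -2s ≈ 0#
    gap-2s≈0 = modulo _ ss-Q≈0 (solve 2 (λ Q s → con (+ 4) :* Q :- :- (con (+ 2) :* s) :* :- (con (+ 2) :* s)
      := con (+ 0) :+ (s :* s :- Q) :* con -[1+ 3 ]) Q s)

    gap2s≈0 : gap 2s ≈ 0#
    gap2s≈0 = modulo _ ss-Q≈0 (solve 2 (λ Q s → con (+ 4) :* Q :- (con (+ 2) :* s) :* (con (+ 2) :* s)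
      := con (+ 0) :+ (s :* s :- Q) :* con -[1+ 3 ]) Q s)

    gap≈0⇒≈±2s : ∀ {y} → gap y ≈ 0# → ¬ ¬ (y ≈ 2s ⊎ y ≈ -2s)
    gap≈0⇒≈±2s {y} e ¬y = *≈0 (trans (modulo _ ss-Q≈0 (solve 3 (λ Q s y →
        (y :- con (+ 2) :* s) :* (y :- :- (con (+ 2) :* s)) := (con (+ 0) :- (con (+ 4) :* Q :- y :* y)) :+ (s :* s :- Q) :* con -[1+ 3 ]) Q s y))
      (trans (+-congˡ (-‿cong e)) (R.-‿inverseʳ _))) λ
      { (inj₁ p) → ¬y (inj₁ (-≈0⇒≈ p)) ; (inj₂ p) → ¬y (inj₂ (-≈0⇒≈ p)) }


    -- Conditions (a) to (d) translated into admissibility.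

    module Inequalities (⅓ 2/27 : Carrier) (3*⅓≈1 : num (+ 3) * ⅓ ≈ 1#) (27*2/27≈2 : num (+ 27) * 2/27 ≈ num (+ 2))
      (α₁ α₂ α₃ ∣α₁∣ : Carrier) (∣α₁∣≈ : ∣α₁∣ ≈ α₁ ⊎ ∣α₁∣ ≈ - α₁) (0≤∣α₁∣ : 0# ≤ ∣α₁∣) where

      c-centre d-lower d-upper b*-lower c-radius : Carrier
      c-centre = - 2/27 * α₁ ^ 3 + ⅓ * α₁ * α₂ + Q * α₁
      c-radius = 2/27 * (√ (radicand α₁ α₂)) ^ 3
      d-lower = - num (+ 2) * Q * α₁ - num (+ 2) * s * α₂ - num (+ 2) * Q * s
      d-upper = - num (+ 2) * Q * α₁ + num (+ 2) * s * α₂ + num (+ 2) * Q * s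
      b*-lower = num (+ 4) * s * ∣α₁∣ - num (+ 9) * Q

      a b* b c d : Set
      a = ∣α₁∣ ≤ num (+ 6) * s
      b* = b*-lower ≤ α₂
      b = α₂ ≤ ⅓ * α₁ ^ 2 + num (+ 3) * Q
      c = c-centre - c-radius ≤ α₃ × α₃ ≤ c-centre + c-radius
      d = d-lower ≤ α₃ × α₃ ≤ d-upper

      private
        3⅓-1≈0 : num (+ 3) * ⅓ - 1# ≈ 0#
        3⅓-1≈0 = ≈⇒-≈0 3*⅓≈1
        27w-2≈0 : num (+ 27) * 2/27 - num (+ 2) ≈ 0#
        27w-2≈0 = ≈⇒-≈0 27*2/27≈2

        0≤∣α₁∣-α₁ : 0# ≤ ∣α₁∣ - α₁
        0≤∣α₁∣-α₁ = Sum.[ (λ e → ≈⇒≥ (≈⇒-≈0 e)) , (λ e → 0≤-resp (+-congˡ e) (0≤-+ 0≤∣α₁∣ 0≤∣α₁∣)) ]′ ∣α₁∣≈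

        0≤∣α₁∣+α₁ : 0# ≤ ∣α₁∣ + α₁
        0≤∣α₁∣+α₁ = Sum.[ (λ e → 0≤-resp (+-congˡ e) (0≤-+ 0≤∣α₁∣ 0≤∣α₁∣)) ,
          (λ e → ≈⇒≥ (trans (+-congʳ e) (R.-‿inverseˡ α₁))) ]′ ∣α₁∣≈

        radicand-neg : radicand (- α₁) α₂ ≈ radicand α₁ α₂
        radicand-neg = +-congʳ (+-congʳ (solve 1 (λ x → :- x :* (:- x :* con (+ 1)) := x :* (x :* con (+ 1))) α₁))

        r r′ : Carrier
        r = √ (radicand α₁ α₂)
        r′ = √ (radicand (- α₁) α₂)

        -- `RealStructure` does not state that `√` respects `_≈_`; the two non-negative roots agree
        -- because their squares do.
        r′≈r : 0# ≤ radicand α₁ α₂ → r′ ≈ r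
        r′≈r 0≤A = square-injective (0≤√ _) (0≤√ _)
          (trans (√*√≈ (0≤-resp (sym radicand-neg) 0≤A)) (trans radicand-neg (sym (√*√≈ 0≤A))))

        cube-cong : ∀ {x y} → x ≈ y → x ^ 3 ≈ y ^ 3
        cube-cong e = *-cong e (*-cong e (*-cong e refl))

        3b≈ : num (+ 3) * (⅓ * α₁ ^ 2 + num (+ 3) * Q - α₂) ≈ radicand α₁ α₂
        3b≈ = modulo _ 3⅓-1≈0 (solve 4 (λ Q t α₁ α₂ →
          con (+ 3) :* (t :* (α₁ :* (α₁ :* con (+ 1))) :+ con (+ 3) :* Q :- α₂)
          := (α₁ :* (α₁ :* con (+ 1)) :- con (+ 3) :* α₂ :+ con (+ 9) :* Q) :+ (con (+ 3) :* t :- con (+ 1)) :* (α₁ :* (α₁ :* con (+ 1)))) Q ⅓ α₁ α₂)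

        27c-lower≈ : num (+ 27) * (α₃ - (c-centre - c-radius)) ≈ num (+ 2) * r ^ 3 + constant α₁ α₂ α₃
        27c-lower≈ = modulo _ 27w-2≈0 (modulo _ 3⅓-1≈0 (solve 7 (λ Q t w α₁ α₂ α₃ r³ →
          con (+ 27) :* (α₃ :- (:- w :* (α₁ :* (α₁ :* (α₁ :* con (+ 1)))) :+ t :* α₁ :* α₂ :+ Q :* α₁ :- w :* r³))
          := ((con (+ 2) :* r³ :+ (con (+ 2) :* (α₁ :* α₁ :* α₁) :- con (+ 9) :* α₁ :* α₂ :- con (+ 27) :* Q :* α₁ :+ con (+ 27) :* α₃))
             :+ (con (+ 27) :* w :- con (+ 2)) :* (α₁ :* α₁ :* α₁ :+ r³)) :+ (con (+ 3) :* t :- con (+ 1)) :* (con -[1+ 8 ] :* α₁ :* α₂)) Q ⅓ 2/27 α₁ α₂ α₃ (r ^ 3)))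

        27c-upper≈ : num (+ 27) * (c-centre + c-radius - α₃) ≈ num (+ 2) * r ^ 3 + constant (- α₁) α₂ (- α₃)
        27c-upper≈ = modulo _ 27w-2≈0 (modulo _ 3⅓-1≈0 (solve 7 (λ Q t w α₁ α₂ α₃ r³ →
          con (+ 27) :* (:- w :* (α₁ :* (α₁ :* (α₁ :* con (+ 1)))) :+ t :* α₁ :* α₂ :+ Q :* α₁ :+ w :* r³ :- α₃)
          := ((con (+ 2) :* r³ :+ (con (+ 2) :* (:- α₁ :* :- α₁ :* :- α₁) :- con (+ 9) :* :- α₁ :* α₂ :- con (+ 27) :* Q :* :- α₁ :+ con (+ 27) :* :- α₃))
             :+ (con (+ 27) :* w :- con (+ 2)) :* (r³ :- α₁ :* α₁ :* α₁)) :+ (con (+ 3) :* t :- con (+ 1)) :* (con (+ 9) :* α₁ :* α₂)) Q ⅓ 2/27 α₁ α₂ α₃ (r ^ 3)))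

        d-lower≈ : α₃ - d-lower ≈ f[2s] α₁ α₂ α₃
        d-lower≈ = solve 5 (λ Q s α₁ α₂ α₃ →
          α₃ :- (:- con (+ 2) :* Q :* α₁ :- con (+ 2) :* s :* α₂ :- con (+ 2) :* Q :* s)
          := α₃ :+ con (+ 2) :* Q :* α₁ :+ con (+ 2) :* s :* α₂ :+ con (+ 2) :* Q :* s) Q s α₁ α₂ α₃

        d-upper≈ : d-upper - α₃ ≈ f[2s] (- α₁) α₂ (- α₃)
        d-upper≈ = solve 5 (λ Q s α₁ α₂ α₃ →
          (:- con (+ 2) :* Q :* α₁ :+ con (+ 2) :* s :* α₂ :+ con (+ 2) :* Q :* s) :- α₃
          := :- α₃ :+ con (+ 2) :* Q :* :- α₁ :+ con (+ 2) :* s :* α₂ :+ con (+ 2) :* Q :* s) Q s α₁ α₂ α₃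

        -- Used for `x = ± α₁`. For one sign `∣α₁∣ + x` vanishes and (b*) becomes exactly
        -- `0 ≤ f′[2s]`; for the other `∣α₁∣ + x ≥ 0`, so that inequality is the weaker one.
        f′≈ : ∀ x → α₂ - b*-lower ≈ f′[2s] x α₂ - num (+ 4) * s * (∣α₁∣ + x)
        f′≈ x = solve 5 (λ Q s α₂ m x → α₂ :- (con (+ 4) :* s :* m :- con (+ 9) :* Q)
          := (α₂ :+ con (+ 9) :* Q :+ con (+ 4) :* s :* x) :- con (+ 4) :* s :* (m :+ x)) Q s α₂ ∣α₁∣ x

      b⇒0≤radicand : b → 0# ≤ radicand α₁ α₂
      b⇒0≤radicand p = 0≤-resp 3b≈ (0≤-* (0≤-num 3) (≤⇒0≤- p))

      conditions⇒admissible : a → b* → b → c → d → Admissible α₁ α₂ α₃ × Admissible (- α₁) α₂ (- α₃)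
      conditions⇒admissible pa pb* pb (pc , pc′) (pd , pd′) = record
        { 0≤f″[2s] = 0≤-resp (f″ α₁) (0≤-+ (≤⇒0≤- pa) 0≤∣α₁∣+α₁)
        ; 0≤f′[2s] = 0≤-resp (f′ α₁) (0≤-+ (≤⇒0≤- pb*) (0≤-* 0≤4s 0≤∣α₁∣+α₁))
        ; 0≤f[2s] = 0≤-resp d-lower≈ (≤⇒0≤- pd)
        ; 0≤radicand = b⇒0≤radicand pb
        ; 0≤constant = 0≤-resp 27c-lower≈ (0≤-* (0≤-num 27) (≤⇒0≤- pc)) } , record
        { 0≤f″[2s] = 0≤-resp (f″ (- α₁)) (0≤-+ (≤⇒0≤- pa) 0≤∣α₁∣-α₁)
        ; 0≤f′[2s] = 0≤-resp (f′ (- α₁)) (0≤-+ (≤⇒0≤- pb*) (0≤-* 0≤4s 0≤∣α₁∣-α₁))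
        ; 0≤f[2s] = 0≤-resp d-upper≈ (≤⇒0≤- pd′)
        ; 0≤radicand = 0≤-resp (sym radicand-neg) (b⇒0≤radicand pb)
        ; 0≤constant = 0≤-resp (trans 27c-upper≈ (+-congʳ (*-congˡ (cube-cong (sym (r′≈r (b⇒0≤radicand pb)))))))
            (0≤-* (0≤-num 27) (≤⇒0≤- pc′)) }
        where
        0≤4s = 0≤-* (0≤-num 4) 0≤s
        f″ : ∀ x → (num (+ 6) * s - ∣α₁∣) + (∣α₁∣ + x) ≈ f″[2s] x
        f″ x = solve 3 (λ s m x → (con (+ 6) :* s :- m) :+ (m :+ x) := con (+ 6) :* s :+ x) s ∣α₁∣ x
        f′ : ∀ x → (α₂ - b*-lower) + num (+ 4) * s * (∣α₁∣ + x) ≈ f′[2s] x α₂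
        f′ x = trans (+-congʳ (f′≈ x)) (solve 2 (λ u v → (u :- v) :+ v := u) _ _)

      admissible⇒conditions : Admissible α₁ α₂ α₃ × Admissible (- α₁) α₂ (- α₃) → a × b* × b × c × d
      admissible⇒conditions (p , p′) = pa , pb* , pb ,
        ( 0≤-⇒≤ (0≤-*⁻ (num-suc≰0 26) (0≤-resp (sym 27c-lower≈) (0≤constant p)))
        , 0≤-⇒≤ (0≤-*⁻ (num-suc≰0 26) (0≤-resp (trans (+-congʳ (*-congˡ (cube-cong (r′≈r (0≤radicand p))))) (sym 27c-upper≈)) (0≤constant p′)))) ,
        (0≤⇒≤ (0≤f[2s] p) (sym d-lower≈) , 0≤⇒≤ (0≤f[2s] p′) (sym d-upper≈))
        where
        open Admissible
        pa : a
        pa = Sum.[ (λ e → 0≤⇒≤ (0≤f″[2s] p′) (+-congˡ (-‿cong (sym e)))) ,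
          (λ e → 0≤⇒≤ (0≤f″[2s] p) (+-congˡ (trans (solve 1 (λ x → x := :- (:- x)) α₁) (-‿cong (sym e))))) ]′ ∣α₁∣≈
        b*-at : ∀ x → 0# ≤ f′[2s] x α₂ → ∣α₁∣ + x ≈ 0# → b*
        b*-at x 0≤f′ e = 0≤⇒≤ 0≤f′ (sym (trans (f′≈ x) (trans (+-congˡ (-‿cong (trans (*-congˡ e) (R.zeroʳ _))))
          (solve 1 (λ u → u :- con (+ 0) := u) _))))
        pb* : b*
        pb* = Sum.[ (λ e → b*-at (- α₁) (0≤f′[2s] p′) (≈⇒-≈0 e)) ,
          (λ e → b*-at α₁ (0≤f′[2s] p) (trans (+-congʳ e) (R.-‿inverseˡ α₁))) ]′ ∣α₁∣≈
        pb : b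
        pb = 0≤-⇒≤ (0≤-*⁻ (num-suc≰0 2) (0≤-resp (sym 3b≈) (0≤radicand p)))

      a-equality b*-equality d-equality : Set
      a-equality = ∣α₁∣ ≈ num (+ 6) * s
      b*-equality = b*-lower ≈ α₂
      d-equality = d-lower ≈ α₃ ⊎ α₃ ≈ d-upper

      d-equality⇒root : d-equality → f[2s] α₁ α₂ α₃ ≈ 0# ⊎ f[2s] (- α₁) α₂ (- α₃) ≈ 0#
      d-equality⇒root = Sum.map (λ e → trans (sym d-lower≈) (≈⇒-≈0 (sym e))) (λ e → trans (sym d-upper≈) (≈⇒-≈0 (sym e)))

      root⇒d-equality : f[2s] α₁ α₂ α₃ ≈ 0# ⊎ f[2s] (- α₁) α₂ (- α₃) ≈ 0# → d-equality
      root⇒d-equality = Sum.map (λ e → sym (-≈0⇒≈ (trans d-lower≈ e))) (λ e → sym (-≈0⇒≈ (trans d-upper≈ e)))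

      -- The sign of `α₁` selects the end: with `∣α₁∣ ≈ α₁` an equality in (a) or (b*) concerns the
      -- reflected cubic, that is, the root `-2s`; with `∣α₁∣ ≈ - α₁` it concerns `2s`.
      equality⇒root : ∀ {y₁ y₂ y₃} → Vieta α₁ α₂ α₃ y₁ y₂ y₃ → Bounded y₁ → Bounded y₂ → Bounded y₃ →
        a-equality ⊎ b*-equality ⊎ d-equality → f[2s] α₁ α₂ α₃ ≈ 0# ⊎ f[2s] (- α₁) α₂ (- α₃) ≈ 0#
      equality⇒root v b₁ b₂ b₃ (inj₁ e) = Sum.[
        (λ e′ → inj₂ (f″[2s]≈0⇒f[2s]≈0 (vieta-neg v) (bounded-neg b₁) (bounded-neg b₂) (bounded-neg b₃)
          (≈⇒-≈0 (trans (sym e) e′)))) ,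
        (λ e′ → inj₁ (f″[2s]≈0⇒f[2s]≈0 v b₁ b₂ b₃ (trans (+-congʳ (trans (sym e) e′)) (R.-‿inverseˡ α₁)))) ]′ ∣α₁∣≈
      equality⇒root v b₁ b₂ b₃ (inj₂ (inj₁ e)) = Sum.[
        (λ e′ → inj₂ (f′[2s]≈0⇒f[2s]≈0 (vieta-neg v) (bounded-neg b₁) (bounded-neg b₂) (bounded-neg b₃) (f′≈0 (- α₁) (≈⇒-≈0 e′)))) ,
        (λ e′ → inj₁ (f′[2s]≈0⇒f[2s]≈0 v b₁ b₂ b₃ (f′≈0 α₁ (trans (+-congʳ e′) (R.-‿inverseˡ α₁))))) ]′ ∣α₁∣≈
        where
        f′≈0 : ∀ x → ∣α₁∣ + x ≈ 0# → f′[2s] x α₂ ≈ 0#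
        f′≈0 x e′ = trans (trans (solve 1 (λ u → u := u :- con (+ 0)) _)
          (trans (+-congˡ (-‿cong (sym (trans (*-congˡ e′) (R.zeroʳ _))))) (sym (f′≈ x)))) (≈⇒-≈0 (sym e))
      equality⇒root v b₁ b₂ b₃ (inj₂ (inj₂ e)) = d-equality⇒root e

    -- Deciding whether `±2s` are roots, and splitting them off.

    module IntegralSplitting (q : ℕ) (Q≈q : Q ≈ num (+ q)) (a₁ a₂ a₃ : ℤ) where


      private
        α₁ α₂ α₃ : Carrier
        α₁ = num a₁
        α₂ = num a₂
        α₃ = num a₃


      f f⁻ : Carrier
      f = f[2s] α₁ α₂ α₃
      f⁻ = f[2s] (- α₁) α₂ (- α₃)

      -- The rational part and the coefficient of `s` in `f = f(2s)`; the conjugate quantity is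
      -- `f⁻ = -f(-2s) = -P₀ + s R₀`.
      P₀ R₀ : ℤ
      P₀ = a₃ ℤ.+ + 2 ℤ.* + q ℤ.* a₁
      R₀ = + 2 ℤ.* (a₂ ℤ.+ + q)

      private
        num-P₀ : num P₀ ≈ α₃ + num (+ 2) * Q * α₁
        num-P₀ = trans (num-+ _ _) (+-congˡ (trans (num-* _ _) (*-congʳ (trans (num-* _ _) (*-congˡ (sym Q≈q))))))

        num-R₀ : num R₀ ≈ num (+ 2) * (α₂ + Q)
        num-R₀ = trans (num-* _ _) (*-congˡ (trans (num-+ _ _) (+-congˡ (sym Q≈q))))

      f≈ : f ≈ num P₀ + s * num R₀
      f≈ = trans (solve 5 (λ Q s α₁ α₂ α₃ → α₃ :+ con (+ 2) :* Q :* α₁ :+ con (+ 2) :* s :* α₂ :+ con (+ 2) :* Q :* s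
        := (α₃ :+ con (+ 2) :* Q :* α₁) :+ s :* (con (+ 2) :* (α₂ :+ Q))) Q s α₁ α₂ α₃)
        (sym (+-cong num-P₀ (*-congˡ num-R₀)))

      f⁻≈ : f⁻ ≈ - num P₀ + s * num R₀
      f⁻≈ = trans (solve 5 (λ Q s α₁ α₂ α₃ → :- α₃ :+ con (+ 2) :* Q :* :- α₁ :+ con (+ 2) :* s :* α₂ :+ con (+ 2) :* Q :* s
        := :- (α₃ :+ con (+ 2) :* Q :* α₁) :+ s :* (con (+ 2) :* (α₂ :+ Q))) Q s α₁ α₂ α₃)
        (sym (+-cong (-‿cong num-P₀) (*-congˡ num-R₀)))

      cubic-2s : cubic α₁ α₂ α₃ -2s ≈ - f⁻
      cubic-2s = modulo _ ss-Q≈0 (solve 5 (λ Q s α₁ α₂ α₃ → let y = :- (con (+ 2) :* s) in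
        (α₃ :- con (+ 2) :* Q :* α₁) :+ y :* ((α₂ :- con (+ 3) :* Q) :+ y :* (α₁ :+ y))
        := :- (:- α₃ :+ con (+ 2) :* Q :* :- α₁ :+ con (+ 2) :* s :* α₂ :+ con (+ 2) :* Q :* s)
           :+ (s :* s :- Q) :* (con (+ 4) :* α₁ :- con (+ 8) :* s)) Q s α₁ α₂ α₃)

      cubic2s : cubic α₁ α₂ α₃ 2s ≈ f
      cubic2s = modulo _ ss-Q≈0 (solve 5 (λ Q s α₁ α₂ α₃ → let y = con (+ 2) :* s in
        (α₃ :- con (+ 2) :* Q :* α₁) :+ y :* ((α₂ :- con (+ 3) :* Q) :+ y :* (α₁ :+ y))
        := (α₃ :+ con (+ 2) :* Q :* α₁ :+ con (+ 2) :* s :* α₂ :+ con (+ 2) :* Q :* s)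
           :+ (s :* s :- Q) :* (con (+ 4) :* α₁ :+ con (+ 8) :* s)) Q s α₁ α₂ α₃)

      -- The product of the conjugates is `f f⁻ = Q R₀² - P₀²`. Its vanishing is a stable equation,
      -- so a doubly negated disjunction is enough.
      f≈0⇒P²≡qR² : ¬ ¬ (f ≈ 0# ⊎ f⁻ ≈ 0#) → P₀ ℤ.* P₀ ≡ + q ℤ.* (R₀ ℤ.* R₀)
      f≈0⇒P²≡qR² ¬¬f = num-injective (trans (num-* _ _) (trans (sym (-≈0⇒≈ (≈-stable λ ¬e → ¬¬f λ f≈0 → ¬e (trans
          (sym (modulo _ ss-Q≈0 (solve 4 (λ Q s P R → (P :+ s :* R) :* (:- P :+ s :* R) := (Q :* (R :* R) :- P :* P) :+ (s :* s :- Q) :* (R :* R)) Q s (num P₀) (num R₀))))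
          (trans (*-cong (sym f≈) (sym f⁻≈)) (Sum.[ (λ e → trans (*-congʳ e) (R.zeroˡ _)) , (λ e → trans (*-congˡ e) (R.zeroʳ _)) ]′ f≈0))))))
        (sym (trans (num-* _ _) (*-cong (sym Q≈q) (num-* _ _))))))

      -- Taking roots gives `∣P₀∣ ≈ s ∣R₀∣`, and the signs of the two integers decide which of
      -- `P₀ + s R₀` and `-P₀ + s R₀` vanishes. After `f≈0⇒P²≡qR²` this recovers a genuine
      -- disjunction from its double negation.
      P²≡qR²⇒f≈0 : P₀ ℤ.* P₀ ≡ + q ℤ.* (R₀ ℤ.* R₀) → f ≈ 0# ⊎ f⁻ ≈ 0#
      P²≡qR²⇒f≈0 e = signs (num-∣∣ P₀) (num-∣∣ R₀)
        where
        p r : Carrier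
        p = num (+ ℤ.∣ P₀ ∣)
        r = num (+ ℤ.∣ R₀ ∣)
        ±-square : ∀ {x y} → x ≈ y ⊎ x ≈ - y → x * x ≈ y * y
        ±-square (inj₁ e) = *-cong e e
        ±-square {x} {y} (inj₂ e) = trans (*-cong e e) (solve 1 (λ y → :- y :* :- y := y :* y) y)
        p≈sr : p ≈ s * r
        p≈sr = square-injective (0≤-num _) (0≤-* 0≤s (0≤-num _)) (trans (±-square (num-∣∣ P₀)) (trans (trans (sym (num-* _ _))
          (trans (R.reflexive (≡.cong num e)) (trans (num-* _ _) (*-cong (sym Q≈q) (trans (num-* _ _) (sym (±-square (num-∣∣ R₀))))))))
          (trans (*-congʳ (sym ss≈Q)) (solve 2 (λ s r → s :* s :* (r :* r) := (s :* r) :* (s :* r)) s r))))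
        signs : p ≈ num P₀ ⊎ p ≈ - num P₀ → r ≈ num R₀ ⊎ r ≈ - num R₀ → f ≈ 0# ⊎ f⁻ ≈ 0#
        signs (inj₁ u) (inj₁ v) = inj₂ (trans f⁻≈ (trans (+-cong (-‿cong (trans (sym u) p≈sr)) (*-congˡ (sym v))) (R.-‿inverseˡ _)))
        signs (inj₁ u) (inj₂ v) = inj₁ (trans f≈ (trans (+-congʳ (trans (sym u) (trans p≈sr (*-congˡ v))))
          (solve 2 (λ s R → s :* :- R :+ s :* R := con (+ 0)) s (num R₀))))
        signs (inj₂ u) (inj₁ v) = inj₁ (trans f≈ (trans (+-congˡ (trans (*-congˡ (sym v)) (trans (sym p≈sr) u))) (R.-‿inverseʳ _)))
        signs (inj₂ u) (inj₂ v) = inj₂ (trans f⁻≈ (trans (+-congʳ (trans (sym u) (trans p≈sr (*-congˡ v))))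
          (solve 2 (λ s R → s :* :- R :+ s :* R := con (+ 0)) s (num R₀))))

      gap≈0⇒f≈0 : ∀ {y₁ y₂ y₃} → Vieta α₁ α₂ α₃ y₁ y₂ y₃ → Any (λ y → gap y ≈ 0#) (y₁ ∷ y₂ ∷ y₃ ∷ []) → ¬ ¬ (f ≈ 0# ⊎ f⁻ ≈ 0#)
      gap≈0⇒f≈0 {y₁} {y₂} {y₃} v any ¬f =
        let r₁ , r₂ , r₃ = vieta-root v in case any (r₁ ∷ r₂ ∷ r₃ ∷ [])
        where
        root : ∀ {y} → gap y ≈ 0# → cubic α₁ α₂ α₃ y ≈ 0# → ⊥
        root gap≈0 fy≈0 = gap≈0⇒≈±2s gap≈0 λ
          { (inj₁ y≈2s) → ¬f (inj₁ (trans (sym cubic2s) (trans (cubic-cong refl refl refl (sym y≈2s)) fy≈0)))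
          ; (inj₂ y≈-2s) → ¬f (inj₂ (trans (solve 1 (λ x → x := :- (:- x)) _)
              (trans (-‿cong (trans (sym cubic-2s) (trans (cubic-cong refl refl refl (sym y≈-2s)) fy≈0))) -0≈0))) }
        case : ∀ {ys} → Any (λ y → gap y ≈ 0#) ys → All (λ y → cubic α₁ α₂ α₃ y ≈ 0#) ys → ⊥
        case (here gap≈0) (fy≈0 ∷ _) = root gap≈0 fy≈0
        case (there any) (_ ∷ rs) = case any rs

      -- From `h(x) = x³ f(x + Q/x)` one has `h(s) = s³ f(2s)` and `h(-s) = -s³ f(-2s)`; the long
      -- cofactors only account for `s² = Q`.
      f≈0⇒real-root : f ≈ 0# ⊎ f⁻ ≈ 0# → ∃ λ r → eval (sexticᴿ α₁ α₂ α₃) r ≈ 0#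
      f≈0⇒real-root (inj₁ e) = s , trans (modulo _ ss-Q≈0 (solve 5 (λ Q s α₁ α₂ α₃ →
          Q :* (Q :* (Q :* con (+ 1))) :+ s :* (α₁ :* (Q :* (Q :* con (+ 1))) :+ s :* (α₂ :* Q :+ s :* (α₃ :+ s :* (α₂ :+ s :* (α₁ :+ s :* (con (+ 1) :+ s :* con (+ 0)))))))
          := (s :* s :* s) :* (α₃ :+ con (+ 2) :* Q :* α₁ :+ con (+ 2) :* s :* α₂ :+ con (+ 2) :* Q :* s)
             :+ (s :* s :- Q) :* (s :* s :* s :* α₁ :- s :* s :* α₂ :+ s :* s :* s :* s :- Q :* s :* α₁ :- Q :* s :* s :- Q :* Q)) Q s α₁ α₂ α₃))
        (trans (*-congˡ e) (R.zeroʳ _))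
      f≈0⇒real-root (inj₂ e) = - s , trans (modulo _ ss-Q≈0 (solve 5 (λ Q s α₁ α₂ α₃ → let r = :- s in
          Q :* (Q :* (Q :* con (+ 1))) :+ r :* (α₁ :* (Q :* (Q :* con (+ 1))) :+ r :* (α₂ :* Q :+ r :* (α₃ :+ r :* (α₂ :+ r :* (α₁ :+ r :* (con (+ 1) :+ r :* con (+ 0)))))))
          := (s :* s :* s) :* (:- α₃ :+ con (+ 2) :* Q :* :- α₁ :+ con (+ 2) :* s :* α₂ :+ con (+ 2) :* Q :* s)
             :+ (s :* s :- Q) :* (con (+ 0) :- s :* s :* s :* α₁ :- s :* s :* α₂ :+ s :* s :* s :* s :+ Q :* s :* α₁ :- Q :* s :* s :- Q :* Q)) Q s α₁ α₂ α₃))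
        (trans (*-congˡ e) (R.zeroʳ _))

      vieta-cong : ∀ {x₁ x₂ x₃ y₁ y₂ y₃} → x₁ ≈ y₁ → x₂ ≈ y₂ → x₃ ≈ y₃ → Vieta α₁ α₂ α₃ x₁ x₂ x₃ → Vieta α₁ α₂ α₃ y₁ y₂ y₃
      vieta-cong e₁ e₂ e₃ (vieta p₁ p₂ p₃) = vieta
        (trans p₁ (-‿cong (+-cong (+-cong e₁ e₂) e₃)))
        (trans p₂ (+-congʳ (+-cong (+-cong (*-cong e₁ e₂) (*-cong e₂ e₃)) (*-cong e₃ e₁))))
        (trans p₃ (+-cong (-‿cong (*-cong (*-cong e₁ e₂) e₃)) (-‿cong (*-congˡ (+-cong (+-cong e₁ e₂) e₃)))))

      -- `P₀ = R₀ = 0` means `α₂ = -Q` and `α₃ = -2Qα₁`, which makes the cubic `(y² - 4Q)(y + α₁)`.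
      non-square-vieta : f ≈ 0# ⊎ f⁻ ≈ 0# → (P₀ ℤ.* P₀ ≡ + q ℤ.* (R₀ ℤ.* R₀) → P₀ ≡ + 0 × R₀ ≡ + 0) →
        Vieta α₁ α₂ α₃ 2s -2s (- α₁)
      non-square-vieta f≈0 P₀≡0×R₀≡0 = vieta
          (solve 2 (λ s α₁ → α₁ := :- (con (+ 2) :* s :+ :- (con (+ 2) :* s) :+ :- α₁)) s α₁)
          (trans α₂≈-Q (sym (modulo _ ss-Q≈0 (solve 3 (λ Q s α₁ → let y = con (+ 2) :* s in
            y :* :- y :+ :- y :* :- α₁ :+ :- α₁ :* y :+ con (+ 3) :* Q := :- Q :+ (s :* s :- Q) :* con -[1+ 3 ]) Q s α₁))))
          (trans α₃≈-2Qα₁ (sym (modulo _ ss-Q≈0 (solve 3 (λ Q s α₁ → let y = con (+ 2) :* s in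
            :- (y :* :- y :* :- α₁) :- con (+ 2) :* Q :* (y :+ :- y :+ :- α₁) := :- (con (+ 2) :* Q :* α₁) :+ (s :* s :- Q) :* (con -[1+ 3 ] :* α₁)) Q s α₁))))
        where
        zeros = P₀≡0×R₀≡0 (f≈0⇒P²≡qR² λ ¬f → ¬f f≈0)
        α₃≈-2Qα₁ : α₃ ≈ - (num (+ 2) * Q * α₁)
        α₃≈-2Qα₁ = trans (solve 2 (λ x y → x := (x :+ y) :- y) α₃ (num (+ 2) * Q * α₁))
          (trans (+-congʳ (trans (sym num-P₀) (R.reflexive (≡.cong num (proj₁ zeros))))) (R.+-identityˡ _))
        α₂≈-Q : α₂ ≈ - Q
        α₂≈-Q = trans (solve 2 (λ x y → x := (x :+ y) :- y) α₂ Q)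
          (trans (+-congʳ (*≈0⇒≈0 (trans (sym num-R₀) (R.reflexive (≡.cong num (proj₂ zeros)))) λ e → num-suc≰0 1 (≈⇒≤ e))) (R.+-identityˡ _))

      -- Equality between reals that carry such a witness is decided in the integers. When `s` is
      -- integral, this covers all values tested by `splitting`.
      Integral : Carrier → Set
      Integral x = ∃ λ a → x ≈ num a

      integral-num : ∀ a → Integral (num a)
      integral-num a = a , refl

      int-Q : Integral Q
      int-Q = + q , Q≈q

      integral-+ : ∀ {x y} → Integral x → Integral y → Integral (x + y)
      integral-+ (a , p) (b , q) = a ℤ.+ b , trans (+-cong p q) (sym (num-+ a b))

      integral-* : ∀ {x y} → Integral x → Integral y → Integral (x * y)
      integral-* (a , p) (b , q) = a ℤ.* b , trans (*-cong p q) (sym (num-* a b))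

      integral-neg : ∀ {x} → Integral x → Integral (- x)
      integral-neg (a , p) = ℤ.- a , trans (-‿cong p) (sym (num-neg a))

      integral-≈? : ∀ {x y} → Integral x → Integral y → Dec (x ≈ y)
      integral-≈? (a , p) (b , q) = map′ (λ e → trans p (trans (R.reflexive (≡.cong num e)) (sym q)))
        (λ e → num-injective (trans (sym p) (trans e q))) (a ℤP.≟ b)

      -- The divided difference `(f(y) - f(x)) / (y - x)`. For a root `x` it is the quadratic
      -- cofactor at `y`, so it detects double roots as well.
      quotient : Carrier → Carrier → Carrier
      quotient x y = ((α₂ - num (+ 3) * Q) + x * (α₁ + x)) + y * ((α₁ + x) + y)

      third : Carrier → Carrier → Carrier
      third x y = - (α₁ + x) - y

      quotient≈0⇒vieta : ∀ {x y} → cubic α₁ α₂ α₃ x ≈ 0# → quotient x y ≈ 0# → Vieta α₁ α₂ α₃ x y (third x y)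
      quotient≈0⇒vieta {x} {y} fx≈0 gy≈0 = quotient⇒vieta fx≈0
        (solve 3 (λ α₁ x y → y :+ (:- (α₁ :+ x) :- y) := :- (α₁ :+ x)) α₁ x y)
        (modulo _ gy≈0 (solve 5 (λ Q α₁ α₂ x y → let n = (α₂ :- con (+ 3) :* Q) :+ x :* (α₁ :+ x) in
          y :* (:- (α₁ :+ x) :- y) := n :+ (n :+ y :* ((α₁ :+ x) :+ y)) :* con -[1+ 0 ]) Q α₁ α₂ x y))

      quotient-factor : ∀ {x y z} → Vieta α₁ α₂ α₃ x y z → ∀ t → quotient x t ≈ (t - y) * (t - z)
      quotient-factor {x} {y} {z} (vieta e₁ e₂ e₃) t = trans
        (+-cong (+-cong (+-congʳ e₂) (*-congˡ (+-congʳ e₁))) (*-congˡ (+-congʳ (+-congʳ e₁))))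
        (solve 5 (λ Q x y z t → let α₁ = :- (x :+ y :+ z) ; α₂ = x :* y :+ y :* z :+ z :* x :+ con (+ 3) :* Q in
          ((α₂ :- con (+ 3) :* Q) :+ x :* (α₁ :+ x)) :+ t :* ((α₁ :+ x) :+ t) := (t :- y) :* (t :- z)) Q x y z t)

      quotient-root : ∀ {x y z t} → Vieta α₁ α₂ α₃ x y z → y ≈ t ⊎ z ≈ t → quotient x t ≈ 0#
      quotient-root {t = t} v (inj₁ y≈t) = trans (quotient-factor v t) (trans (*-congʳ (≈⇒-≈0 (sym y≈t))) (R.zeroˡ _))
      quotient-root {t = t} v (inj₂ z≈t) = trans (quotient-factor v t) (trans (*-congˡ (≈⇒-≈0 (sym z≈t))) (R.zeroʳ _))

      realRoots : ℕ → ℕ → List Carrier → List Carrier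
      realRoots k ℓ ys = replicate k -2s ++ replicate ℓ 2s ++ ys

      -- In `split₁` the two remaining roots may be irrational. Their sum and product being integral
      -- is what makes the coefficients of the quartic cofactor of `h` integral.
      data Splitting : Set where
        split₃ : ∀ k ℓ → k ℕ.+ ℓ ≡ 3 → sexticᴿ α₁ α₂ α₃ ≋ quads (realRoots k ℓ []) → Splitting
        split₂ : ∀ k ℓ {y} → k ℕ.+ ℓ ≡ 2 → Integral y → Bounded y → ¬ (gap y ≈ 0#) →
          sexticᴿ α₁ α₂ α₃ ≋ quads (realRoots k ℓ (y ∷ [])) → Splitting
        split₁ : ∀ k ℓ {y z} → k ℕ.+ ℓ ≡ 1 → Integral (y + z) → Integral (y * z) →
          Bounded y → Bounded z → ¬ (gap y ≈ 0#) → ¬ (gap z ≈ 0#) →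
          sexticᴿ α₁ α₂ α₃ ≋ quads (realRoots k ℓ (y ∷ z ∷ [])) → Splitting

      module _ (int-s : Integral s) (p : Admissible α₁ α₂ α₃ × Admissible (- α₁) α₂ (- α₃)) where

        private
          int-2s = integral-* (integral-num (+ 2)) int-s
          int--2s = integral-neg int-2s
          int-0 = integral-num (+ 0)
          int-α₂-3Q = integral-+ (integral-num a₂) (integral-neg (integral-* (integral-num (+ 3)) int-Q))

          int-cubic : ∀ {y} → Integral y → Integral (cubic α₁ α₂ α₃ y)
          int-cubic y = integral-+
            (integral-+ (integral-num a₃) (integral-neg (integral-* (integral-* (integral-num (+ 2)) int-Q) (integral-num a₁))))
            (integral-* y (integral-+ int-α₂-3Q (integral-* y (integral-+ (integral-num a₁) y))))

          int-quotient : ∀ {x y} → Integral x → Integral y → Integral (quotient x y)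
          int-quotient x y = integral-+ (integral-+ int-α₂-3Q (integral-* x (integral-+ (integral-num a₁) x)))
            (integral-* y (integral-+ (integral-+ (integral-num a₁) x) y))

          int-third : ∀ {x y} → Integral x → Integral y → Integral (third x y)
          int-third x y = integral-+ (integral-neg (integral-+ (integral-num a₁) x)) (integral-neg y)

          gap≉0 : ∀ {y} → ¬ (y ≈ -2s) → ¬ (y ≈ 2s) → ¬ (gap y ≈ 0#)
          gap≉0 y≉-2s y≉2s gap≈0 = gap≈0⇒≈±2s gap≈0 Sum.[ y≉2s , y≉-2s ]′

          finish₂ : ∀ {x y z} k ℓ → k ℕ.+ ℓ ≡ 2 → (∀ zs → realRoots k ℓ zs ≡ x ∷ y ∷ zs) → Integral z →
            Vieta α₁ α₂ α₃ x y z → ¬ (z ≈ -2s) → ¬ (z ≈ 2s) → Splitting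
          finish₂ {z = z} k ℓ k+ℓ≡2 eq int-z v z≉-2s z≉2s = split₂ k ℓ k+ℓ≡2 int-z
            (admissible⇒bounded p (proj₂ (proj₂ (vieta-root v)))) (gap≉0 z≉-2s z≉2s)
            (≡.subst (λ ys → sexticᴿ α₁ α₂ α₃ ≋ quads ys) (≡.sym (eq (z ∷ []))) (vieta⇒sextic≋quads v))

          finish₁ : ∀ {x} k ℓ → k ℕ.+ ℓ ≡ 1 → (∀ zs → realRoots k ℓ zs ≡ x ∷ zs) → Integral x →
            cubic α₁ α₂ α₃ x ≈ 0# → (∀ {y z} → Vieta α₁ α₂ α₃ x y z → ¬ (y ≈ -2s) × ¬ (y ≈ 2s) × ¬ (z ≈ -2s) × ¬ (z ≈ 2s)) → Splitting
          finish₁ {x} k ℓ k+ℓ≡1 eq int-x fx≈0 others =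
            let y , z , v = remaining-roots p fx≈0
                y≉-2s , y≉2s , z≉-2s , z≉2s = others v
                _ , fy≈0 , fz≈0 = vieta-root v
                v′ = Vieta.α₁≈ v
                sum≈ : y + z ≈ - (α₁ + x)
                sum≈ = trans (solve 3 (λ x y z → y :+ z := :- (:- (x :+ y :+ z) :+ x)) x y z) (-‿cong (+-congʳ (sym v′)))
                product≈ : y * z ≈ (α₂ - num (+ 3) * Q) + x * (α₁ + x)
                product≈ = trans (solve 4 (λ Q x y z → y :* z := (x :* y :+ y :* z :+ z :* x :+ con (+ 3) :* Q :- con (+ 3) :* Q) :+ x :* (:- (x :+ y :+ z) :+ x)) Q x y z)
                  (sym (+-cong (+-congʳ (Vieta.α₂≈ v)) (*-congˡ (+-congʳ v′))))
                b , e = integral-neg (integral-+ (integral-num a₁) int-x)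
                c , e′ = integral-+ int-α₂-3Q (integral-* int-x (integral-+ (integral-num a₁) int-x))
            in split₁ k ℓ k+ℓ≡1 (b , trans sum≈ e) (c , trans product≈ e′)
                 (admissible⇒bounded p fy≈0) (admissible⇒bounded p fz≈0) (gap≉0 y≉-2s y≉2s) (gap≉0 z≉-2s z≉2s)
                 (≡.subst (λ ys → sexticᴿ α₁ α₂ α₃ ≋ quads ys) (≡.sym (eq (y ∷ z ∷ []))) (vieta⇒sextic≋quads v))

          finish₃ : ∀ {x y z} → Vieta α₁ α₂ α₃ x y z → ∀ k ℓ → k ℕ.+ ℓ ≡ 3 → realRoots k ℓ [] ≡ x ∷ y ∷ z ∷ [] → Splitting
          finish₃ v k ℓ k+ℓ≡3 eq = split₃ k ℓ k+ℓ≡3 (≡.subst (λ ys → sexticᴿ α₁ α₂ α₃ ≋ quads ys) (≡.sym eq) (vieta⇒sextic≋quads v))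

        -- The roots -2s are split off before the roots 2s, so that they come out in the order of `realRoots`.
        splitting : f ≈ 0# ⊎ f⁻ ≈ 0# → Splitting
        splitting f≈0 with integral-≈? (int-cubic int--2s) int-0
        ... | yes fx≈0 with integral-≈? (int-quotient int--2s int--2s) int-0 | integral-≈? (int-quotient int--2s int-2s) int-0
        ...   | yes gx≈0 | _ = double
          where
          v = quotient≈0⇒vieta fx≈0 gx≈0
          int-z = int-third int--2s int--2s
          double : Splitting
          double with integral-≈? int-z int--2s | integral-≈? int-z int-2s
          ... | yes z≈-2s | _ = finish₃ (vieta-cong refl refl z≈-2s v) 3 0 ≡.refl ≡.refl
          ... | no _ | yes z≈2s = finish₃ (vieta-cong refl refl z≈2s v) 2 1 ≡.refl ≡.refl
          ... | no z≉-2s | no z≉2s = finish₂ 2 0 ≡.refl (λ _ → ≡.refl) int-z v z≉-2s z≉2s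
        ...   | no gx≉0 | yes gy≈0 = mixed
          where
          v = quotient≈0⇒vieta fx≈0 gy≈0
          int-z = int-third int--2s int-2s
          mixed : Splitting
          mixed with integral-≈? int-z int-2s
          ... | yes z≈2s = finish₃ (vieta-cong refl refl z≈2s v) 1 2 ≡.refl ≡.refl
          ... | no z≉2s = finish₂ 1 1 ≡.refl (λ _ → ≡.refl) int-z v (λ z≈-2s → gx≉0 (quotient-root v (inj₂ z≈-2s))) z≉2s
        -- The cofactor left by the root `-2s` vanishes at neither end. By `quotient-root` this
        -- keeps both remaining roots, which need not be integral, away from `±2s`.
        ...   | no gx≉0 | no gy≉0 = finish₁ 1 0 ≡.refl (λ _ → ≡.refl) int--2s fx≈0 λ v →
          (λ e → gx≉0 (quotient-root v (inj₁ e))) , (λ e → gy≉0 (quotient-root v (inj₁ e))) ,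
          (λ e → gx≉0 (quotient-root v (inj₂ e))) , (λ e → gy≉0 (quotient-root v (inj₂ e)))
        splitting f≈0 | no fx≉0 with integral-≈? (int-quotient int-2s int-2s) int-0
        ...   | yes gy≈0 = positive
          where
          f2s≈0 : cubic α₁ α₂ α₃ 2s ≈ 0#
          f2s≈0 = Sum.[ (λ e → trans cubic2s e) , (λ e → contradiction (trans cubic-2s (trans (-‿cong e) -0≈0)) fx≉0) ]′ f≈0
          v = quotient≈0⇒vieta f2s≈0 gy≈0
          int-z = int-third int-2s int-2s
          positive : Splitting
          positive with integral-≈? int-z int-2s
          ... | yes z≈2s = finish₃ (vieta-cong refl refl z≈2s v) 0 3 ≡.refl ≡.refl
          ... | no z≉2s = finish₂ 0 2 ≡.refl (λ _ → ≡.refl) int-z v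
            (λ z≈-2s → fx≉0 (trans (cubic-cong refl refl refl (sym z≈-2s)) (proj₂ (proj₂ (vieta-root v))))) z≉2s
        ...   | no gy≉0 = finish₁ 0 1 ≡.refl (λ _ → ≡.refl) int-2s f2s≈0 λ v → let _ , fy≈0 , fz≈0 = vieta-root v in
          (λ e → fx≉0 (trans (cubic-cong refl refl refl (sym e)) fy≈0)) , (λ e → gy≉0 (quotient-root v (inj₁ e))) ,
          (λ e → fx≉0 (trans (cubic-cong refl refl refl (sym e)) fz≈0)) , (λ e → gy≉0 (quotient-root v (inj₂ e)))
          where
          f2s≈0 : cubic α₁ α₂ α₃ 2s ≈ 0#
          f2s≈0 = Sum.[ (λ e → trans cubic2s e) , (λ e → contradiction (trans cubic-2s (trans (-‿cong e) -0≈0)) fx≉0) ]′ f≈0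

-- The Cauchy reals as an instance, and the ring of complex numbers.

ℝ-structure : RealStructure
ℝ-structure = record
  { Carrier = ℝ ; _≈_ = Real._≈_ ; _≤_ = Real._≤_ ; _+_ = Real._+_ ; _*_ = Real._*_ ; -_ = Real.-_ ; num = Real.fromℤ
  ; isCommutative = isCommutativeRing
  ; num-+ = fromℤ-homo-+ ; num-* = fromℤ-homo-* ; num-neg = fromℤ-homo-neg ; num-mono = fromℤ-mono-≤
  ; ≈⇒≤ = ≈⇒≤ ; ≤-trans = ≤-trans ; ≤-antisym = ≤-antisym ; ≤-stable = ≤-stable
  ; ≤-total = λ x≰y y≰x → ≤-total x≰y y≰x
  ; +-mono-≤ = +-mono-≤ ; 0≤-* = 0≤-* ; *≈0⇒≈0 = *≈0⇒≈0 ; ¬1≤0 = ¬1≤0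
  ; ½ = Real.fromℚ ℚ.½ ; 2*½≈1 = pointwise-≈ λ _ → ≡.refl
  ; √ = Real.√ ; 0≤√ = 0≤√ ; √*√≈ = √*√≈ ; cubic-root = cubic-root }
  where
  open RealProperties
  open CubicRoots

module ℝ-Algebra = RealAlgebra ℝ-structure

module ComplexRing where

  open ℝ-Algebra using (module R)
  open ℝ-Algebra.ComplexIdentities

  isCommutativeRing : IsCommutative Complex.rawRing
  isCommutativeRing = record
    { isRing = record
      { +-isAbelianGroup = record
        { isGroup = record
          { isMonoid = record
            { isSemigroup = record
              { isMagma = record
                { isEquivalence = record
                  { refl = R.refl , R.refl ; sym = λ (p , q) → R.sym p , R.sym q
                  ; trans = λ (p , q) (p′ , q′) → R.trans p p′ , R.trans q q′ }
                ; ∙-cong = λ (p , q) (p′ , q′) → R.+-cong p p′ , R.+-cong q q′ }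
              ; assoc = λ x y z → R.+-assoc _ _ _ , R.+-assoc _ _ _ }
            ; identity = (λ x → R.+-identityˡ _ , R.+-identityˡ _) , (λ x → R.+-identityʳ _ , R.+-identityʳ _) }
          ; inverse = (λ x → R.-‿inverseˡ _ , R.-‿inverseˡ _) , (λ x → R.-‿inverseʳ _ , R.-‿inverseʳ _)
          ; ⁻¹-cong = λ (p , q) → R.-‿cong p , R.-‿cong q }
        ; comm = λ x y → R.+-comm _ _ , R.+-comm _ _ }
      ; *-cong = λ (p , q) (p′ , q′) → R.+-cong (R.*-cong p p′) (R.-‿cong (R.*-cong q q′)) , R.+-cong (R.*-cong p q′) (R.*-cong q p′)
      ; *-assoc = λ (a +i b) (c +i d) (e +i f) → *-assocᶜ (a , b) (c , d) (e , f)
      ; *-identity = (λ (a +i b) → *-identityˡᶜ (a , b)) , (λ (a +i b) → *-identityʳᶜ (a , b))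
      ; distrib = (λ (a +i b) (c +i d) (e +i f) → *-distribˡᶜ (a , b) (c , d) (e , f))
                , (λ (a +i b) (c +i d) (e +i f) → *-distribʳᶜ (a , b) (c , d) (e , f)) }
    ; *-comm = λ (a +i b) (c +i d) → *-commᶜ (a , b) (c , d) }

-- Square numbers and the irrationality of other square roots.

isSquare? : ∀ q → Dec (IsSquare q)
isSquare? q = map′ (λ (m , _ , e) → m , e) (λ (m , e) → m , ℕ.s≤s (m≤q m e) , e)
  (ℕP.anyUpTo? (λ m → q ℕP.≟ m ℕ.* m) (suc q))
  where
  m≤q : ∀ m → q ≡ m ℕ.* m → m ℕ.≤ q
  m≤q zero _ = ℕ.z≤n
  m≤q m@(suc _) ≡.refl = ℕP.m≤m*n m m

-- Division by the gcd leaves coprime `p′`, `r′` with `p′² = q r′²`. Then `r′` divides `p′²`, hence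
-- `p′` by coprimality, hence `r′ = 1`.
p²≡qr²⇒square : ∀ p q r .{{_ : ℕ.NonZero r}} → p ℕ.* p ≡ q ℕ.* (r ℕ.* r) → IsSquare q
p²≡qr²⇒square p q r e = p′ , q≡p′p′
  where
  instance
    g≢0 : ℕ.NonZero (gcd p r)
    g≢0 = ℕ.≢-nonZero (gcd[m,n]≢0 p r (inj₂ (ℕ.≢-nonZero⁻¹ r)))
    gg≢0 : ℕ.NonZero (gcd p r ℕ.* gcd p r)
    gg≢0 = ℕP.m*n≢0 (gcd p r) (gcd p r)
  g = gcd p r
  p′ = p DivMod./ g
  r′ = r DivMod./ g
  coprime : Coprimality.Coprime p′ r′
  coprime = Coprimality.coprime-/gcd p r
  p′g≡p : p′ ℕ.* g ≡ p
  p′g≡p = DivMod.m/n*n≡m (gcd[m,n]∣m p r)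
  r′g≡r : r′ ℕ.* g ≡ r
  r′g≡r = DivMod.m/n*n≡m (gcd[m,n]∣n p r)
  e′ : p′ ℕ.* p′ ≡ q ℕ.* (r′ ℕ.* r′)
  e′ = ℕP.*-cancelʳ-≡ _ _ (g ℕ.* g) (begin
    (p′ ℕ.* p′) ℕ.* (g ℕ.* g)              ≡⟨ solve 2 (λ p g → (p :* p) :* (g :* g) := (p :* g) :* (p :* g)) ≡.refl p′ g ⟩
    (p′ ℕ.* g) ℕ.* (p′ ℕ.* g)              ≡⟨ ≡.cong₂ ℕ._*_ p′g≡p p′g≡p ⟩
    p ℕ.* p                                ≡⟨ e ⟩
    q ℕ.* (r ℕ.* r)                        ≡⟨ ≡.cong (λ t → q ℕ.* (t ℕ.* t)) r′g≡r ⟨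
    q ℕ.* ((r′ ℕ.* g) ℕ.* (r′ ℕ.* g))      ≡⟨ solve 3 (λ q r g → q :* ((r :* g) :* (r :* g)) := (q :* (r :* r)) :* (g :* g)) ≡.refl q r′ g ⟩
    (q ℕ.* (r′ ℕ.* r′)) ℕ.* (g ℕ.* g)      ∎)
    where
    open ≡.≡-Reasoning
    open Data.Nat.Solver.+-*-Solver
  r′∣p′ : r′ Divisibility.∣ p′
  r′∣p′ = Coprimality.coprime-divisor {r′} {p′} {p′} (Coprimality.sym coprime)
    (Divisibility.divides (q ℕ.* r′) (≡.trans e′ (≡.sym (ℕP.*-assoc q r′ r′))))
  r′≡1 : r′ ≡ 1
  r′≡1 = coprime (r′∣p′ , Divisibility.∣-refl)
  q≡p′p′ : q ≡ p′ ℕ.* p′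
  q≡p′p′ = ≡.sym (≡.trans e′ (≡.trans (≡.cong (λ t → q ℕ.* (t ℕ.* t)) r′≡1) (ℕP.*-identityʳ q)))

P²≡qR²⇒≡0 : ∀ {q} → ¬ IsSquare q → ∀ P R → P ℤ.* P ≡ + q ℤ.* (R ℤ.* R) → P ≡ + 0 × R ≡ + 0
P²≡qR²⇒≡0 {q} ¬sq P R e = P≡0 , R≡0
  where
  ∣e∣ : ℤ.∣ P ∣ ℕ.* ℤ.∣ P ∣ ≡ q ℕ.* (ℤ.∣ R ∣ ℕ.* ℤ.∣ R ∣)
  ∣e∣ = ≡.trans (≡.sym (ℤP.abs-* P P)) (≡.trans (≡.cong ℤ.∣_∣ e) (≡.trans (ℤP.abs-* (+ q) (R ℤ.* R)) (≡.cong (q ℕ.*_) (ℤP.abs-* R R))))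
  ∣R∣≡0 : ∀ r → ℤ.∣ P ∣ ℕ.* ℤ.∣ P ∣ ≡ q ℕ.* (r ℕ.* r) → r ≡ 0
  ∣R∣≡0 zero _ = ≡.refl
  ∣R∣≡0 r@(suc _) e = contradiction (p²≡qr²⇒square ℤ.∣ P ∣ q r e) ¬sq
  R≡0 : R ≡ + 0
  R≡0 = ℤP.∣i∣≡0⇒i≡0 (∣R∣≡0 ℤ.∣ R ∣ ∣e∣)
  P≡0 : P ≡ + 0
  P≡0 = ℤP.∣i∣≡0⇒i≡0 (Sum.[ (λ e → e) , (λ e → e) ]′ (ℕP.m*n≡0⇒m≡0∨n≡0 ℤ.∣ P ∣
    (≡.trans ∣e∣ (≡.trans (≡.cong (λ t → q ℕ.* (ℤ.∣ t ∣ ℕ.* ℤ.∣ t ∣)) R≡0) (ℕP.*-zeroʳ q)))))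

-- Weil polynomials as products of real quadratic factors.

module WeilPolynomials (q : ℕ) where

  open RealStructure ℝ-structure using (isCommutative; num-+; num-*; num-neg; ½; 2*½≈1; √*√≈; 0≤√; num)
  open ℝ-Algebra.Solver using (con; _:=_; _:+_; _:*_; _:-_; :-_)
  open ℝ-Algebra using (module R; solve; num-∣∣; ≈⇒≥; *≈0; -≈0⇒≈; 0≤⇒≤; 0≤-resp; 0≤-square; 0≤-+; 0≤-*⁻; 0≤-num;
    num-suc≰0; ≤⇒0≤-; ≈⇒-≈0; modulo; square-injective; num-injective)
  open Real using (fromℕ; √)

  Q s : ℝ
  Q = fromℕ q
  s = √ Q

  0≤s = 0≤√ Q
  ss≈Q = √*√≈ {Q} (0≤-num q)

  open ℝ-Algebra.TraceCubic Q s 0≤s ss≈Q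

  module ℝP = PolynomialProperties Real.rawRing isCommutative
  module ℂP = PolynomialProperties Complex.rawRing ComplexRing.isCommutativeRing
  module ℤ→ℝ = PolynomialMap ℤ.+-*-rawRing Real.rawRing isCommutative Real.fromℤ
    (λ e → R.reflexive (≡.cong Real.fromℤ e)) num-+ num-* R.refl R.refl
  module ℝ→ℂ = PolynomialMap Real.rawRing Complex.rawRing ComplexRing.isCommutativeRing Complex.fromℝ
    (λ e → e , R.refl)
    (λ x y → R.refl , R.sym (R.+-identityˡ _))
    (λ x y → solve 2 (λ x y → x :* y := x :* y :- con (+ 0) :* con (+ 0)) x y ,
             solve 2 (λ x y → con (+ 0) := x :* con (+ 0) :+ con (+ 0) :* y) x y)
    (R.refl , R.refl) (R.refl , R.refl)

  toℝ-injective : ∀ {f g} → toℝ[X] f ℝ[X].≈ toℝ[X] g → f ℤ[X].≈ g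
  toℝ-injective {f} {g} e .ℤ[X]._≈_.coeff-≈ i = num-injective
    (R.trans (R.sym (ℤ→ℝ.coeff-map-φ f i)) (R.trans (ℝ[X]._≈_.coeff-≈ e i) (ℤ→ℝ.coeff-map-φ g i)))

  fromℝ-injective : ∀ {f g} → List.map Complex.fromℝ f ℂ[X].≈ List.map Complex.fromℝ g → f ℝ[X].≈ g
  fromℝ-injective {f} {g} e .ℝ[X]._≈_.coeff-≈ i =
    R.trans (R.sym (proj₁ (ℝ→ℂ.coeff-map-φ f i)))
      (R.trans (proj₁ (ℂ[X]._≈_.coeff-≈ e i)) (proj₁ (ℝ→ℂ.coeff-map-φ g i)))

  toℂ≈ : ∀ h → toℂ[X] h ≡ List.map Complex.fromℝ (toℝ[X] h)
  toℂ≈ h = ListP.map-∘ h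

  trace : ℂ → ℝ
  trace w = fromℕ 2 Real.* ℂ.re w

  norm : ℂ → ℝ
  norm w = ℂ.re w Real.* ℂ.re w Real.+ ℂ.im w Real.* ℂ.im w

  conjugate-factors : ∀ w → norm w Real.≈ Q →
    linear w ℂ[X].* linear (Complex.conj w) ℂ[X].≈ List.map Complex.fromℝ (quad (trace w))
  conjugate-factors (a +i b) e =
    let p₀ , q₀ = conjugates₀ a b ; p₁ , q₁ = conjugates₁ a b ; p₂ , q₂ = conjugates₂ a b in
    ℂP.∷-cong (R.trans p₀ e , q₀) (ℂP.∷-cong (p₁ , q₁) (ℂP.∷-cong (p₂ , q₂) ℂP.≈-refl))
    where
    open ℝ-Algebra.ComplexIdentities

  0≤norm : ∀ w → fromℕ 0 Real.≤ norm w
  0≤norm w = 0≤-+ (0≤-square (ℂ.re w)) (0≤-square (ℂ.im w))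

  modulus⇒norm : ∀ w → Complex.∣ w ∣ Real.≈ s → norm w Real.≈ Q
  modulus⇒norm w e = R.trans (R.sym (√*√≈ (0≤norm w))) (R.trans (R.*-cong e e) ss≈Q)

  norm⇒modulus : ∀ w → norm w Real.≈ Q → Complex.∣ w ∣ Real.≈ s
  norm⇒modulus w e = square-injective (0≤√ (norm w)) 0≤s (R.trans (√*√≈ (0≤norm w)) (R.trans e (R.sym ss≈Q)))

  trace-bounded : ∀ w → norm w Real.≈ Q → Bounded (trace w)
  trace-bounded (a +i b) e = 0≤⇒≤ (0≤-* (0≤-num 4) (0≤-square b)) (R.trans
    (solve 2 (λ a b → con (+ 4) :* (b :* b) := con (+ 4) :* (a :* a :+ b :* b) :- (con (+ 2) :* a) :* (con (+ 2) :* a)) a b)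
    (R.+-congʳ (R.*-congˡ e)))
    where
    open RealStructure ℝ-structure using (0≤-*)

  -- A zero of x² - yx + Q.
  weil : ℝ → ℂ
  weil y = (½ Real.* y) +i √ (Q Real.- (½ Real.* y) Real.* (½ Real.* y))

  trace-weil : ∀ y → trace (weil y) Real.≈ y
  trace-weil y = R.trans (R.sym (R.*-assoc _ _ _)) (R.trans (R.*-congʳ 2*½≈1) (R.*-identityˡ y))

  norm-weil : ∀ {y} → Bounded y → norm (weil y) Real.≈ Q
  norm-weil {y} b = R.trans (R.+-congˡ (√*√≈ 0≤Q-¼yy)) (solve 2 (λ Q x → x :* x :+ (Q :- x :* x) := Q) Q (½ Real.* y))
    where
    0≤Q-¼yy : fromℕ 0 Real.≤ Q Real.- (½ Real.* y) Real.* (½ Real.* y)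
    0≤Q-¼yy = 0≤-*⁻ (num-suc≰0 3) (0≤-resp (R.sym (modulo _ (≈⇒-≈0 2*½≈1)
      (solve 3 (λ Q h y → con (+ 4) :* (Q :- (h :* y) :* (h :* y)) := (con (+ 4) :* Q :- y :* y)
        :+ (con (+ 2) :* h :- con (+ 1)) :* (:- (y :* y) :* (con (+ 2) :* h :+ con (+ 1)))) Q ½ y))) (≤⇒0≤- b))

  -- The real counterpart of `W`: a pair `w`, `w̄` of modulus `s` is recorded by its trace
  -- `y = w + w̄`, and such a pair exists for a given real `y` exactly when `y² ≤ 4Q`.
  record RealFactorization (g : ℕ) (h : ℤ[X].Poly) : Set where
    constructor realFactorization
    field
      traces : List ℝ
      length-traces : List.length traces ≡ g
      bounded : All Bounded traces
      factors : toℝ[X] h ℝ[X].≈ quads traces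

  one-trace : ∀ {h} → RealFactorization 1 h → ∃ λ y → Bounded y × toℝ[X] h ℝ[X].≈ quads (y ∷ [])
  one-trace (realFactorization (y ∷ []) _ (b ∷ []) e) = y , b , e

  two-traces : ∀ {h} → RealFactorization 2 h → ∃₂ λ y z → Bounded y × Bounded z × toℝ[X] h ℝ[X].≈ quads (y ∷ z ∷ [])
  two-traces (realFactorization (y ∷ z ∷ []) _ (b ∷ b′ ∷ []) e) = y , z , b , b′ , e

  three-traces : ∀ {h} → RealFactorization 3 h →
    ∃ λ y₁ → ∃ λ y₂ → ∃ λ y₃ → Bounded y₁ × Bounded y₂ × Bounded y₃ × toℝ[X] h ℝ[X].≈ quads (y₁ ∷ y₂ ∷ y₃ ∷ [])
  three-traces (realFactorization (y₁ ∷ y₂ ∷ y₃ ∷ []) _ (b₁ ∷ b₂ ∷ b₃ ∷ []) e) = y₁ , y₂ , y₃ , b₁ , b₂ , b₃ , e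

  product≈ : ∀ {g} (w : Fin g → ℂ) → (∀ i → norm (w i) Real.≈ Q) →
    ℂ[X].product (λ i → linear (w i) ℂ[X].* linear (Complex.conj (w i))) ℂ[X].≈
    List.map Complex.fromℝ (quads (List.tabulate (λ i → trace (w i))))
  product≈ {zero} w norms = ℂP.≈-refl
  product≈ {suc g} w norms = ℂP.≈-trans
    (ℂP.*-cong (conjugate-factors (w zero) (norms zero)) (product≈ (λ i → w (suc i)) (λ i → norms (suc i))))
    (ℂP.≈-sym (ℝ→ℂ.map-* (quad (trace (w zero))) (quads (List.tabulate (λ i → trace (w (suc i)))))))

  product-weil≈ : ∀ {ys} → All Bounded ys →
    ℂ[X].product (λ i → linear (weil (List.lookup ys i)) ℂ[X].* linear (Complex.conj (weil (List.lookup ys i)))) ℂ[X].≈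
    List.map Complex.fromℝ (quads ys)
  product-weil≈ [] = ℂP.≈-refl
  product-weil≈ {y ∷ ys} (b ∷ bs) = ℂP.≈-trans
    (ℂP.*-cong (ℂP.≈-trans (conjugate-factors (weil y) (norm-weil b)) (ℝ→ℂ.map-cong (quad-cong (trace-weil y)))) (product-weil≈ bs))
    (ℂP.≈-sym (ℝ→ℂ.map-* (quad y) (quads ys)))

  weil⇒real : ∀ {g h} → W q g h → RealFactorization g h
  weil⇒real {g} {h} v = realFactorization (List.tabulate (λ i → trace (w i))) (ListP.length-tabulate _)
    (AllP.tabulate⁺ (λ i → trace-bounded (w i) (norms i)))
    (fromℝ-injective (≡.subst (ℂ[X]._≈ List.map Complex.fromℝ (quads (List.tabulate (λ i → trace (w i))))) (toℂ≈ h)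
      (ℂP.≈-trans factorization (product≈ w norms))))
    where
    open W v
    norms : ∀ i → norm (w i) Real.≈ Q
    norms i = modulus⇒norm (w i) (modulus i)

  real⇒weil : ∀ {g h} → 1 ℕ.≤ g → ℤ[X].coeff h (2 ℕ.* g) ≡ + 1 → List.length h ≡ suc (2 ℕ.* g) → RealFactorization g h → W q g h
  real⇒weil {h = h} 1≤g monic length-h (realFactorization ys ≡.refl bs e) = record
    { positive-degree = 1≤g ; monic = monic
    ; degree = λ i i> → coeff-beyond h (≡.subst (ℕ._≤ i) (≡.sym length-h) i>)
    ; w = λ i → weil (List.lookup ys i)
    ; modulus = λ i → norm⇒modulus (weil (List.lookup ys i)) (norm-weil {List.lookup ys i} (All.lookup bs (∈-lookup i)))
    ; factorization = ≡.subst (ℂ[X]._≈ _) (≡.sym (toℂ≈ h)) (ℂP.≈-trans (ℝ→ℂ.map-cong e) (ℂP.≈-sym (product-weil≈ bs))) }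
    where
    coeff-beyond : ∀ p {i} → List.length p ℕ.≤ i → ℤ[X].coeff p i ≡ + 0
    coeff-beyond [] _ = ≡.refl
    coeff-beyond (a ∷ p) (ℕ.s≤s n≤i) = coeff-beyond p n≤i

  -- The criterion for the sextic and the classification of real roots.

  module Classification (a₁ a₂ a₃ : ℤ) where

    open IntegralSplitting q R.refl a₁ a₂ a₃
    open Conditions q a₁ a₂ a₃ using (α₁; α₂; α₃)
    module H = Conditions q a₁ a₂ a₃
    open Inequalities (Real.fromℚ (+ 1 ℚ./ 3)) (Real.fromℚ (+ 2 ℚ./ 27))
      (RealProperties.pointwise-≈ λ _ → ≡.refl) (RealProperties.pointwise-≈ λ _ → ≡.refl)
      α₁ α₂ α₃ (Real.fromℕ ℤ.∣ a₁ ∣) (num-∣∣ a₁) (0≤-num ℤ.∣ a₁ ∣)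
      using (conditions⇒admissible; admissible⇒conditions; b⇒0≤radicand; equality⇒root; root⇒d-equality) public

    h : ℤ[X].Poly
    h = sextic q a₁ a₂ a₃

    toℝ-sextic : toℝ[X] h ℝ[X].≈ sexticᴿ α₁ α₂ α₃
    toℝ-sextic = ℝP.∷-cong (num-^ 3) (ℝP.∷-cong (R.trans (num-* a₁ _) (R.*-congˡ (num-^ 2))) (ℝP.∷-cong (num-* a₂ (+ q)) ℝP.≈-refl))
      where
      num-^ : ∀ n → num ((+ q) ℤ.^ n) Real.≈ Q Real.^ n
      num-^ zero = R.refl
      num-^ (suc n) = R.trans (num-* (+ q) ((+ q) ℤ.^ n)) (R.*-congˡ (num-^ n))

    record Roots : Set where
      constructor roots
      field
        {y₁ y₂ y₃} : ℝ
        v : Vieta α₁ α₂ α₃ y₁ y₂ y₃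
        b₁ : Bounded y₁
        b₂ : Bounded y₂
        b₃ : Bounded y₃

      all : List ℝ
      all = y₁ ∷ y₂ ∷ y₃ ∷ []

      all-bounded : All Bounded all
      all-bounded = b₁ ∷ b₂ ∷ b₃ ∷ []

      factors : toℝ[X] h ℝ[X].≈ quads all
      factors = ℝP.≈-trans toℝ-sextic (vieta⇒sextic≋quads v)

      admissible : Admissible α₁ α₂ α₃ × Admissible (Real.- α₁) α₂ (Real.- α₃)
      admissible = admissible-pair v b₁ b₂ b₃

    open Roots using (all; all-bounded; factors; admissible)

    weil⇒roots : W q 3 h → Roots
    weil⇒roots w = let _ , _ , _ , b₁ , b₂ , b₃ , e = three-traces (weil⇒real w) in
      roots (sextic≋quads⇒vieta (ℝP.≈-trans (ℝP.≈-sym toℝ-sextic) e)) b₁ b₂ b₃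

    roots⇒weil : Roots → W q 3 h
    roots⇒weil r = real⇒weil (ℕ.s≤s ℕ.z≤n) ≡.refl ≡.refl (realFactorization (all r) ≡.refl (all-bounded r) (factors r))

    admissible⇒roots : Admissible α₁ α₂ α₃ × Admissible (Real.- α₁) α₂ (Real.- α₃) → Roots
    admissible⇒roots p =
      let y , e = RealStructure.cubic-root ℝ-structure a₁ (a₂ ℤ.+ ℤ.- (+ 3 ℤ.* + q)) (a₃ ℤ.+ ℤ.- (+ 2 ℤ.* + q ℤ.* a₁))
          fy≈0 = R.trans (R.+-cong (R.sym num-constant) (R.*-congˡ (R.+-congʳ (R.sym num-linear)))) e
          y₂ , y₃ , v = remaining-roots p fy≈0
          r₁ , r₂ , r₃ = vieta-root v
      in roots v (admissible⇒bounded p r₁) (admissible⇒bounded p r₂) (admissible⇒bounded p r₃)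
      where
      num-linear : num (a₂ ℤ.+ ℤ.- (+ 3 ℤ.* + q)) Real.≈ α₂ Real.- Real.fromℕ 3 Real.* Q
      num-linear = R.trans (num-+ a₂ (ℤ.- (+ 3 ℤ.* + q))) (R.+-congˡ (R.trans (num-neg (+ 3 ℤ.* + q)) (R.-‿cong (num-* (+ 3) (+ q)))))
      num-constant : num (a₃ ℤ.+ ℤ.- (+ 2 ℤ.* + q ℤ.* a₁)) Real.≈ α₃ Real.- Real.fromℕ 2 Real.* Q Real.* α₁
      num-constant = R.trans (num-+ a₃ (ℤ.- (+ 2 ℤ.* + q ℤ.* a₁))) (R.+-congˡ (R.trans (num-neg (+ 2 ℤ.* + q ℤ.* a₁))
        (R.-‿cong (R.trans (num-* (+ 2 ℤ.* + q) a₁) (R.*-congʳ (num-* (+ 2) (+ q)))))))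

    weil⇔conditions : W q 3 h ⇔ (H.a × H.b* × H.b × H.c × H.d)
    weil⇔conditions = mk⇔ (λ w → admissible⇒conditions (admissible (weil⇒roots w)))
      (λ (pa , pb* , pb , pc , pd) → roots⇒weil (admissible⇒roots (conditions⇒admissible pa pb* pb pc pd)))

    Equality : Set
    Equality = H.a-equality ⊎ H.b*-equality ⊎ H.d-equality

    Endpoint : Set
    Endpoint = f Real.≈ Real.fromℕ 0 ⊎ f⁻ Real.≈ Real.fromℕ 0

    -- A real root yields a vanishing gap, hence an end root, only up to double negation. The detour
    -- through the integer equation `P₀² = q R₀²` turns this into an actual choice.
    real-root⇒endpoint : Roots → HasRealRoot h → Endpoint
    real-root⇒endpoint r (x , e) = P²≡qR²⇒f≈0 (f≈0⇒P²≡qR² λ ¬f →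
      real-root⇒gap≈0 x (all-bounded r) (R.trans (ℝP.eval-cong _ _ x (ℝP.≈-sym (factors r))) e) λ any →
        gap≈0⇒f≈0 (Roots.v r) any ¬f)

    endpoint⇒real-root : Endpoint → HasRealRoot h
    endpoint⇒real-root f≈0 = let x , e = f≈0⇒real-root f≈0 in x , R.trans (ℝP.eval-cong _ _ x toℝ-sextic) e

    real-root⇔equality : W q 3 h → HasRealRoot h ⇔ Equality
    -- The equality produced is always one in (d), which the other two imply.
    real-root⇔equality w = mk⇔ (λ root → inj₂ (inj₂ (root⇒d-equality (real-root⇒endpoint r root))))
      (λ eq → endpoint⇒real-root (equality⇒root (Roots.v r) (Roots.b₁ r) (Roots.b₂ r) (Roots.b₃ r) eq))
      where
      r = weil⇒roots w

    -- Retaining only the length of the list and the vanishing of its gaps allows matching on one,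
    -- two or three real quadratic factors instead of on all pairs `k`, `ℓ`.
    realRoots-++ : ∀ k ℓ → ∃ λ zs → List.length zs ≡ k ℕ.+ ℓ × All (λ z → gap z Real.≈ Real.fromℕ 0) zs × (∀ ys → realRoots k ℓ ys ≡ zs ++ ys)
    realRoots-++ k ℓ = replicate k -2s ++ replicate ℓ 2s ,
      ≡.trans (ListP.length-++ (replicate k -2s)) (≡.cong₂ ℕ._+_ (ListP.length-replicate k) (ListP.length-replicate ℓ)) ,
      AllP.++⁺ (AllP.replicate⁺ k gap-2s≈0) (AllP.replicate⁺ ℓ gap2s≈0) ,
      λ ys → ≡.sym (ListP.++-assoc (replicate k -2s) (replicate ℓ 2s) ys)

    gap≈0⇒bounded : ∀ {y} → gap y Real.≈ Real.fromℕ 0 → Bounded y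
    gap≈0⇒bounded e = ≈⇒≥ (-≈0⇒≈ e)

    -- The number of indices with gap yᵢ ≈ 0 is an invariant of h, since gap yᵢ ≥ 0 and the
    -- elementary symmetric functions of the gaps are polynomials in the coefficients of h.
    Status : Case → Roots → Set
    Status I r = IsSquare q → ⊥
    Status II r = IsSquare q × gap-sum (Roots.y₁ r) (Roots.y₂ r) (Roots.y₃ r) Real.≈ Real.fromℕ 0
      × gap-sum₂ (Roots.y₁ r) (Roots.y₂ r) (Roots.y₃ r) Real.≈ Real.fromℕ 0
    Status III r = IsSquare q × ¬ (gap-sum (Roots.y₁ r) (Roots.y₂ r) (Roots.y₃ r) Real.≈ Real.fromℕ 0)
      × gap-sum₂ (Roots.y₁ r) (Roots.y₂ r) (Roots.y₃ r) Real.≈ Real.fromℕ 0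
    Status IV r = IsSquare q × ¬ (gap-sum₂ (Roots.y₁ r) (Roots.y₂ r) (Roots.y₃ r) Real.≈ Real.fromℕ 0)

    status-unique : ∀ c c′ r r′ → Status c r → Status c′ r′ → c ≡ c′
    status-unique c c′ r r′ = compare c c′
      where
      unique = gap-sums-unique (Roots.v r) (Roots.v r′)
      e = proj₁ unique
      e₂ = proj₂ unique
      compare : ∀ c c′ → Status c r → Status c′ r′ → c ≡ c′
      compare I I _ _ = ≡.refl
      compare II II _ _ = ≡.refl
      compare III III _ _ = ≡.refl
      compare IV IV _ _ = ≡.refl
      compare I II ¬sq (sq , _) = contradiction sq ¬sq
      compare I III ¬sq (sq , _) = contradiction sq ¬sq
      compare I IV ¬sq (sq , _) = contradiction sq ¬sq
      compare II I (sq , _) ¬sq = contradiction sq ¬sq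
      compare III I (sq , _) ¬sq = contradiction sq ¬sq
      compare IV I (sq , _) ¬sq = contradiction sq ¬sq
      compare II III (_ , p , _) (_ , ¬p , _) = contradiction (R.trans (R.sym e) p) ¬p
      compare III II (_ , ¬p , _) (_ , p , _) = contradiction (R.trans e p) ¬p
      compare II IV (_ , _ , p) (_ , ¬p) = contradiction (R.trans (R.sym e₂) p) ¬p
      compare IV II (_ , ¬p) (_ , _ , p) = contradiction (R.trans e₂ p) ¬p
      compare III IV (_ , _ , p) (_ , ¬p) = contradiction (R.trans (R.sym e₂) p) ¬p
      compare IV III (_ , ¬p) (_ , _ , p) = contradiction (R.trans e₂ p) ¬p

    x²-Q : ℝ[X].Poly
    x²-Q = (Real.- Q) ∷ Real.fromℕ 0 ∷ Real.fromℕ 1 ∷ []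

    toℝ-x²-q : toℝ[X] (x²-q q a₁ a₂ a₃) ℝ[X].≈ x²-Q
    toℝ-x²-q = ℝP.∷-cong (R.trans (R.reflexive (≡.cong num (ℤP.+-identityˡ (ℤ.- (+ q))))) (num-neg (+ q))) ℝP.≈-refl

    toℝ-x²-q²* : ∀ h₀ → toℝ[X] (x²-q q a₁ a₂ a₃ ℤ[X].^ 2 ℤ[X].* h₀) ℝ[X].≈ x²-Q ℝ[X].^ 2 ℝ[X].* toℝ[X] h₀
    toℝ-x²-q²* h₀ = ℝP.≈-trans (ℤ→ℝ.map-* (x²-q q a₁ a₂ a₃ ℤ[X].^ 2) h₀)
      (ℝP.*-congʳ (toℝ[X] h₀) (ℝP.≈-trans (ℤ→ℝ.map-^ (x²-q q a₁ a₂ a₃) 2) (ℝP.^-cong 2 toℝ-x²-q)))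

    no-real-root⇒gap≉0 : ∀ {ys} h₀ → toℝ[X] h₀ ℝ[X].≈ quads ys → ¬ HasRealRoot h₀ → ¬ Any (λ y → gap y Real.≈ Real.fromℕ 0) ys
    no-real-root⇒gap≉0 h₀ e ¬root any = let x , e′ = gap≈0⇒real-root any in
      ¬root (x , R.trans (ℝP.eval-cong _ _ x e) e′)

    gap≉0⇒no-real-root : ∀ {ys} h₀ → All Bounded ys → toℝ[X] h₀ ℝ[X].≈ quads ys → All (λ y → ¬ (gap y Real.≈ Real.fromℕ 0)) ys → ¬ HasRealRoot h₀
    gap≉0⇒no-real-root h₀ bs e ¬gaps (x , e′) = real-root⇒gap≈0 x bs (R.trans (ℝP.eval-cong _ _ x (ℝP.≈-sym e)) e′)
      (AllP.All¬⇒¬Any ¬gaps)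

    sextic≋⇒vieta : ∀ {y₁ y₂ y₃} → toℝ[X] h ℝ[X].≈ quads (y₁ ∷ y₂ ∷ y₃ ∷ []) → Vieta α₁ α₂ α₃ y₁ y₂ y₃
    sextic≋⇒vieta e = sextic≋quads⇒vieta (ℝP.≈-trans (ℝP.≈-sym toℝ-sextic) e)

    realFactors-cong : ∀ k ℓ {f g} → f ℝ[X].≈ g → realFactors q a₁ a₂ a₃ k ℓ f ℝ[X].≈ realFactors q a₁ a₂ a₃ k ℓ g
    realFactors-cong k ℓ = ℝP.*-congˡ ((X ⊕ C s) ^ (2 ℕ.* k) ⊗ (X ⊕ C (Real.- s)) ^ (2 ℕ.* ℓ))
      where
      open ℝ[X] using (X; C; _^_) renaming (_+_ to _⊕_; _*_ to _⊗_)

    realRoots⇒roots₃ : IsSquare q → ∀ {zs} → List.length zs ≡ 3 → All (λ z → gap z Real.≈ Real.fromℕ 0) zs →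
      toℝ[X] h ℝ[X].≈ quads zs → ∃ λ r → Any (λ y → gap y Real.≈ Real.fromℕ 0) (all r) × Status II r
    realRoots⇒roots₃ sq {x ∷ y ∷ z ∷ []} _ (g₁ ∷ g₂ ∷ g₃ ∷ []) e =
      roots (sextic≋⇒vieta e) (gap≈0⇒bounded g₁) (gap≈0⇒bounded g₂) (gap≈0⇒bounded g₃) , here g₁ , sq , gap-sum≈0 g₁ g₂ g₃ ,
      R.trans (gap-sum₂≈gap*gap g₁) (R.trans (R.*-congʳ g₂) (R.zeroˡ _))

    realRoots⇒roots₂ : IsSquare q → ∀ {y zs} → Bounded y → ¬ (gap y Real.≈ Real.fromℕ 0) →
      List.length zs ≡ 2 → All (λ z → gap z Real.≈ Real.fromℕ 0) zs →
      toℝ[X] h ℝ[X].≈ quads (zs ++ y ∷ []) → ∃ λ r → Any (λ y → gap y Real.≈ Real.fromℕ 0) (all r) × Status III r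
    realRoots⇒roots₂ sq {y} {x ∷ x′ ∷ []} b gap≉0 _ (g₁ ∷ g₂ ∷ []) e =
      roots (sextic≋⇒vieta e) (gap≈0⇒bounded g₁) (gap≈0⇒bounded g₂) b , here g₁ , sq ,
      (λ p → gap≉0 (R.trans (R.sym (gap-sum≈gap g₁ g₂)) p)) ,
      R.trans (gap-sum₂≈gap*gap g₁) (R.trans (R.*-congʳ g₂) (R.zeroˡ _))

    realRoots⇒roots₁ : IsSquare q → ∀ {y z zs} → Bounded y → Bounded z → ¬ Any (λ y → gap y Real.≈ Real.fromℕ 0) (y ∷ z ∷ []) →
      List.length zs ≡ 1 → All (λ z → gap z Real.≈ Real.fromℕ 0) zs →
      toℝ[X] h ℝ[X].≈ quads (zs ++ y ∷ z ∷ []) → ∃ λ r → Any (λ y → gap y Real.≈ Real.fromℕ 0) (all r) × Status IV r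
    realRoots⇒roots₁ sq {y} {z} {x ∷ []} b b′ ¬any _ (g₁ ∷ []) e =
      roots (sextic≋⇒vieta e) (gap≈0⇒bounded g₁) b b′ , here g₁ , sq ,
      λ p → *≈0 (R.trans (R.sym (gap-sum₂≈gap*gap g₁)) p) λ { (inj₁ g) → ¬any (here g) ; (inj₂ g) → ¬any (there (here g)) }

    realFactors≋quads : ∀ {k ℓ zs h₀} ys → realRoots k ℓ ys ≡ zs → h₀ ℝ[X].≈ quads ys →
      toℝ[X] h ℝ[X].≈ realFactors q a₁ a₂ a₃ k ℓ h₀ → toℝ[X] h ℝ[X].≈ quads zs
    realFactors≋quads {k} {ℓ} ys ≡.refl e₀ e = ℝP.≈-trans e (ℝP.≈-trans (realFactors-cong k ℓ e₀) (ℝP.≈-sym (quads-real k ℓ ys)))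

    -- The vanishing gap serves the converse direction, where it gives the real root; the `Status`
    -- serves the mutual exclusion of the cases.
    Occurs⇒roots : ∀ k ℓ c → Occurs q a₁ a₂ a₃ k ℓ c →
      ∃ λ r → Any (λ y → gap y Real.≈ Real.fromℕ 0) (all r) × Status c r
    Occurs⇒roots k ℓ I (¬sq , h₀ , w , e) =
      let y , b , e₀ = one-trace (weil⇒real w) in
      roots (sextic≋⇒vieta (ℝP.≈-trans (ℤ→ℝ.map-cong e) (ℝP.≈-trans (toℝ-x²-q²* h₀)
        (ℝP.≈-trans (ℝP.*-congˡ (x²-Q ℝ[X].^ 2) e₀) (ℝP.≈-sym (quads-2s-2s (y ∷ []))))))) (gap≈0⇒bounded gap2s≈0) (gap≈0⇒bounded gap-2s≈0) b ,
      here gap2s≈0 , ¬sq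
    Occurs⇒roots k ℓ II (sq , k+ℓ≡3 , e) =
      let zs , length-zs , gaps , split = realRoots-++ k ℓ in
      realRoots⇒roots₃ sq (≡.trans length-zs k+ℓ≡3) gaps
        (realFactors≋quads {k} {ℓ} [] (≡.trans (split []) (ListP.++-identityʳ zs)) ℝP.≈-refl e)
    Occurs⇒roots k ℓ III (sq , k+ℓ≡2 , h₀ , w , ¬root , e) =
      let zs , length-zs , gaps , split = realRoots-++ k ℓ
          y , b , e₀ = one-trace (weil⇒real w)
      in realRoots⇒roots₂ sq b (λ g → no-real-root⇒gap≉0 {y ∷ []} h₀ e₀ ¬root (here g)) (≡.trans length-zs k+ℓ≡2) gaps
           (realFactors≋quads {k} {ℓ} (y ∷ []) (split (y ∷ [])) e₀ e)
    Occurs⇒roots k ℓ IV (sq , k+ℓ≡1 , h₀ , w , ¬root , e) =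
      let zs , length-zs , gaps , split = realRoots-++ k ℓ
          y , z , b , b′ , e₀ = two-traces (weil⇒real w)
      in realRoots⇒roots₁ sq b b′ (no-real-root⇒gap≉0 {y ∷ z ∷ []} h₀ e₀ ¬root) (≡.trans length-zs k+ℓ≡1) gaps
           (realFactors≋quads {k} {ℓ} (y ∷ z ∷ []) (split (y ∷ z ∷ [])) e₀ e)

    Occurs-unique : ∀ k ℓ k′ ℓ′ c c′ → Occurs q a₁ a₂ a₃ k ℓ c → Occurs q a₁ a₂ a₃ k′ ℓ′ c′ → c ≡ c′
    Occurs-unique k ℓ k′ ℓ′ c c′ o o′ =
      let r , _ , st = Occurs⇒roots k ℓ c o ; r′ , _ , st′ = Occurs⇒roots k′ ℓ′ c′ o′ in status-unique c c′ r r′ st st′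

    Occurs⇒weil : ∀ k ℓ c → Occurs q a₁ a₂ a₃ k ℓ c → W q 3 h × HasRealRoot h
    Occurs⇒weil k ℓ c o = let r , any , _ = Occurs⇒roots k ℓ c o ; x , e = gap≈0⇒real-root any in
      roots⇒weil r , x , R.trans (ℝP.eval-cong _ _ x (factors r)) e

    square⇒integral : IsSquare q → Integral s
    square⇒integral (m , e) = + m , square-injective 0≤s (0≤-num m)
      (R.trans ss≈Q (R.trans (R.reflexive (≡.cong num (≡.trans (≡.cong +_ e) (ℤP.pos-* m m)))) (num-* (+ m) (+ m))))

    splitting⇒Occurs : IsSquare q → Splitting → ∃₂ λ k ℓ → ∃ (Occurs q a₁ a₂ a₃ k ℓ)
    splitting⇒Occurs sq (split₃ k ℓ k+ℓ≡3 e) = k , ℓ , II , sq , k+ℓ≡3 , ℝP.≈-trans toℝ-sextic (ℝP.≈-trans e (quads-real k ℓ []))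
    splitting⇒Occurs sq (split₂ k ℓ {y} k+ℓ≡2 int-y b gap≉0 e) = let c , -y≈c = integral-neg int-y ; h₀ = + q ∷ c ∷ + 1 ∷ []
                                                                     e₀ = toℝ-h₀ c -y≈c in
      k , ℓ , III , sq , k+ℓ≡2 , h₀ ,
      real⇒weil (ℕ.s≤s ℕ.z≤n) ≡.refl ≡.refl (realFactorization (y ∷ []) ≡.refl (b ∷ []) e₀) ,
      gap≉0⇒no-real-root h₀ (b ∷ []) e₀ (gap≉0 ∷ []) ,
      ℝP.≈-trans toℝ-sextic (ℝP.≈-trans e (ℝP.≈-trans (quads-real k ℓ (y ∷ [])) (realFactors-cong k ℓ (ℝP.≈-sym e₀))))
      where
      toℝ-h₀ : ∀ c → Real.- y Real.≈ num c → toℝ[X] (+ q ∷ c ∷ + 1 ∷ []) ℝ[X].≈ quads (y ∷ [])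
      toℝ-h₀ c -y≈c = ℝP.≈-trans (ℝP.∷-cong R.refl (ℝP.∷-cong (R.sym -y≈c) ℝP.≈-refl)) (ℝP.≈-sym (quads₁ y))
    splitting⇒Occurs sq (split₁ k ℓ {y} {z} k+ℓ≡1 int-y+z int-yz b b′ gap≉0 gap≉0′ e) =
      let c₀ , e₀ = integral-* int-Q int-Q
          c₁ , e₁ = integral-* int-neg int-Q
          c₂ , e₂ = integral-+ int-yz (integral-* (integral-num (+ 2)) int-Q)
          c₃ , e₃ = int-neg
          h₀ = c₀ ∷ c₁ ∷ c₂ ∷ c₃ ∷ + 1 ∷ []
          toℝ-h₀ = ℝP.≈-trans (ℝP.∷-cong (R.sym e₀) (ℝP.∷-cong (R.sym e₁) (ℝP.∷-cong (R.sym e₂) (ℝP.∷-cong (R.sym e₃) ℝP.≈-refl)))) (ℝP.≈-sym (quads₂ y z))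
      in k , ℓ , IV , sq , k+ℓ≡1 , h₀ ,
         real⇒weil (ℕ.s≤s ℕ.z≤n) ≡.refl ≡.refl (realFactorization (y ∷ z ∷ []) ≡.refl (b ∷ b′ ∷ []) toℝ-h₀) ,
         gap≉0⇒no-real-root h₀ (b ∷ b′ ∷ []) toℝ-h₀ (gap≉0 ∷ gap≉0′ ∷ []) ,
         ℝP.≈-trans toℝ-sextic (ℝP.≈-trans e (ℝP.≈-trans (quads-real k ℓ (y ∷ z ∷ [])) (realFactors-cong k ℓ (ℝP.≈-sym toℝ-h₀))))
      where
      int-neg = integral-neg int-y+z

    non-square⇒Occurs : ¬ IsSquare q → Roots → Endpoint → Occurs q a₁ a₂ a₃ 0 0 I
    non-square⇒Occurs ¬sq r endpoint = ¬sq , h₀ ,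
      real⇒weil (ℕ.s≤s ℕ.z≤n) ≡.refl ≡.refl (realFactorization (Real.- α₁ ∷ []) ≡.refl (bounded ∷ []) e₀) ,
      toℝ-injective (ℝP.≈-trans toℝ-sextic (ℝP.≈-trans (vieta⇒sextic≋quads v)
        (ℝP.≈-trans (quads-2s-2s (Real.- α₁ ∷ [])) (ℝP.≈-trans (ℝP.*-congˡ (x²-Q ℝ[X].^ 2) (ℝP.≈-sym e₀)) (ℝP.≈-sym (toℝ-x²-q²* h₀))))))
      where
      h₀ : ℤ[X].Poly
      -- The cubic is `(y² - 4Q)(y + α₁)`, and its root `- α₁` corresponds to the factor
      -- `x² + a₁x + q`.
      h₀ = + q ∷ a₁ ∷ + 1 ∷ []
      v = non-square-vieta endpoint (P²≡qR²⇒≡0 ¬sq P₀ R₀)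
      bounded = admissible⇒bounded (admissible r) (proj₂ (proj₂ (vieta-root v)))
      e₀ : toℝ[X] h₀ ℝ[X].≈ quads (Real.- α₁ ∷ [])
      e₀ = ℝP.≈-trans (ℝP.∷-cong R.refl (ℝP.∷-cong (solve 1 (λ x → x := :- (:- x)) α₁) ℝP.≈-refl)) (ℝP.≈-sym (quads₁ (Real.- α₁)))

    real-root⇒Occurs : Dec (IsSquare q) → W q 3 h × HasRealRoot h → ∃₂ λ k ℓ → ∃ (Occurs q a₁ a₂ a₃ k ℓ)
    real-root⇒Occurs (yes sq) (w , root) = let r = weil⇒roots w in
      splitting⇒Occurs sq (splitting (square⇒integral sq) (admissible r) (real-root⇒endpoint r root))
    real-root⇒Occurs (no ¬sq) (w , root) = let r = weil⇒roots w in
      0 , 0 , I , non-square⇒Occurs ¬sq r (real-root⇒endpoint r root)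

open import Data.Nat.Base using (_^_; _≤_)

theoremA : ∀ (p n q : ℕ) → Prime p → 1 ≤ n → q ≡ p ^ n → ∀ (a₁ a₂ a₃ : ℤ) →
    let h = sextic q a₁ a₂ a₃
        module H = Conditions q a₁ a₂ a₃
    in
      (W q 3 h ⇔ (H.a × H.b* × H.b × H.c × H.d))
      × (H.b → Real.fromℕ 0 Real.≤ H.radicand)
      × (W q 3 h → (HasRealRoot h ⇔ (H.a-equality ⊎ H.b*-equality ⊎ H.d-equality)))
      × ((W q 3 h × HasRealRoot h) ⇔ (∃ λ k → ∃ λ ℓ → ∃! _≡_ (Occurs q a₁ a₂ a₃ k ℓ)))
      × (∀ k ℓ k′ ℓ′ c c′ → Occurs q a₁ a₂ a₃ k ℓ c → Occurs q a₁ a₂ a₃ k′ ℓ′ c′ → c ≡ c′)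
theoremA p n q _ _ _ a₁ a₂ a₃ =
  weil⇔conditions ,
  b⇒0≤radicand ,
  real-root⇔equality ,
  mk⇔ (λ w → let k , ℓ , c , o = real-root⇒Occurs (isSquare? q) w in k , ℓ , c , o , λ {c′} → Occurs-unique k ℓ k ℓ c c′ o)
    (λ (k , ℓ , c , o , _) → Occurs⇒weil k ℓ c o) ,
  Occurs-unique
  where
  open WeilPolynomials q
  open Classification a₁ a₂ a₃
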